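{- Let $W$ be a world of $\mathrm{LO}^{\mathrm{emb}}$. Then $\mathrm{Val}_{\mathrm{LO}^{\mathrm{emb}}}(W,\mathcal L^{\Diamond}_{\le}(W))=\mathsf{S4.2}$ if and only if $W$ has infinitely many adjacent pairs.
   Context: Linear orders are total orders, possibly empty. $\mathrm{LO}^{\mathrm{emb}}$ is the category of linear orders and order-embeddings. $\mathcal L^{\Diamond}_{\le}(W)$ is the modal extension (operators $\Diamond,\Box$) of the language $\{\le\}$ with constants naming the elements of $W$ (transported along morphisms). Modal satisfaction: $U\models\Diamond\varphi[\nu]$ iff there is a morphism $f:U\to V$ with $V\models\varphi[f\circ\nu]$; $\Box$ dually. $\mathrm{Val}(W,\Gamma)$ is the set of propositional modal formulas $\psi(p_0,\dots,p_n)$ all of whose substitution instances $\psi(\varphi_0,\dots,\varphi_n)$ with $\varphi_i\in\Gamma$ hold at $W$. $\mathsf{S4.2}$ is the normal modal logic axiomatized by $\Box p\to p$, $\Box p\to\Box\Box p$, and $\Diamond\Box p\to\Box\Diamond p$. An adjacent pair in $W$ is a pair $x<y$ with no $z$ satisfying $x<z<y$. -}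

module Defs where

open import Level using (Level; 0ℓ; Lift) renaming (suc to lsuc)
open import Data.Nat using (ℕ; zero; suc)
open import Data.Fin using (Fin; zero; suc)
open import Data.Bool using (Bool; true; false; _∧_; _∨_; not)
open import Data.Product using (Σ; Σ-syntax; _×_; _,_; proj₁; proj₂)
open import Data.Sum using (_⊎_)
open import Data.Empty using (⊥)
open import Data.Unit using (⊤)
open import Function using (Injective)
open import Relation.Nullary using (¬_)
open import Relation.Binary.PropositionalEquality using (_≡_; _≢_)
open import Relation.Binary.Structures using (IsTotalOrder)

record LO : Set₁ where
  field
    Carrier      : Set
    _≤_          : Carrier → Carrier → Set
    isTotalOrder : IsTotalOrder _≡_ _≤_

open LO public

-- order-embedding: preserves and reflects ≤ (hence injective)
record Emb (U V : LO) : Set where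
  field
    fun     : Carrier U → Carrier V
    mono    : ∀ {x y} → _≤_ U x y → _≤_ V (fun x) (fun y)
    reflect : ∀ {x y} → _≤_ V (fun x) (fun y) → _≤_ U x y

open Emb public

idE : (U : LO) → Emb U U
idE U = record { fun = λ x → x ; mono = λ p → p ; reflect = λ p → p }

_∘E_ : {U V X : LO} → Emb V X → Emb U V → Emb U X
g ∘E f = record
  { fun     = λ x → fun g (fun f x)
  ; mono    = λ p → mono g (mono f p)
  ; reflect = λ p → reflect f (reflect g p) }

data Term (W : LO) (n : ℕ) : Set where
  var : Fin n → Term W n
  con : Carrier W → Term W n

data Form (W : LO) : ℕ → Set where
  _≤ᶠ_ : ∀ {n} → Term W n → Term W n → Form W n
  _≐_  : ∀ {n} → Term W n → Term W n → Form W n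
  ⊥ᶠ ⊤ᶠ : ∀ {n} → Form W n
  ¬ᶠ_  : ∀ {n} → Form W n → Form W n
  _∧ᶠ_ _∨ᶠ_ _⇒ᶠ_ : ∀ {n} → Form W n → Form W n → Form W n
  ∀ᶠ ∃ᶠ : ∀ {n} → Form W (suc n) → Form W n
  ◇ᶠ □ᶠ : ∀ {n} → Form W n → Form W n

Sentence : LO → Set
Sentence W = Form W 0

extend : ∀ {A : Set} {n} → A → (Fin n → A) → Fin (suc n) → A
extend a ρ zero    = a
extend a ρ (suc i) = ρ i

⟦_⟧ₜ : ∀ {W U n} → Term W n → Emb W U → (Fin n → Carrier U) → Carrier U
⟦ var i ⟧ₜ c ρ = ρ i
⟦ con w ⟧ₜ c ρ = fun c w

Sat : ∀ {W n} (U : LO) → Emb W U → (Fin n → Carrier U) → Form W n → Set₁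
Sat U c ρ (s ≤ᶠ t) = Lift (lsuc 0ℓ) (_≤_ U (⟦ s ⟧ₜ c ρ) (⟦ t ⟧ₜ c ρ))
Sat U c ρ (s ≐ t)  = Lift (lsuc 0ℓ) (⟦ s ⟧ₜ c ρ ≡ ⟦ t ⟧ₜ c ρ)
Sat U c ρ ⊥ᶠ       = Lift (lsuc 0ℓ) ⊥
Sat U c ρ ⊤ᶠ       = Lift (lsuc 0ℓ) ⊤
Sat U c ρ (¬ᶠ φ)   = ¬ Sat U c ρ φ
Sat U c ρ (φ ∧ᶠ ψ) = Sat U c ρ φ × Sat U c ρ ψ
Sat U c ρ (φ ∨ᶠ ψ) = Sat U c ρ φ ⊎ Sat U c ρ ψ
Sat U c ρ (φ ⇒ᶠ ψ) = Sat U c ρ φ → Sat U c ρ ψ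
Sat U c ρ (∀ᶠ φ)   = (x : Carrier U) → Sat U c (extend x ρ) φ
Sat U c ρ (∃ᶠ φ)   = Σ[ x ∈ Carrier U ] Sat U c (extend x ρ) φ
Sat U c ρ (◇ᶠ φ)   = Σ[ V ∈ LO ] Σ[ f ∈ Emb U V ] Sat V (f ∘E c) (λ i → fun f (ρ i)) φ
Sat U c ρ (□ᶠ φ)   = (V : LO) (f : Emb U V) → Sat V (f ∘E c) (λ i → fun f (ρ i)) φ

TrueAt : (W : LO) → Sentence W → Set₁
TrueAt W φ = Sat W (idE W) (λ ()) φ

data PForm : Set where
  pvar : ℕ → PForm
  ⊥ₚ ⊤ₚ : PForm
  ¬ₚ_ : PForm → PForm
  _∧ₚ_ _∨ₚ_ _⇒ₚ_ : PForm → PForm → PForm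
  ◇ₚ □ₚ : PForm → PForm

_⇔ₚ_ : PForm → PForm → PForm
a ⇔ₚ b = (a ⇒ₚ b) ∧ₚ (b ⇒ₚ a)

inst : ∀ {W} → (ℕ → Sentence W) → PForm → Sentence W
inst σ (pvar i)  = σ i
inst σ ⊥ₚ        = ⊥ᶠ
inst σ ⊤ₚ        = ⊤ᶠ
inst σ (¬ₚ a)    = ¬ᶠ (inst σ a)
inst σ (a ∧ₚ b)  = inst σ a ∧ᶠ inst σ b
inst σ (a ∨ₚ b)  = inst σ a ∨ᶠ inst σ b
inst σ (a ⇒ₚ b)  = inst σ a ⇒ᶠ inst σ b
inst σ (◇ₚ a)    = ◇ᶠ (inst σ a)
inst σ (□ₚ a)    = □ᶠ (inst σ a)

Val : (W : LO) → PForm → Set₁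
Val W ψ = (σ : ℕ → Sentence W) → TrueAt W (inst σ ψ)

-- propositional tautologies: true under every Boolean valuation in which
-- variables and modalised subformulas are treated as atoms
evalB : (PForm → Bool) → PForm → Bool
evalB v (pvar i) = v (pvar i)
evalB v ⊥ₚ       = false
evalB v ⊤ₚ       = true
evalB v (¬ₚ a)   = not (evalB v a)
evalB v (a ∧ₚ b) = evalB v a ∧ evalB v b
evalB v (a ∨ₚ b) = evalB v a ∨ evalB v b
evalB v (a ⇒ₚ b) = not (evalB v a) ∨ evalB v b
evalB v (◇ₚ a)   = v (◇ₚ a)
evalB v (□ₚ a)   = v (□ₚ a)

Tautology : PForm → Set
Tautology ψ = (v : PForm → Bool) → evalB v ψ ≡ true

-- Hilbert system; axioms are given as schemata (equivalent to closing the
-- single axioms under uniform substitution)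
data S4·2 : PForm → Set where
  taut : ∀ {a} → Tautology a → S4·2 a
  axK  : ∀ a b → S4·2 (□ₚ (a ⇒ₚ b) ⇒ₚ (□ₚ a ⇒ₚ □ₚ b))
  axDual : ∀ a → S4·2 (◇ₚ a ⇔ₚ (¬ₚ (□ₚ (¬ₚ a))))
  axT  : ∀ a → S4·2 (□ₚ a ⇒ₚ a)
  ax4  : ∀ a → S4·2 (□ₚ a ⇒ₚ □ₚ (□ₚ a))
  ax2  : ∀ a → S4·2 (◇ₚ (□ₚ a) ⇒ₚ □ₚ (◇ₚ a))
  mp   : ∀ {a b} → S4·2 (a ⇒ₚ b) → S4·2 a → S4·2 b
  nec  : ∀ {a} → S4·2 a → S4·2 (□ₚ a)

Adjacent : (W : LO) → Carrier W → Carrier W → Set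
Adjacent W x y = (_≤_ W x y × x ≢ y)
               × ¬ (Σ[ z ∈ Carrier W ] ((_≤_ W x z × x ≢ z) × (_≤_ W z y × z ≢ y)))

InfinitelyManyAdjacentPairs : LO → Set
InfinitelyManyAdjacentPairs W =
  (n : ℕ) → Σ[ f ∈ (Fin n → Carrier W × Carrier W) ]
              (Injective _≡_ _≡_ f × ((i : Fin n) → Adjacent W (proj₁ (f i)) (proj₂ (f i))))

{-# OPTIONS --safe #-}
module Submission where

-- Soundness of S4.2 at every W is the amalgamation property of linear orders.
--
-- Suppose W has infinitely many adjacent pairs.  A non-theorem of S4.2 fails at the root of a
-- finite preorder with a greatest cluster.  Take one adjacent pair (a , b) per world of that
-- frame: "some x lies strictly between a and b" is a button, the buttons are independent, and
-- the final part of the order supplies a dial.  A set of pushed buttons denotes the maximum of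
-- the chain it forms together with the root (the greatest cluster if it is not a chain), and the
-- dial selects a world inside the cluster.  This is a p-morphism from the extensions of W onto
-- the frame, so the countermodel is simulated at W.
--
-- Suppose W has finitely many adjacent pairs.  By an Ehrenfeucht–Fraïssé argument, the truth of
-- □ φ in an extension of W depends only on the sizes, truncated at some N, of the gaps between
-- the constants of φ, and grows with them: a segment with many points is d-equivalent to one
-- containing any prescribed order.  In an extension where no gap can grow further without
-- making one of m given necessities true, making exactly the i-th one true needs a new point in
-- a gap j(i), and j is injective because that single point already decides which necessity
-- becomes true.  The gaps j(i) are small already in W, so apart from the two outer ones they
-- contain distinct adjacent pairs.  Hence for large m the formula refuted by the fork with m
-- prongs and a common top is valid at W.

open import Defs
open import Level using (Level; 0ℓ; Lift; lift; lower) renaming (suc to lsuc)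
open import Axiom.ExcludedMiddle using (ExcludedMiddle)
open import Data.Bool using (Bool; true; false; _∧_; _∨_; not; if_then_else_)
open import Data.Empty using (⊥; ⊥-elim)
open import Data.Fin using (Fin; zero; suc; toℕ; fromℕ<; inject₁; combine; funToFin; finToFun)
open import Data.Fin.Permutation.Components using (transpose; transpose-inverse)
open import Data.Fin.Properties using (_≟_; <-cmp; toℕ<n; toℕ-injective; toℕ-fromℕ<; toℕ-inject₁; pigeonhole; combine-injective; finToFun-funToFin) renaming (≤-isTotalOrder to Fin-≤-isTotalOrder)
open import Data.Integer as ℤ using (ℤ; +_)
import Data.Integer.Properties as ℤ
open import Data.List using (List; []; _∷_; _++_; length; lookup; allFin; upTo; cartesianProduct) renaming (map to mapᴸ; tabulate to tabulateᴸ)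
open import Data.List.Membership.Propositional using (_∈_)
open import Data.List.Membership.Propositional.Properties using (∈-++⁺ˡ; ∈-++⁺ʳ; ∈-map⁺; ∈-allFin; ∈-upTo⁺; ∈-cartesianProduct⁺; ∈-tabulate⁺)
open import Data.List.Relation.Unary.Any as Any using (here; there)
open import Data.List.Relation.Unary.Any.Properties using (lookup-index)
open import Data.Maybe as Maybe using (Maybe; just; nothing)
open import Data.Nat as ℕ using (ℕ; zero; suc; z≤n; s≤s; _^_; _⊔_)
import Data.Nat.Properties as ℕ
open import Data.Product using (Σ-syntax; ∃; _×_; _,_; proj₁; proj₂; swap)
open import Data.Sum using (_⊎_; inj₁; inj₂)
open import Data.Unit using (⊤; tt)
open import Data.Vec as Vec using (Vec; []; _∷_; tabulate)
open import Data.Vec.Properties using (lookup-map; lookup∘tabulate)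
open import Function using (_∘_; id; case_of_; Injective)
open import Function.Bundles using (_⇔_; mk⇔; Equivalence)
open import Relation.Binary.Definitions using (tri<; tri≈; tri>)
open import Relation.Binary.PropositionalEquality using (_≡_; _≢_; refl; sym; trans; cong; cong₂; subst; subst₂; isEquivalence)
open import Relation.Binary.Structures using (IsTotalOrder)
open import Relation.Nullary using (¬_; Dec; yes; no; does)
open import Relation.Nullary.Decidable using (map′; dec-true; recompute)

open Equivalence using (to; from)

-- Kripke models

-- The formula refuted by the fork must be fixed before the substitution is known, while the number
-- of gaps grows with the constants substituted. The bound is uniform because large gaps are never
-- counted: only a gap still small in `W` can make a necessity true, and each inner one needs an
-- adjacent pair of its own. The fork has a common top because it has to be a frame for S4.2.
--
-- The substituted sentences are modal and may quantify into modal contexts, so ordinary elementary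
-- equivalence is not enough: when one of two equivalent structures is extended, the other needs an
-- extension that is equivalent again. Extensions have arbitrary size and order type, hence the need
-- for equivalent segments that contain a prescribed order. A modality therefore costs as many
-- rounds as it takes to compare gap sizes up to the bound from which pumping is possible.
--
-- In the other direction, pushed buttons stay pushed, so they cannot account for moves back and
-- forth inside a cluster. The dial can: a new final part resets it and leaves all buttons alone.

record Model (a : Level) : Set (lsuc a) where
  field
    World : Set a
    _↝_   : World → World → Set
    val   : World → ℕ → Set a

open Model

forces : ∀ {a} (M : Model a) → World M → PForm → Set a
forces M w (pvar i)  = val M w i
forces M w ⊥ₚ        = Lift _ ⊥
forces M w ⊤ₚ        = Lift _ ⊤
forces M w (¬ₚ φ)    = ¬ forces M w φ
forces M w (φ ∧ₚ ψ)  = forces M w φ × forces M w ψ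
forces M w (φ ∨ₚ ψ)  = forces M w φ ⊎ forces M w ψ
forces M w (φ ⇒ₚ ψ)  = forces M w φ → forces M w ψ
forces M w (◇ₚ φ)    = Σ[ v ∈ World M ] (_↝_ M w v × forces M v φ)
forces M w (□ₚ φ)    = ∀ v → _↝_ M w v → forces M v φ

record DirectedPreorder {a} (M : Model a) : Set a where
  field
    ↝-refl     : ∀ w → _↝_ M w w
    ↝-trans    : ∀ {u v w} → _↝_ M u v → _↝_ M v w → _↝_ M u w
    ↝-directed : ∀ {u v w} → _↝_ M u v → _↝_ M u w → Σ[ x ∈ World M ] (_↝_ M v x × _↝_ M w x)

record PMorphism {a b} (M : Model a) (N : Model b) : Set (a Level.⊔ b) where
  field
    image : World M → World N
    atoms : ∀ w i → val M w i ⇔ val N (image w) i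
    forth : ∀ {w v} → _↝_ M w v → _↝_ N (image w) (image v)
    back  : ∀ {w x} → _↝_ N (image w) x → Σ[ v ∈ World M ] (_↝_ M w v × image v ≡ x)

module _ {a b} {M : Model a} {N : Model b} (F : PMorphism M N) where
  open PMorphism F

  forces-image : ∀ φ w → forces M w φ ⇔ forces N (image w) φ
  forces-image (pvar i) w = atoms w i
  forces-image ⊥ₚ w = mk⇔ (λ ()) (λ ())
  forces-image ⊤ₚ w = mk⇔ (λ _ → lift tt) (λ _ → lift tt)
  forces-image (¬ₚ φ) w = mk⇔ (λ k p → k (from (forces-image φ w) p)) (λ k p → k (to (forces-image φ w) p))
  forces-image (φ ∧ₚ ψ) w = mk⇔
    (λ (p , q) → to (forces-image φ w) p , to (forces-image ψ w) q)
    (λ (p , q) → from (forces-image φ w) p , from (forces-image ψ w) q)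
  forces-image (φ ∨ₚ ψ) w = mk⇔
    (λ { (inj₁ p) → inj₁ (to (forces-image φ w) p) ; (inj₂ q) → inj₂ (to (forces-image ψ w) q) })
    (λ { (inj₁ p) → inj₁ (from (forces-image φ w) p) ; (inj₂ q) → inj₂ (from (forces-image ψ w) q) })
  forces-image (φ ⇒ₚ ψ) w = mk⇔
    (λ k p → to (forces-image ψ w) (k (from (forces-image φ w) p)))
    (λ k p → from (forces-image ψ w) (k (to (forces-image φ w) p)))
  forces-image (◇ₚ φ) w = mk⇔
    (λ (v , r , p) → image v , forth r , to (forces-image φ v) p)
    (λ (x , r , p) → let (v , s , e) = back r in
      v , s , from (forces-image φ v) (subst (λ y → forces N y φ) (sym e) p))
  forces-image (□ₚ φ) w = mk⇔
    (λ k x r → let (v , s , e) = back r in subst (λ y → forces N y φ) e (to (forces-image φ v) (k v s)))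
    (λ k v r → from (forces-image φ v) (k (image v) (forth r)))

module _ {a} (em : ExcludedMiddle a) (M : Model a) where

  private
    truth : World M → PForm → Bool
    truth w φ = does (em {forces M w φ})

    truth-sound : ∀ w φ → truth w φ ≡ true → forces M w φ
    truth-sound w φ e with em {forces M w φ}
    ... | yes p = p
    truth-sound w φ () | no _

    truth-complete : ∀ w φ → forces M w φ → truth w φ ≡ true
    truth-complete w φ p with em {forces M w φ}
    ... | yes _ = refl
    ... | no k = ⊥-elim (k p)

    evalB⇔forces : ∀ w φ → (evalB (truth w) φ ≡ true) ⇔ forces M w φ
    evalB⇔forces w (pvar i) = mk⇔ (truth-sound w (pvar i)) (truth-complete w (pvar i))
    evalB⇔forces w ⊥ₚ = mk⇔ (λ ()) (λ ())
    evalB⇔forces w ⊤ₚ = mk⇔ (λ _ → lift tt) (λ _ → refl)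
    evalB⇔forces w (¬ₚ φ) with evalB (truth w) φ | evalB⇔forces w φ
    ... | true  | ih = mk⇔ (λ ()) (λ k → ⊥-elim (k (to ih refl)))
    ... | false | ih = mk⇔ (λ _ p → case from ih p of λ ()) (λ _ → refl)
    evalB⇔forces w (φ ∧ₚ ψ) with evalB (truth w) φ | evalB⇔forces w φ
    ... | true  | ih = mk⇔ (λ e → to ih refl , to (evalB⇔forces w ψ) e) (λ (_ , q) → from (evalB⇔forces w ψ) q)
    ... | false | ih = mk⇔ (λ ()) (λ (p , _) → from ih p)
    evalB⇔forces w (φ ∨ₚ ψ) with evalB (truth w) φ | evalB⇔forces w φ
    ... | true  | ih = mk⇔ (λ _ → inj₁ (to ih refl)) (λ _ → refl)
    ... | false | ih = mk⇔ (λ e → inj₂ (to (evalB⇔forces w ψ) e))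
                           (λ { (inj₁ p) → (case from ih p of λ ()) ; (inj₂ q) → from (evalB⇔forces w ψ) q })
    evalB⇔forces w (φ ⇒ₚ ψ) with evalB (truth w) φ | evalB⇔forces w φ
    ... | true  | ih = mk⇔ (λ e _ → to (evalB⇔forces w ψ) e) (λ k → from (evalB⇔forces w ψ) (k (to ih refl)))
    ... | false | ih = mk⇔ (λ _ p → (case from ih p of λ ())) (λ _ → refl)
    evalB⇔forces w (◇ₚ φ) = mk⇔ (truth-sound w (◇ₚ φ)) (truth-complete w (◇ₚ φ))
    evalB⇔forces w (□ₚ φ) = mk⇔ (truth-sound w (□ₚ φ)) (truth-complete w (□ₚ φ))

  S4·2-sound : DirectedPreorder M → ∀ {φ} → S4·2 φ → ∀ w → forces M w φ
  S4·2-sound D = go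
    where
    open DirectedPreorder D
    go : ∀ {φ} → S4·2 φ → ∀ w → forces M w φ
    go (taut {φ} t) w = to (evalB⇔forces w φ) (t (truth w))
    go (axK φ ψ) w k p v r = k v r (p v r)
    go (axDual φ) w = (λ (v , r , p) k → k v r p) , λ k → stable k
      where
      stable : ¬ (∀ v → _↝_ M w v → ¬ forces M v φ) → forces M w (◇ₚ φ)
      stable k with em {forces M w (◇ₚ φ)}
      ... | yes p = p
      ... | no n = ⊥-elim (k (λ v r p → n (v , r , p)))
    go (axT φ) w k = k w (↝-refl w)
    go (ax4 φ) w k v r u s = k u (↝-trans r s)
    go (ax2 φ) w (v , r , k) u s = let (x , r' , s') = ↝-directed r s in x , s' , k x r'
    go (mp d e) w = go d w (go e w)
    go (nec d) w v _ = go d v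

-- Finite countermodels for S4.2

data Schema (n : ℕ) : Set where
  `_       : Fin n → Schema n
  ¬ˢ_      : Schema n → Schema n
  _∧ˢ_ _∨ˢ_ _⇒ˢ_ : Schema n → Schema n → Schema n

infix  9 `_
infix  8 ¬ˢ_
infixr 7 _∧ˢ_
infixr 6 _∨ˢ_
infixr 5 _⇒ˢ_

plug : ∀ {n} → Schema n → Vec PForm n → PForm
plug (` i)    as = Vec.lookup as i
plug (¬ˢ s)   as = ¬ₚ plug s as
plug (s ∧ˢ t) as = plug s as ∧ₚ plug t as
plug (s ∨ˢ t) as = plug s as ∨ₚ plug t as
plug (s ⇒ˢ t) as = plug s as ⇒ₚ plug t as

evalˢ : ∀ {n} → Schema n → Vec Bool n → Bool
evalˢ (` i)    bs = Vec.lookup bs i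
evalˢ (¬ˢ s)   bs = not (evalˢ s bs)
evalˢ (s ∧ˢ t) bs = evalˢ s bs ∧ evalˢ t bs
evalˢ (s ∨ˢ t) bs = evalˢ s bs ∨ evalˢ t bs
evalˢ (s ⇒ˢ t) bs = not (evalˢ s bs) ∨ evalˢ t bs

everywhere : ∀ n → (Vec Bool n → Bool) → Bool
everywhere zero    f = f []
everywhere (suc n) f = everywhere n (f ∘ (true ∷_)) ∧ everywhere n (f ∘ (false ∷_))

∧-true : ∀ {a b} → a ∧ b ≡ true → (a ≡ true) × (b ≡ true)
∧-true {true} {true} refl = refl , refl

everywhere-elim : ∀ n f → everywhere n f ≡ true → ∀ bs → f bs ≡ true
everywhere-elim zero f e [] = e
everywhere-elim (suc n) f e (true ∷ bs) = everywhere-elim n _ (proj₁ (∧-true e)) bs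
everywhere-elim (suc n) f e (false ∷ bs) = everywhere-elim n _ (proj₂ (∧-true {everywhere n (f ∘ (true ∷_))} e)) bs

evalB-plug : ∀ {n} (s : Schema n) as v → evalB v (plug s as) ≡ evalˢ s (Vec.map (evalB v) as)
evalB-plug (` i)    as v = sym (lookup-map i (evalB v) as)
evalB-plug (¬ˢ s)   as v = cong not (evalB-plug s as v)
evalB-plug (s ∧ˢ t) as v = cong₂ _∧_ (evalB-plug s as v) (evalB-plug t as v)
evalB-plug (s ∨ˢ t) as v = cong₂ _∨_ (evalB-plug s as v) (evalB-plug t as v)
evalB-plug (s ⇒ˢ t) as v = cong₂ (λ a b → not a ∨ b) (evalB-plug s as v) (evalB-plug t as v)

-- Propositional tautologies are proved by evaluating the truth table of a schema.
tautology : ∀ {n} (s : Schema n) → everywhere n (evalˢ s) ≡ true → ∀ as → S4·2 (plug s as)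
tautology s e as = taut (λ v → trans (evalB-plug s as v) (everywhere-elim _ _ e (Vec.map (evalB v) as)))

-- Derived rules of S4.2

infix 4 _⊢_
_⊢_ : PForm → PForm → Set
a ⊢ b = S4·2 (a ⇒ₚ b)

private
  𝐩 𝐪 𝐫 : Schema 3
  𝐩 = ` zero
  𝐪 = ` suc zero
  𝐫 = ` suc (suc zero)

⊢-refl : ∀ {a} → a ⊢ a
⊢-refl {a} = tautology (𝐩 ⇒ˢ 𝐩) refl (a ∷ a ∷ a ∷ [])

⊢-trans : ∀ {a b c} → a ⊢ b → b ⊢ c → a ⊢ c
⊢-trans {a} {b} {c} d e = mp (mp (tautology ((𝐩 ⇒ˢ 𝐪) ⇒ˢ (𝐪 ⇒ˢ 𝐫) ⇒ˢ (𝐩 ⇒ˢ 𝐫)) refl (a ∷ b ∷ c ∷ [])) d) e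

⊢-pair : ∀ {a b c} → a ⊢ b → a ⊢ c → a ⊢ b ∧ₚ c
⊢-pair {a} {b} {c} d e =
  mp (mp (tautology ((𝐩 ⇒ˢ 𝐪) ⇒ˢ (𝐩 ⇒ˢ 𝐫) ⇒ˢ (𝐩 ⇒ˢ 𝐪 ∧ˢ 𝐫)) refl (a ∷ b ∷ c ∷ [])) d) e

⊢-fst : ∀ {a b} → a ∧ₚ b ⊢ a
⊢-fst {a} {b} = tautology (𝐩 ∧ˢ 𝐪 ⇒ˢ 𝐩) refl (a ∷ b ∷ b ∷ [])

⊢-snd : ∀ {a b} → a ∧ₚ b ⊢ b
⊢-snd {a} {b} = tautology (𝐩 ∧ˢ 𝐪 ⇒ˢ 𝐪) refl (a ∷ b ∷ b ∷ [])

⊢-weaken : ∀ {a b} → S4·2 b → a ⊢ b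
⊢-weaken {a} {b} d = mp (tautology (𝐪 ⇒ˢ 𝐩 ⇒ˢ 𝐪) refl (a ∷ b ∷ b ∷ [])) d

⊢-mp : ∀ {a b c} → a ⊢ b ⇒ₚ c → a ⊢ b → a ⊢ c
⊢-mp {a} {b} {c} d e =
  mp (mp (tautology ((𝐩 ⇒ˢ 𝐪 ⇒ˢ 𝐫) ⇒ˢ (𝐩 ⇒ˢ 𝐪) ⇒ˢ (𝐩 ⇒ˢ 𝐫)) refl (a ∷ b ∷ c ∷ [])) d) e

⊢-contra : ∀ {a b} → a ⊢ b → ¬ₚ b ⊢ ¬ₚ a
⊢-contra {a} {b} d = mp (tautology ((𝐩 ⇒ˢ 𝐪) ⇒ˢ (¬ˢ 𝐪 ⇒ˢ ¬ˢ 𝐩)) refl (a ∷ b ∷ b ∷ [])) d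

⊢-clash : ∀ {a b} → a ⊢ b → a ⊢ ¬ₚ b → S4·2 (¬ₚ a)
⊢-clash {a} {b} d e = mp (mp (tautology ((𝐩 ⇒ˢ 𝐪) ⇒ˢ (𝐩 ⇒ˢ ¬ˢ 𝐪) ⇒ˢ ¬ˢ 𝐩) refl (a ∷ b ∷ b ∷ [])) d) e

¬¬-intro : ∀ {a} → a ⊢ ¬ₚ (¬ₚ a)
¬¬-intro {a} = tautology (𝐩 ⇒ˢ ¬ˢ ¬ˢ 𝐩) refl (a ∷ a ∷ a ∷ [])

¬¬-elim : ∀ {a} → ¬ₚ (¬ₚ a) ⊢ a
¬¬-elim {a} = tautology (¬ˢ ¬ˢ 𝐩 ⇒ˢ 𝐩) refl (a ∷ a ∷ a ∷ [])

□-mono : ∀ {a b} → a ⊢ b → □ₚ a ⊢ □ₚ b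
□-mono d = mp (axK _ _) (nec d)

□-pair : ∀ {a b} → (□ₚ a ∧ₚ □ₚ b) ⊢ □ₚ (a ∧ₚ b)
□-pair {a} {b} =
  ⊢-mp (⊢-trans ⊢-fst (⊢-trans (□-mono (tautology (𝐩 ⇒ˢ 𝐪 ⇒ˢ 𝐩 ∧ˢ 𝐪) refl (a ∷ b ∷ b ∷ []))) (axK _ _))) ⊢-snd

-- ◆ is the possibility operator written with □, so that it is literally a negation.
◆ : PForm → PForm
◆ a = ¬ₚ (□ₚ (¬ₚ a))

◆-mono : ∀ {a b} → a ⊢ b → ◆ a ⊢ ◆ b
◆-mono d = ⊢-contra (□-mono (⊢-contra d))

◆-intro : ∀ {a} → a ⊢ ◆ a
◆-intro = ⊢-trans ¬¬-intro (⊢-contra (axT _))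

◆◆-elim : ∀ {a} → ◆ (◆ a) ⊢ ◆ a
◆◆-elim = ⊢-contra (⊢-trans (ax4 _) (□-mono ¬¬-intro))

□◆-meet : ∀ {a b c} → a ⊢ □ₚ b → a ⊢ ◆ c → a ⊢ ◆ (b ∧ₚ c)
□◆-meet {a} {b} {c} d e = mp (mp (tautology ((𝐩 ∧ˢ 𝐪 ⇒ˢ 𝐫) ⇒ˢ (𝐩 ⇒ˢ ¬ˢ 𝐫) ⇒ˢ (𝐩 ⇒ˢ ¬ˢ 𝐪)) refl
    (a ∷ □ₚ (¬ₚ (b ∧ₚ c)) ∷ □ₚ (¬ₚ c) ∷ []))
    (⊢-trans (⊢-pair (⊢-trans ⊢-fst d) ⊢-snd) (⊢-trans □-pair (□-mono
      (tautology (𝐩 ∧ˢ ¬ˢ (𝐩 ∧ˢ 𝐪) ⇒ˢ ¬ˢ 𝐪) refl (b ∷ c ∷ c ∷ [])))))) e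

◇⊢◆ : ∀ {a} → ◇ₚ a ⊢ ◆ a
◇⊢◆ = mp ⊢-fst (axDual _)

◆⊢◇ : ∀ {a} → ◆ a ⊢ ◇ₚ a
◆⊢◇ = mp ⊢-snd (axDual _)

-- The only derivation from `ax2`. A possible necessity is necessarily possible, so a world with
-- `□ₚ c` still sees one with `□ₚ b`, and `ax4` carries `□ₚ c` there.
◆□-meet : ∀ {a b c} → a ⊢ ◆ (□ₚ b) → a ⊢ ◆ (□ₚ c) → a ⊢ ◆ (□ₚ (b ∧ₚ c))
◆□-meet d e = ⊢-trans (□◆-meet □◆□b e)
    (⊢-trans (◆-mono (□◆-meet (⊢-trans ⊢-snd (ax4 _)) ⊢-fst))
      (⊢-trans ◆◆-elim (◆-mono (⊢-trans (⊢-pair ⊢-snd ⊢-fst) □-pair))))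
  where
  □◆□b = ⊢-trans d (⊢-trans (◆-mono (ax4 _)) (⊢-trans ◆⊢◇ (⊢-trans (ax2 _) (□-mono ◇⊢◆))))

subformulas : PForm → List PForm
subformulas (pvar i) = pvar i ∷ []
subformulas ⊥ₚ       = ⊥ₚ ∷ []
subformulas ⊤ₚ       = ⊤ₚ ∷ []
subformulas (¬ₚ a)   = (¬ₚ a) ∷ subformulas a
subformulas (a ∧ₚ b) = (a ∧ₚ b) ∷ (subformulas a ++ subformulas b)
subformulas (a ∨ₚ b) = (a ∨ₚ b) ∷ (subformulas a ++ subformulas b)
subformulas (a ⇒ₚ b) = (a ⇒ₚ b) ∷ (subformulas a ++ subformulas b)
subformulas (◇ₚ a)   = ◇ₚ a ∷ subformulas a
subformulas (□ₚ a)   = □ₚ a ∷ subformulas a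

subformula-self : ∀ a → a ∈ subformulas a
subformula-self (pvar i) = here refl
subformula-self ⊥ₚ       = here refl
subformula-self ⊤ₚ       = here refl
subformula-self (¬ₚ a)   = here refl
subformula-self (a ∧ₚ b) = here refl
subformula-self (a ∨ₚ b) = here refl
subformula-self (a ⇒ₚ b) = here refl
subformula-self (◇ₚ a)   = here refl
subformula-self (□ₚ a)   = here refl

record Countermodel (ψ : PForm) : Set₁ where
  field
    size      : ℕ
    _⊑_       : Fin size → Fin size → Set
    valuation : Fin size → ℕ → Set
    ⊑-refl    : ∀ i → i ⊑ i
    ⊑-trans   : ∀ {i j k} → i ⊑ j → j ⊑ k → i ⊑ k
    root      : Fin size
    top       : Fin size
    root⊑     : ∀ i → root ⊑ i
    ⊑top      : ∀ i → i ⊑ top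

  model : Model 0ℓ
  model = record { World = Fin size ; _↝_ = _⊑_ ; val = valuation }

  field
    refutes   : ¬ forces model root ψ

-- States that decide finitely many formulas

Decides : List PForm → PForm → Set
Decides E x = ∀ {a} → a ∈ E → (x ⊢ a) ⊎ (x ⊢ ¬ₚ a)

module _ (em : ExcludedMiddle 0ℓ) where

  -- Lindenbaum's construction for a finite list; a single conjunction replaces a maximal consistent
  -- set. `C` is abstract because the root is built for consistency and the other states for
  -- possibility from the root.
  decideAll : (C : PForm → Set) → (∀ {x} a → C x → C (x ∧ₚ a) ⊎ C (x ∧ₚ (¬ₚ a))) →
              ∀ E x → C x → Σ[ y ∈ PForm ] (C y × (y ⊢ x) × Decides E y)
  decideAll C split [] x c = x , c , ⊢-refl , λ ()
  decideAll C split (a ∷ E) x c with split a c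
  ... | inj₁ c' = let (y , cy , y⊢ , dec) = decideAll C split E (x ∧ₚ a) c' in
        y , cy , ⊢-trans y⊢ ⊢-fst , λ { (here refl) → inj₁ (⊢-trans y⊢ ⊢-snd) ; (there m) → dec m }
  ... | inj₂ c' = let (y , cy , y⊢ , dec) = decideAll C split E (x ∧ₚ (¬ₚ a)) c' in
        y , cy , ⊢-trans y⊢ ⊢-fst , λ { (here refl) → inj₂ (⊢-trans y⊢ ⊢-snd) ; (there m) → dec m }

  Consistent : PForm → Set
  Consistent x = ¬ S4·2 (¬ₚ x)

  consistent-split : ∀ {x} a → Consistent x → Consistent (x ∧ₚ a) ⊎ Consistent (x ∧ₚ (¬ₚ a))
  consistent-split {x} a c with em {S4·2 (¬ₚ (x ∧ₚ a))} | em {S4·2 (¬ₚ (x ∧ₚ (¬ₚ a)))}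
  ... | no k  | _     = inj₁ k
  ... | yes _ | no k  = inj₂ k
  ... | yes d | yes e = ⊥-elim (c (mp (mp
          (tautology (¬ˢ (𝐩 ∧ˢ 𝐪) ⇒ˢ ¬ˢ (𝐩 ∧ˢ ¬ˢ 𝐪) ⇒ˢ ¬ˢ 𝐩) refl (x ∷ a ∷ a ∷ [])) d) e))

  -- The □-formulas with matrix in L that x proves, as one conjunction.
  boxes : ∀ x L → Σ[ β ∈ PForm ] ((x ⊢ β) × (β ⊢ □ₚ β) × (∀ {c} → c ∈ L → x ⊢ □ₚ c → β ⊢ □ₚ c))
  boxes x [] = ⊤ₚ , ⊢-weaken ⊤-intro , ⊢-weaken (nec ⊤-intro) , λ ()
    where
    ⊤-intro : S4·2 ⊤ₚ
    ⊤-intro = taut (λ _ → refl)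
  boxes x (c ∷ L) with boxes x L | em {x ⊢ □ₚ c}
  ... | β , x⊢β , β⊢□β , all | no k = β , x⊢β , β⊢□β , λ { (here refl) d → ⊥-elim (k d) ; (there m) d → all m d }
  ... | β , x⊢β , β⊢□β , all | yes e = (□ₚ c ∧ₚ β) , ⊢-pair e x⊢β
      , ⊢-trans (⊢-pair (⊢-trans ⊢-fst (ax4 _)) (⊢-trans ⊢-snd β⊢□β)) □-pair
      , λ { (here refl) _ → ⊢-fst ; (there m) d → ⊢-trans ⊢-snd (all m d) }

  -- By `◆□-meet`, necessities that are possible one by one are possible together. A state refined
  -- from `□ₚ β` becomes the top of the frame.
  possibleBoxes : ∀ x L → Σ[ β ∈ PForm ] ((x ⊢ ◆ (□ₚ β)) × (∀ {c} → c ∈ L → x ⊢ ◆ (□ₚ c) → □ₚ β ⊢ □ₚ c))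
  possibleBoxes x [] = ⊤ₚ , ⊢-weaken (mp ◆-intro (nec (taut (λ _ → refl)))) , λ ()
  possibleBoxes x (c ∷ L) with possibleBoxes x L | em {x ⊢ ◆ (□ₚ c)}
  ... | β , d , all | no k = β , d , λ { (here refl) e → ⊥-elim (k e) ; (there m) e → all m e }
  ... | β , d , all | yes e = (c ∧ₚ β) , ◆□-meet e d
      , λ { (here refl) _ → □-mono ⊢-fst ; (there m) e' → ⊢-trans (□-mono ⊢-snd) (all m e') }

  module _ (ψ : PForm) (unprovable : ¬ S4·2 ψ) where
    private
      -- Negations are included because `◇ₚ a` is handled as the negation of `□ₚ (¬ₚ a)`.
      L : List PForm
      L = subformulas ψ ++ mapᴸ ¬ₚ_ (subformulas ψ)

      E : List PForm
      E = subformulas ψ ++ mapᴸ □ₚ L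

      -- The extra formulas settle which `□ₚ c` are possible from the root. In `topData` every
      -- necessity of a state must be known to `w₀` as a possible one.
      start : Σ[ y ∈ PForm ] (Consistent y × (y ⊢ ¬ₚ ψ) × Decides (E ++ mapᴸ (λ c → □ₚ (¬ₚ (□ₚ c))) L) y)
      start = decideAll Consistent consistent-split _ (¬ₚ ψ) (λ d → unprovable (mp ¬¬-elim d))

      w₀ : PForm
      w₀ = proj₁ start

      -- Consistency with the necessities proved by `w₀`. Restricting the states in this way keeps
      -- only what the root can see, where `w₀` is least and a top exists.
      Possible : PForm → Set
      Possible x = ¬ (w₀ ⊢ □ₚ (¬ₚ x))

      possible-split : ∀ {x} a → Possible x → Possible (x ∧ₚ a) ⊎ Possible (x ∧ₚ (¬ₚ a))
      possible-split {x} a c with em {w₀ ⊢ □ₚ (¬ₚ (x ∧ₚ a))} | em {w₀ ⊢ □ₚ (¬ₚ (x ∧ₚ (¬ₚ a)))}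
      ... | no k  | _     = inj₁ k
      ... | yes _ | no k  = inj₂ k
      ... | yes d | yes e = ⊥-elim (c (⊢-trans (⊢-pair d e) (⊢-trans □-pair (□-mono
              (tautology (¬ˢ (𝐩 ∧ˢ 𝐪) ∧ˢ ¬ˢ (𝐩 ∧ˢ ¬ˢ 𝐪) ⇒ˢ ¬ˢ 𝐩) refl (x ∷ a ∷ a ∷ []))))))

      possible-mono : ∀ {x y} → x ⊢ y → Possible x → Possible y
      possible-mono d k e = k (⊢-trans e (□-mono (⊢-contra d)))

      possible-◆ : ∀ {x y} → x ⊢ ◆ y → Possible x → Possible y
      possible-◆ d k e = k (⊢-trans e (⊢-trans (ax4 _) (□-mono (⊢-trans ¬¬-intro (⊢-contra d)))))

      ⊢◆⇒possible : ∀ {y} → w₀ ⊢ ◆ y → Possible y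
      ⊢◆⇒possible d e = proj₁ (proj₂ start) (⊢-clash e d)

      record State : Set where
        constructor state
        field
          form     : PForm
          possible : Possible form
          decides  : Decides E form
      open State

      refine : ∀ x → Possible x → Σ[ u ∈ State ] (form u ⊢ x)
      refine x k = let (y , k' , d , dec) = decideAll Possible possible-split E x k in state y k' dec , d

      coherent : ∀ u {a} → form u ⊢ a → ¬ (form u ⊢ ¬ₚ a)
      coherent u d e = possible u (⊢-weaken (nec (⊢-clash d e)))

      refuted : ∀ u {a} → a ∈ E → ¬ (form u ⊢ a) → form u ⊢ ¬ₚ a
      refuted u m k with decides u m
      ... | inj₁ d = ⊥-elim (k d)
      ... | inj₂ e = e

      sub∈E : ∀ {a} → a ∈ subformulas ψ → a ∈ E
      sub∈E = ∈-++⁺ˡ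

      □∈E : ∀ {c} → c ∈ L → □ₚ c ∈ E
      □∈E m = ∈-++⁺ʳ (subformulas ψ) (∈-map⁺ □ₚ m)

      ¬∈L : ∀ {a} → a ∈ subformulas ψ → (¬ₚ a) ∈ L
      ¬∈L m = ∈-++⁺ʳ (subformulas ψ) (∈-map⁺ ¬ₚ_ m)

      -- The filtration for transitive frames: boxes are passed on as boxes, which makes the
      -- relation a preorder at once.
      _≼_ : State → State → Set
      u ≼ v = ∀ {c} → c ∈ L → form u ⊢ □ₚ c → form v ⊢ □ₚ c

      rootState : State
      rootState = state w₀ (⊢◆⇒possible ◆-intro) (λ m → proj₂ (proj₂ (proj₂ start)) (∈-++⁺ˡ m))

      root≼ : ∀ u → rootState ≼ u
      root≼ u m d with decides u (□∈E m)
      ... | inj₁ e = e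
      ... | inj₂ e = ⊥-elim (possible u (⊢-trans d (⊢-trans (ax4 _) (□-mono (⊢-trans ¬¬-intro (⊢-contra e))))))

      topData : Σ[ u ∈ State ] (∀ v → v ≼ u)
      topData = let (β , d , all) = possibleBoxes w₀ L
                    (u , u⊢) = refine (□ₚ β) (⊢◆⇒possible d) in
        u , λ v {c} m e → ⊢-trans u⊢ (all m (decided (proj₂ (proj₂ (proj₂ start))
                (∈-++⁺ʳ E (∈-map⁺ (λ c → □ₚ (¬ₚ (□ₚ c))) m))) (possible-mono e (possible v))))
        where
        decided : ∀ {c} → (w₀ ⊢ □ₚ (¬ₚ c)) ⊎ (w₀ ⊢ ◆ c) → Possible c → w₀ ⊢ ◆ c
        decided (inj₁ d) k = ⊥-elim (k d)
        decided (inj₂ e) _ = e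

      witness : ∀ u {c} → c ∈ L → ¬ (form u ⊢ □ₚ c) → Σ[ v ∈ State ] ((u ≼ v) × (form v ⊢ ¬ₚ c))
      witness u {c} m k =
        let (β , u⊢β , β⊢□β , all) = boxes (form u) L
            u⊢◆ = □◆-meet (⊢-trans u⊢β β⊢□β) (⊢-trans (refuted u (□∈E m) k) (⊢-contra (□-mono ¬¬-elim)))
            (v , v⊢) = refine (β ∧ₚ (¬ₚ c)) (possible-◆ u⊢◆ (possible u)) in
        v , (λ m' d → ⊢-trans v⊢ (⊢-trans ⊢-fst (all m' d))) , ⊢-trans v⊢ ⊢-snd

      sign : State → Fin (length E) → Fin 2
      sign u i = if does (em {form u ⊢ lookup E i}) then suc zero else zero

      code : State → Fin (2 ^ length E)
      code u = funToFin (sign u)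

      sign-⊢ : ∀ u v i → sign u i ≡ sign v i → form u ⊢ lookup E i → form v ⊢ lookup E i
      sign-⊢ u v i e d with em {form u ⊢ lookup E i} | em {form v ⊢ lookup E i}
      ... | _     | yes d' = d'
      sign-⊢ u v i () d | yes _ | no _
      ... | no k | no _ = ⊥-elim (k d)

      code-⊢ : ∀ u v → code u ≡ code v → ∀ {a} → a ∈ E → form u ⊢ a → form v ⊢ a
      code-⊢ u v e {a} m d = subst (form v ⊢_) (sym (lookup-index m))
        (sign-⊢ u v i (trans (sym (finToFun-funToFin (sign u) i))
                      (trans (cong (λ k → finToFun k i) e) (finToFun-funToFin (sign v) i)))
                (subst (form u ⊢_) (lookup-index m) d))
        where i = Any.index m

      rep : Fin (2 ^ length E) → State
      rep i with em {Σ[ u ∈ State ] (code u ≡ i)}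
      ... | yes (u , _) = u
      -- A code realised by no state becomes a copy of the root, so that every index names a state.
      ... | no _ = rootState

      code-rep : ∀ u → code (rep (code u)) ≡ code u
      code-rep u with em {Σ[ v ∈ State ] (code v ≡ code u)}
      ... | yes (v , e) = e
      ... | no k = ⊥-elim (k (u , refl))

      _⊑_ : Fin (2 ^ length E) → Fin (2 ^ length E) → Set
      i ⊑ j = rep i ≼ rep j

      ≼-rep : ∀ {u v} → u ≼ v → u ≼ rep (code v)
      ≼-rep {u} {v} r m d = code-⊢ v (rep (code v)) (sym (code-rep v)) (□∈E m) (r m d)

      rep-≼ : ∀ {u v} → u ≼ v → rep (code u) ≼ v
      rep-≼ {u} r m d = r m (code-⊢ (rep (code u)) u (code-rep u) (□∈E m) d)

      M : Model 0ℓ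
      M = record { World = Fin (2 ^ length E) ; _↝_ = _⊑_ ; val = λ i n → form (rep i) ⊢ pvar n }

      Sub : PForm → Set
      Sub a = ∀ {b} → b ∈ subformulas a → b ∈ subformulas ψ

      truth : ∀ a → Sub a → ∀ i → forces M i a ⇔ (form (rep i) ⊢ a)
      truth (pvar n) h i = mk⇔ id id
      truth ⊥ₚ h i = mk⇔ (λ ()) (λ d → ⊥-elim (coherent (rep i) d (⊢-weaken (taut (λ _ → refl)))))
      truth ⊤ₚ h i = mk⇔ (λ _ → ⊢-weaken (taut (λ _ → refl))) (λ _ → lift tt)
      truth (¬ₚ a) h i = mk⇔
        (λ k → refuted (rep i) (sub∈E (h (there (subformula-self a)))) (λ d → k (from ih d)))
        (λ d k → coherent (rep i) (to ih k) d)
        where ih = truth a (λ m → h (there m)) i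
      truth (a ∧ₚ b) h i = mk⇔
        (λ (k , l) → ⊢-pair (to iha k) (to ihb l))
        (λ d → from iha (⊢-trans d ⊢-fst) , from ihb (⊢-trans d ⊢-snd))
        where iha = truth a (λ m → h (there (∈-++⁺ˡ m))) i
              ihb = truth b (λ m → h (there (∈-++⁺ʳ (subformulas a) m))) i
      truth (a ∨ₚ b) h i = mk⇔
        (λ { (inj₁ k) → ⊢-trans (to iha k) (tautology (𝐩 ⇒ˢ 𝐩 ∨ˢ 𝐪) refl (a ∷ b ∷ b ∷ []))
           ; (inj₂ l) → ⊢-trans (to ihb l) (tautology (𝐪 ⇒ˢ 𝐩 ∨ˢ 𝐪) refl (a ∷ b ∷ b ∷ [])) })
        split
        where
        iha = truth a (λ m → h (there (∈-++⁺ˡ m))) i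
        ihb = truth b (λ m → h (there (∈-++⁺ʳ (subformulas a) m))) i
        split : form (rep i) ⊢ a ∨ₚ b → forces M i (a ∨ₚ b)
        split d with decides (rep i) (sub∈E (h (there (∈-++⁺ˡ (subformula-self a)))))
        ... | inj₁ e = inj₁ (from iha e)
        ... | inj₂ e = inj₂ (from ihb (⊢-trans (⊢-pair e d)
                (tautology (¬ˢ 𝐩 ∧ˢ (𝐩 ∨ˢ 𝐪) ⇒ˢ 𝐪) refl (a ∷ b ∷ b ∷ []))))
      truth (a ⇒ₚ b) h i = mk⇔ close (λ d k → from ihb (⊢-mp d (to iha k)))
        where
        iha = truth a (λ m → h (there (∈-++⁺ˡ m))) i
        ihb = truth b (λ m → h (there (∈-++⁺ʳ (subformulas a) m))) i
        close : forces M i (a ⇒ₚ b) → form (rep i) ⊢ a ⇒ₚ b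
        close k with decides (rep i) (sub∈E (h (there (∈-++⁺ˡ (subformula-self a)))))
        ... | inj₁ e = ⊢-trans (to ihb (k (from iha e))) (tautology (𝐪 ⇒ˢ 𝐩 ⇒ˢ 𝐪) refl (a ∷ b ∷ b ∷ []))
        ... | inj₂ e = ⊢-trans e (tautology (¬ˢ 𝐩 ⇒ˢ 𝐩 ⇒ˢ 𝐪) refl (a ∷ b ∷ b ∷ []))
      truth (□ₚ a) h i = mk⇔ close (λ d j r → from (ih j) (⊢-trans (r a∈L d) (axT a)))
        where
        a∈ = h (there (subformula-self a))
        a∈L = ∈-++⁺ˡ a∈
        ih = truth a (λ m → h (there m))
        close : forces M i (□ₚ a) → form (rep i) ⊢ □ₚ a
        close k with em {form (rep i) ⊢ □ₚ a}
        ... | yes d = d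
        ... | no n = let (v , r , e) = witness (rep i) a∈L n in
              ⊥-elim (coherent v (code-⊢ (rep (code v)) v (code-rep v) (sub∈E a∈) (to (ih (code v)) (k (code v) (≼-rep {rep i} {v} r)))) e)
      truth (◇ₚ a) h i = mk⇔ close open′
        where
        a∈ = h (there (subformula-self a))
        ih = truth a (λ m → h (there m))
        close : forces M i (◇ₚ a) → form (rep i) ⊢ ◇ₚ a
        close (j , r , k) = ⊢-trans (refuted (rep i) (□∈E (¬∈L a∈))
          (λ d → coherent (rep j) (to (ih j) k) (⊢-trans (r (¬∈L a∈) d) (axT _)))) ◆⊢◇
        open′ : form (rep i) ⊢ ◇ₚ a → forces M i (◇ₚ a)
        open′ d = let (v , r , e) = witness (rep i) (¬∈L a∈) (λ k → coherent (rep i) k (⊢-trans d ◇⊢◆)) in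
          code v , ≼-rep {rep i} {v} r , from (ih (code v))
            (code-⊢ v (rep (code v)) (sym (code-rep v)) (sub∈E a∈) (⊢-trans e ¬¬-elim))

    S4·2-countermodel : Countermodel ψ
    S4·2-countermodel = record
      { size = 2 ^ length E
      ; _⊑_ = _⊑_
      ; valuation = val M
      ; ⊑-refl = λ i m d → d
      ; ⊑-trans = λ r r' m d → r' m (r m d)
      ; root = code rootState
      ; top = code (proj₁ topData)
      ; root⊑ = λ i → rep-≼ {rootState} {rep i} (root≼ (rep i))
      ; ⊑top = λ i → ≼-rep {rep i} {proj₁ topData} (proj₂ topData (rep i))
      ; refutes = λ k → coherent rootState
          (code-⊢ (rep (code rootState)) rootState (code-rep rootState) (sub∈E (subformula-self ψ))
            (to (truth ψ id (code rootState)) k)) (proj₁ (proj₂ (proj₂ start)))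
      }

-- The Kripke model of extensions of W

abstract
  lower-em : ExcludedMiddle (lsuc 0ℓ) → ExcludedMiddle 0ℓ
  lower-em em {P} = map′ lower lift (em {Lift (lsuc 0ℓ) P})

by-contradiction : ∀ {a} → ExcludedMiddle a → {P : Set a} → ¬ ¬ P → P
by-contradiction em {P} k with em {P}
... | yes p = p
... | no n = ⊥-elim (k n)


lt : (U : LO) → Carrier U → Carrier U → Set
lt U x y = ¬ _≤_ U y x

module Order (U : LO) where
  open IsTotalOrder (isTotalOrder U) public using ()
    renaming (refl to ≤-refl; trans to ≤-trans; antisym to ≤-antisym; total to ≤-total; reflexive to ≤-reflexive)

  <⇒≤ : ∀ {x y} → lt U x y → _≤_ U x y
  <⇒≤ {x} {y} k with ≤-total x y
  ... | inj₁ p = p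
  ... | inj₂ q = ⊥-elim (k q)

  <-irrefl : ∀ {x} → ¬ lt U x x
  <-irrefl k = k ≤-refl

  <⇒≢ : ∀ {x y} → lt U x y → x ≢ y
  <⇒≢ k refl = k ≤-refl

  <-≤-trans : ∀ {x y z} → lt U x y → _≤_ U y z → lt U x z
  <-≤-trans k p q = k (≤-trans p q)

  <-trans : ∀ {x y z} → lt U x y → lt U y z → lt U x z
  <-trans k l = <-≤-trans k (<⇒≤ l)

  ≤∧≢⇒< : ∀ {x y} → _≤_ U x y → x ≢ y → lt U x y
  ≤∧≢⇒< p k q = k (≤-antisym p q)

emb-< : ∀ {U V} (f : Emb U V) {x y} → lt U x y → lt V (fun f x) (fun f y)
emb-< f k p = k (reflect f p)

reflect-< : ∀ {U V} (f : Emb U V) {x y} → lt V (fun f x) (fun f y) → lt U x y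
reflect-< f k p = k (mono f p)

emb-injective : ∀ {U V} (f : Emb U V) {x y} → fun f x ≡ fun f y → x ≡ y
emb-injective {U} {V} f e = Order.≤-antisym U (reflect f (Order.≤-reflexive V e)) (reflect f (Order.≤-reflexive V (sym e)))

-- The triangles of `_⇢_` commute only pointwise, so truth has to be invariant under pointwise
-- equality.
Sat-cong : ∀ {W U n} {c d : Emb W U} {ρ τ : Fin n → Carrier U} (φ : Form W n) →
           (∀ x → fun c x ≡ fun d x) → (∀ i → ρ i ≡ τ i) → Sat U c ρ φ → Sat U d τ φ
Sat-cong {W} {U} {n} {c} {d} {ρ} {τ} φ e h = go φ
  where
  term : ∀ (t : Term W n) → ⟦ t ⟧ₜ c ρ ≡ ⟦ t ⟧ₜ d τ
  term (var i) = h i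
  term (con w) = e w
  e⁻ = λ x → sym (e x)
  h⁻ = λ i → sym (h i)
  ext : ∀ {ρ τ : Fin n → Carrier U} → (∀ i → ρ i ≡ τ i) → ∀ x i → extend x ρ i ≡ extend x τ i
  ext h x zero = refl
  ext h x (suc i) = h i
  go : ∀ φ → Sat U c ρ φ → Sat U d τ φ
  go (s ≤ᶠ t) (lift p) = lift (subst₂ (_≤_ U) (term s) (term t) p)
  go (s ≐ t) (lift p) = lift (trans (sym (term s)) (trans p (term t)))
  go ⊥ᶠ p = p
  go ⊤ᶠ p = p
  go (¬ᶠ φ) k p = k (Sat-cong φ e⁻ h⁻ p)
  go (φ ∧ᶠ ψ) (p , q) = Sat-cong φ e h p , Sat-cong ψ e h q
  go (φ ∨ᶠ ψ) (inj₁ p) = inj₁ (Sat-cong φ e h p)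
  go (φ ∨ᶠ ψ) (inj₂ q) = inj₂ (Sat-cong ψ e h q)
  go (φ ⇒ᶠ ψ) k p = Sat-cong ψ e h (k (Sat-cong φ e⁻ h⁻ p))
  go (∀ᶠ φ) k x = Sat-cong φ e (ext h x) (k x)
  go (∃ᶠ φ) (x , p) = x , Sat-cong φ e (ext h x) p
  go (◇ᶠ φ) (V , f , p) = V , f , Sat-cong φ (λ x → cong (fun f) (e x)) (λ i → cong (fun f) (h i)) p
  go (□ᶠ φ) k V f = Sat-cong φ (λ x → cong (fun f) (e x)) (λ i → cong (fun f) (h i)) (k V f)

-- `env` is the empty assignment. It is stored because functions out of `Fin 0` agree only
-- pointwise, and composing with an embedding yields a new one.
record Over (W : LO) : Set₁ where
  constructor over
  field
    ord : LO
    emb : Emb W ord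
    env : Fin 0 → Carrier ord
open Over

_⇢_ : ∀ {W} → Over W → Over W → Set
A ⇢ B = Σ[ f ∈ Emb (ord A) (ord B) ] (∀ x → fun (emb B) x ≡ fun f (fun (emb A) x))

SatOver : ∀ {W} → Over W → Sentence W → Set₁
SatOver A φ = Sat (ord A) (emb A) (env A) φ

along : ∀ {W} (A : Over W) (V : LO) → Emb (ord A) V → Over W
along A V f = over V (f ∘E emb A) (λ i → fun f (env A i))

along-⇢ : ∀ {W} (A : Over W) V f → A ⇢ along A V f
along-⇢ A V f = f , λ _ → refl

SatOver-along : ∀ {W} (A B : Over W) φ (r : A ⇢ B) → SatOver (along A (ord B) (proj₁ r)) φ ⇔ SatOver B φ
SatOver-along A B φ (f , e) = mk⇔ (Sat-cong φ (λ x → sym (e x)) (λ ())) (Sat-cong φ e (λ ()))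

loModel : ∀ {W} → (ℕ → Sentence W) → Model (lsuc 0ℓ)
loModel {W} σ = record { World = Over W ; _↝_ = _⇢_ ; val = λ A i → SatOver A (σ i) }

inst⇔forces : ∀ {W} (σ : ℕ → Sentence W) φ A → SatOver A (inst σ φ) ⇔ forces (loModel σ) A φ
inst⇔forces σ (pvar i) A = mk⇔ id id
inst⇔forces σ ⊥ₚ A = mk⇔ (λ ()) (λ ())
inst⇔forces σ ⊤ₚ A = mk⇔ id id
inst⇔forces σ (¬ₚ φ) A = mk⇔ (λ k p → k (from (inst⇔forces σ φ A) p)) (λ k p → k (to (inst⇔forces σ φ A) p))
inst⇔forces σ (φ ∧ₚ ψ) A = mk⇔
  (λ (p , q) → to (inst⇔forces σ φ A) p , to (inst⇔forces σ ψ A) q)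
  (λ (p , q) → from (inst⇔forces σ φ A) p , from (inst⇔forces σ ψ A) q)
inst⇔forces σ (φ ∨ₚ ψ) A = mk⇔
  (λ { (inj₁ p) → inj₁ (to (inst⇔forces σ φ A) p) ; (inj₂ q) → inj₂ (to (inst⇔forces σ ψ A) q) })
  (λ { (inj₁ p) → inj₁ (from (inst⇔forces σ φ A) p) ; (inj₂ q) → inj₂ (from (inst⇔forces σ ψ A) q) })
inst⇔forces σ (φ ⇒ₚ ψ) A = mk⇔
  (λ k p → to (inst⇔forces σ ψ A) (k (from (inst⇔forces σ φ A) p)))
  (λ k p → from (inst⇔forces σ ψ A) (k (to (inst⇔forces σ φ A) p)))
inst⇔forces σ (◇ₚ φ) A = mk⇔
  (λ (V , f , p) → along A V f , along-⇢ A V f , to (inst⇔forces σ φ (along A V f)) p)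
  (λ (B , r , p) → ord B , proj₁ r , from (SatOver-along A B (inst σ φ) r) (from (inst⇔forces σ φ B) p))
inst⇔forces σ (□ₚ φ) A = mk⇔
  (λ k B r → to (inst⇔forces σ φ B) (to (SatOver-along A B (inst σ φ) r) (k (ord B) (proj₁ r))))
  (λ k V f → from (inst⇔forces σ φ (along A V f)) (k (along A V f) (along-⇢ A V f)))

⇢-refl : ∀ {W} (A : Over W) → A ⇢ A
⇢-refl A = idE (ord A) , λ _ → refl

⇢-trans : ∀ {W} {A B C : Over W} → A ⇢ B → B ⇢ C → A ⇢ C
⇢-trans (f , e) (g , h) = g ∘E f , λ x → trans (h x) (cong (fun g) (e x))

base : (W : LO) → Over W
base W = over W (idE W) (λ ())

-- Amalgamation and directedness

module _ (em : ExcludedMiddle 0ℓ) where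

  module StrictOrder (U : LO) where
    open Order U public

    ≤⇒<⊎≡ : ∀ {x y} → _≤_ U x y → lt U x y ⊎ x ≡ y
    ≤⇒<⊎≡ {x} {y} p with em {_≤_ U y x}
    ... | yes q = inj₂ (≤-antisym p q)
    ... | no k = inj₁ k

    data Tri (x y : Carrier U) : Set where
      less    : lt U x y → Tri x y
      equal   : x ≡ y → Tri x y
      greater : lt U y x → Tri x y

    compare : ∀ x y → Tri x y
    compare x y with ≤-total x y
    ... | inj₁ p with ≤⇒<⊎≡ p
    ... | inj₁ l = less l
    ... | inj₂ e = equal e
    compare x y | inj₂ p with ≤⇒<⊎≡ p
    ... | inj₁ l = greater l
    ... | inj₂ e = equal (sym e)

  -- The disjoint union of V and X, where a point of X precedes a point of V exactly when an
  -- element of U separates them; X is mapped in with the points coming from U sent into V.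
  module Amalgam {U V X : LO} (f : Emb U V) (g : Emb U X) where
    private
      module V = StrictOrder V
      module X = StrictOrder X

      Before : Carrier X → Carrier V → Set
      Before x a = Σ[ u ∈ Carrier U ] (_≤_ X x (fun g u) × _≤_ V (fun f u) a)

      _⊴_ : Carrier V ⊎ Carrier X → Carrier V ⊎ Carrier X → Set
      inj₁ a ⊴ inj₁ b = _≤_ V a b
      inj₁ a ⊴ inj₂ y = ¬ Before y a
      inj₂ x ⊴ inj₁ b = Before x b
      inj₂ x ⊴ inj₂ y = _≤_ X x y

      ⊴-refl : ∀ x → x ⊴ x
      ⊴-refl (inj₁ a) = V.≤-refl
      ⊴-refl (inj₂ x) = X.≤-refl

      ⊴-trans : ∀ x y z → x ⊴ y → y ⊴ z → x ⊴ z
      ⊴-trans (inj₁ a) (inj₁ b) (inj₁ c) p q = V.≤-trans p q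
      ⊴-trans (inj₁ a) (inj₁ b) (inj₂ z) p k (u , r , s) = k (u , r , V.≤-trans s p)
      ⊴-trans (inj₁ a) (inj₂ y) (inj₁ c) k (u , r , s) = V.<⇒≤ (λ p → k (u , r , V.≤-trans s p))
      ⊴-trans (inj₁ a) (inj₂ y) (inj₂ z) k q (u , r , s) = k (u , X.≤-trans q r , s)
      ⊴-trans (inj₂ x) (inj₁ b) (inj₁ c) (u , r , s) q = u , r , V.≤-trans s q
      ⊴-trans (inj₂ x) (inj₁ b) (inj₂ z) (u , r , s) k = X.<⇒≤ (λ p → k (u , X.≤-trans p r , s))
      ⊴-trans (inj₂ x) (inj₂ y) (inj₁ c) p (u , r , s) = u , X.≤-trans p r , s
      ⊴-trans (inj₂ x) (inj₂ y) (inj₂ z) p q = X.≤-trans p q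

      ⊴-antisym : ∀ x y → x ⊴ y → y ⊴ x → x ≡ y
      ⊴-antisym (inj₁ a) (inj₁ b) p q = cong inj₁ (V.≤-antisym p q)
      ⊴-antisym (inj₁ a) (inj₂ y) k p = ⊥-elim (k p)
      ⊴-antisym (inj₂ x) (inj₁ b) p k = ⊥-elim (k p)
      ⊴-antisym (inj₂ x) (inj₂ y) p q = cong inj₂ (X.≤-antisym p q)

      ⊴-total : ∀ x y → x ⊴ y ⊎ y ⊴ x
      ⊴-total (inj₁ a) (inj₁ b) = V.≤-total a b
      ⊴-total (inj₁ a) (inj₂ y) with em {Before y a}
      ... | yes p = inj₂ p
      ... | no k = inj₁ k
      ⊴-total (inj₂ x) (inj₁ b) with em {Before x b}
      ... | yes p = inj₁ p
      ... | no k = inj₂ k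
      ⊴-total (inj₂ x) (inj₂ y) = X.≤-total x y

      Image : Carrier X → Set
      Image x = Σ[ u ∈ Carrier U ] (fun g u ≡ x)

      place : ∀ x → Dec (Image x) → Carrier V ⊎ Carrier X
      place x (yes (u , _)) = inj₁ (fun f u)
      place x (no _) = inj₂ x

      place-mono : ∀ x y dx dy → _≤_ X x y → place x dx ⊴ place y dy
      place-mono x y (yes (u , refl)) (yes (v , refl)) p = mono f (reflect g p)
      place-mono x y (yes (u , refl)) (no k) p (v , r , s) =
        k (u , X.≤-antisym p (X.≤-trans r (mono g (reflect f s))))
      place-mono x y (no k) (yes (v , refl)) p = v , p , V.≤-refl
      place-mono x y (no _) (no _) p = p

      place-reflect : ∀ x y dx dy → place x dx ⊴ place y dy → _≤_ X x y
      place-reflect x y (yes (u , refl)) (yes (v , refl)) p = mono g (reflect f p)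
      place-reflect x y (yes (u , refl)) (no _) k = X.<⇒≤ (λ p → k (u , p , V.≤-refl))
      place-reflect x y (no _) (yes (v , refl)) (w , r , s) = X.≤-trans r (mono g (reflect f s))
      place-reflect x y (no _) (no _) p = p

      place-image : ∀ u d → place (fun g u) d ≡ inj₁ (fun f u)
      place-image u (yes (v , e)) = cong (inj₁ ∘ fun f) (emb-injective g e)
      place-image u (no k) = ⊥-elim (k (u , refl))

    amalgam : LO
    amalgam = record
      { Carrier = Carrier V ⊎ Carrier X
      ; _≤_ = _⊴_
      ; isTotalOrder = record
        { isPartialOrder = record
          { isPreorder = record
            { isEquivalence = isEquivalence
            ; reflexive = λ { {x} refl → ⊴-refl x }
            ; trans = λ {x} {y} {z} → ⊴-trans x y z }
          ; antisym = λ {x} {y} → ⊴-antisym x y }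
        ; total = ⊴-total } }

    left : Emb V amalgam
    left = record { fun = inj₁ ; mono = id ; reflect = id }

    right : Emb X amalgam
    right = record
      { fun = λ x → place x em
      ; mono = λ {x} {y} → place-mono x y em em
      ; reflect = λ {x} {y} → place-reflect x y em em }

    commutes : ∀ u → fun left (fun f u) ≡ fun right (fun g u)
    commutes u = sym (place-image u em)

  loModel-directed : ∀ {W} (σ : ℕ → Sentence W) → DirectedPreorder (loModel σ)
  loModel-directed σ = record
    { ↝-refl = ⇢-refl
    ; ↝-trans = λ {A} {B} {C} → ⇢-trans {A = A} {B} {C}
    ; ↝-directed = λ {A} {B} {C} (f , e) (g , h) → let open Amalgam f g in
        along B amalgam left , along-⇢ B amalgam left ,
        right , λ x → trans (cong inj₁ (e x)) (trans (commutes (fun (emb A) x)) (cong (fun right) (sym (h x)))) }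

S4·2⊆Val : ExcludedMiddle (lsuc 0ℓ) → ∀ W ψ → S4·2 ψ → Val W ψ
S4·2⊆Val em W ψ d σ = from (inst⇔forces σ ψ (base W))
  (S4·2-sound em (loModel σ) (loModel-directed (lower-em em) σ) d (base W))

-- Buttons and dials

module _ (A B : LO) where
  private
    _⊴_ : Carrier A ⊎ Carrier B → Carrier A ⊎ Carrier B → Set
    inj₁ x ⊴ inj₁ y = _≤_ A x y
    inj₁ x ⊴ inj₂ y = ⊤
    inj₂ x ⊴ inj₁ y = ⊥
    inj₂ x ⊴ inj₂ y = _≤_ B x y

    ⊴-refl : ∀ x → x ⊴ x
    ⊴-refl (inj₁ x) = Order.≤-refl A
    ⊴-refl (inj₂ x) = Order.≤-refl B

    ⊴-trans : ∀ x y z → x ⊴ y → y ⊴ z → x ⊴ z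
    ⊴-trans (inj₁ x) (inj₁ y) (inj₁ z) p q = Order.≤-trans A p q
    ⊴-trans (inj₁ x) _        (inj₂ z) p q = tt
    ⊴-trans (inj₂ x) (inj₂ y) (inj₂ z) p q = Order.≤-trans B p q

    ⊴-antisym : ∀ x y → x ⊴ y → y ⊴ x → x ≡ y
    ⊴-antisym (inj₁ x) (inj₁ y) p q = cong inj₁ (Order.≤-antisym A p q)
    ⊴-antisym (inj₂ x) (inj₂ y) p q = cong inj₂ (Order.≤-antisym B p q)

    ⊴-total : ∀ x y → x ⊴ y ⊎ y ⊴ x
    ⊴-total (inj₁ x) (inj₁ y) = Order.≤-total A x y
    ⊴-total (inj₁ x) (inj₂ y) = inj₁ tt
    ⊴-total (inj₂ x) (inj₁ y) = inj₂ tt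
    ⊴-total (inj₂ x) (inj₂ y) = Order.≤-total B x y

  Sum : LO
  Sum = record
    { Carrier = Carrier A ⊎ Carrier B
    ; _≤_ = _⊴_
    ; isTotalOrder = record
      { isPartialOrder = record
        { isPreorder = record
          { isEquivalence = isEquivalence
          ; reflexive = λ { {x} refl → ⊴-refl x }
          ; trans = λ {x} {y} {z} → ⊴-trans x y z }
        ; antisym = λ {x} {y} → ⊴-antisym x y }
      ; total = ⊴-total } }

module _ (U : LO) where
  Above : ℕ → Carrier U → Set
  Above zero x = ⊤
  Above (suc k) x = Σ[ y ∈ Carrier U ] (lt U x y × Above k y)

  -- No immediate predecessor; a least point qualifies vacuously.
  Limit : Carrier U → Set
  Limit x = ∀ y → lt U y x → Σ[ z ∈ Carrier U ] (lt U y z × lt U z x)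

  -- An arbitrary order may satisfy this for several `k` or for none. Uniqueness is only claimed
  -- after the dial has been set.
  Dial : ℕ → Set
  Dial k = Σ[ x ∈ Carrier U ] (Limit x × Above k x × ¬ Above (suc k) x)

module _ {W : LO} where

  button : Carrier W × Carrier W → Sentence W
  button (a , b) = ∃ᶠ ((¬ᶠ (var zero ≤ᶠ con a)) ∧ᶠ (¬ᶠ (con b ≤ᶠ var zero)))

  atLeastAbove : ∀ {n} → ℕ → Form W (suc n)
  atLeastAbove zero = ⊤ᶠ
  atLeastAbove (suc k) = ∃ᶠ ((¬ᶠ (var zero ≤ᶠ var (suc zero))) ∧ᶠ atLeastAbove k)

  isLimit : Form W 1
  isLimit = ∀ᶠ ((¬ᶠ (var (suc zero) ≤ᶠ var zero)) ⇒ᶠ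
              ∃ᶠ ((¬ᶠ (var zero ≤ᶠ var (suc zero))) ∧ᶠ (¬ᶠ (var (suc (suc zero)) ≤ᶠ var zero))))

  dial : ℕ → Sentence W
  dial k = ∃ᶠ (isLimit ∧ᶠ (atLeastAbove k ∧ᶠ (¬ᶠ atLeastAbove (suc k))))

  Pushed : Over W → Carrier W × Carrier W → Set
  Pushed A (a , b) = Σ[ x ∈ Carrier (ord A) ] (lt (ord A) (fun (emb A) a) x × lt (ord A) x (fun (emb A) b))

  button⇔ : ∀ A ab → SatOver A (button ab) ⇔ Pushed A ab
  button⇔ A ab = mk⇔ (λ (x , p , q) → x , (λ r → p (lift r)) , (λ r → q (lift r)))
                      (λ (x , p , q) → x , (λ r → p (lower r)) , (λ r → q (lower r)))

  atLeastAbove⇔ : ∀ {n} U (c : Emb W U) (ρ : Fin (suc n) → Carrier U) k →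
                  Sat U c ρ (atLeastAbove k) ⇔ Above U k (ρ zero)
  atLeastAbove⇔ U c ρ zero = mk⇔ (λ _ → tt) (λ _ → lift tt)
  atLeastAbove⇔ U c ρ (suc k) = mk⇔
    (λ (y , p , q) → y , (λ r → p (lift r)) , to (atLeastAbove⇔ U c (extend y ρ) k) q)
    (λ (y , p , q) → y , (λ r → p (lower r)) , from (atLeastAbove⇔ U c (extend y ρ) k) q)

  isLimit⇔ : ∀ U (c : Emb W U) (ρ : Fin 1 → Carrier U) → Sat U c ρ isLimit ⇔ Limit U (ρ zero)
  isLimit⇔ U c ρ = mk⇔ there′ back′
    where
    there′ : Sat U c ρ isLimit → Limit U (ρ zero)
    there′ k y p with k y (λ s → p (lower s))
    ... | z , q , r = z , (λ s → q (lift s)) , (λ s → r (lift s))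
    back′ : Limit U (ρ zero) → Sat U c ρ isLimit
    back′ k y p with k y (λ s → p (lift s))
    ... | z , q , r = z , (λ s → q (lower s)) , (λ s → r (lower s))

  dial⇔ : ∀ A k → SatOver A (dial k) ⇔ Dial (ord A) k
  dial⇔ A k = mk⇔
    (λ (x , l , p , q) → x , to (isLimit⇔ _ (emb A) (ρ x)) l , to (atLeastAbove⇔ _ (emb A) (ρ x) k) p
                           , (λ r → q (from (atLeastAbove⇔ _ (emb A) (ρ x) (suc k)) r)))
    (λ (x , l , p , q) → x , from (isLimit⇔ _ (emb A) (ρ x)) l , from (atLeastAbove⇔ _ (emb A) (ρ x) k) p
                           , (λ r → q (to (atLeastAbove⇔ _ (emb A) (ρ x) (suc k)) r)))
    where ρ = λ x → extend x (env A)

ℕ-LO : LO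
ℕ-LO = record { Carrier = ℕ ; _≤_ = ℕ._≤_ ; isTotalOrder = ℕ.≤-isTotalOrder }

Fin-LO : ℕ → LO
Fin-LO n = record { Carrier = Fin n ; _≤_ = Data.Fin._≤_ ; isTotalOrder = Fin-≤-isTotalOrder }

-- U + ω + (j + 1): the only limit point with finitely many points above it is the first
-- point of the last summand.
module SetDial (U : LO) (j : ℕ) where

  dialed : LO
  dialed = Sum U (Sum ℕ-LO (Fin-LO (suc j)))

  into : Emb U dialed
  into = record { fun = inj₁ ; mono = id ; reflect = id }

  private
    mid : ℕ → Carrier dialed
    mid n = inj₂ (inj₁ n)

    fin : Fin (suc j) → Carrier dialed
    fin i = inj₂ (inj₂ i)

    above-mid : ∀ k n → Above dialed k (mid n)
    above-mid zero n = tt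
    above-mid (suc k) n = mid (suc n) , ℕ.<⇒≱ (ℕ.n<1+n n) , above-mid k (suc n)

    above-U : ∀ k u → Above dialed k (inj₁ u)
    above-U zero u = tt
    above-U (suc k) u = mid 0 , (λ ()) , above-mid k 0

    above-fin : ∀ k i → toℕ i ℕ.+ k ℕ.≤ j → Above dialed k (fin i)
    above-fin zero i p = tt
    above-fin (suc k) i p = fin i' , (λ q → ℕ.<⇒≱ (ℕ.n<1+n (toℕ i)) (subst (ℕ._≤ toℕ i) e q)) ,
      above-fin k i' (subst (λ m → m ℕ.+ k ℕ.≤ j) (sym e) p')
      where
      p' : suc (toℕ i) ℕ.+ k ℕ.≤ j
      p' = subst (ℕ._≤ j) (ℕ.+-suc (toℕ i) k) p
      lt' : suc (toℕ i) ℕ.< suc j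
      lt' = s≤s (ℕ.≤-trans (ℕ.m≤m+n _ k) p')
      i' = fromℕ< lt'
      e : toℕ i' ≡ suc (toℕ i)
      e = toℕ-fromℕ< lt'

    fin-above : ∀ k i → Above dialed k (fin i) → toℕ i ℕ.+ k ℕ.≤ j
    fin-above zero i _ = subst (ℕ._≤ j) (sym (ℕ.+-identityʳ _)) (ℕ.s≤s⁻¹ (toℕ<n i))
    fin-above (suc k) i (inj₁ _ , p , _) = ⊥-elim (p tt)
    fin-above (suc k) i (inj₂ (inj₁ _) , p , _) = ⊥-elim (p tt)
    fin-above (suc k) i (inj₂ (inj₂ i') , p , q) = subst (ℕ._≤ j) (sym (ℕ.+-suc (toℕ i) k))
      (ℕ.≤-trans (ℕ.+-monoˡ-≤ k (ℕ.≰⇒> p)) (fin-above k i' q))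

    limit-zero : Limit dialed (fin zero)
    limit-zero (inj₁ u) _ = mid 0 , (λ ()) , (λ ())
    limit-zero (inj₂ (inj₁ n)) _ = mid (suc n) , ℕ.<⇒≱ (ℕ.n<1+n n) , (λ ())
    limit-zero (inj₂ (inj₂ i)) p = ⊥-elim (p z≤n)

    ¬limit-suc : ∀ i → ¬ Limit dialed (fin (suc i))
    ¬limit-suc i l with l (fin (inject₁ i)) (λ q → ℕ.1+n≰n (subst (suc (toℕ i) ℕ.≤_) (toℕ-inject₁ i) q))
    ... | inj₁ _ , p , _ = p tt
    ... | inj₂ (inj₁ _) , p , _ = p tt
    ... | inj₂ (inj₂ z) , p , q = p (subst (toℕ z ℕ.≤_) (sym (toℕ-inject₁ i)) (ℕ.s≤s⁻¹ (ℕ.≰⇒> q)))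

  dial-at : Dial dialed j
  dial-at = fin zero , limit-zero , above-fin j zero ℕ.≤-refl ,
    λ a → ℕ.1+n≰n (fin-above (suc j) zero a)

  dial-only : ∀ k → Dial dialed k → k ≡ j
  dial-only k (inj₁ u , _ , _ , n) = ⊥-elim (n (above-U (suc k) u))
  dial-only k (inj₂ (inj₁ m) , _ , _ , n) = ⊥-elim (n (above-mid (suc k) m))
  dial-only k (inj₂ (inj₂ zero) , _ , a , n) =
    ℕ.≤-antisym (fin-above k zero a) (ℕ.≮⇒≥ (λ q → n (above-fin (suc k) zero q)))
  dial-only k (inj₂ (inj₂ (suc i)) , l , _ , _) = ⊥-elim (¬limit-suc i l)

module InsertAfter (em : ExcludedMiddle 0ℓ) (U : LO) (a : Carrier U) where
  private
    module U = StrictOrder em U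

    _⊴_ : Maybe (Carrier U) → Maybe (Carrier U) → Set
    just x  ⊴ just y  = _≤_ U x y
    just x  ⊴ nothing = _≤_ U x a
    nothing ⊴ just y  = lt U a y
    nothing ⊴ nothing = ⊤

    ⊴-refl : ∀ x → x ⊴ x
    ⊴-refl (just x) = U.≤-refl
    ⊴-refl nothing = tt

    ⊴-trans : ∀ x y z → x ⊴ y → y ⊴ z → x ⊴ z
    ⊴-trans (just x) (just y) (just z) p q = U.≤-trans p q
    ⊴-trans (just x) (just y) nothing p q = U.≤-trans p q
    ⊴-trans (just x) nothing (just z) p q = U.≤-trans p (U.<⇒≤ q)
    ⊴-trans (just x) nothing nothing p q = p
    ⊴-trans nothing (just y) (just z) p q = U.<-≤-trans p q
    ⊴-trans nothing _ nothing p q = tt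
    ⊴-trans nothing nothing (just z) p q = q

    ⊴-antisym : ∀ x y → x ⊴ y → y ⊴ x → x ≡ y
    ⊴-antisym (just x) (just y) p q = cong just (U.≤-antisym p q)
    ⊴-antisym (just x) nothing p q = ⊥-elim (q p)
    ⊴-antisym nothing (just y) p q = ⊥-elim (p q)
    ⊴-antisym nothing nothing p q = refl

    ⊴-total : ∀ x y → x ⊴ y ⊎ y ⊴ x
    ⊴-total (just x) (just y) = U.≤-total x y
    ⊴-total (just x) nothing with em {_≤_ U x a}
    ... | yes p = inj₁ p
    ... | no k = inj₂ k
    ⊴-total nothing (just y) with em {_≤_ U y a}
    ... | yes p = inj₂ p
    ... | no k = inj₁ k
    ⊴-total nothing nothing = inj₁ tt

  inserted : LO
  inserted = record
    { Carrier = Maybe (Carrier U)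
    ; _≤_ = _⊴_
    ; isTotalOrder = record
      { isPartialOrder = record
        { isPreorder = record
          { isEquivalence = isEquivalence
          ; reflexive = λ { {x} refl → ⊴-refl x }
          ; trans = λ {x} {y} {z} → ⊴-trans x y z }
        ; antisym = λ {x} {y} → ⊴-antisym x y }
      ; total = ⊴-total } }

  into : Emb U inserted
  into = record { fun = just ; mono = id ; reflect = id }

module Buttons (em : ExcludedMiddle 0ℓ) {W : LO} where
  open StrictOrder em W

  adjacent-unpushed : ∀ {a b} → Adjacent W a b → ¬ Pushed (base W) (a , b)
  adjacent-unpushed (_ , k) (x , p , q) = k (x , (<⇒≤ p , <⇒≢ p) , (<⇒≤ q , <⇒≢ q))

  adjacent-functional : ∀ {a b b'} → Adjacent W a b → Adjacent W a b' → b ≡ b'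
  adjacent-functional {a} {b} {b'} (p , k) (p' , k') with compare b b'
  ... | less l = ⊥-elim (k' (b , p , <⇒≤ l , <⇒≢ l))
  ... | equal e = e
  ... | greater l = ⊥-elim (k (b' , p' , <⇒≤ l , <⇒≢ l))

  pushed-mono : ∀ {A B : Over W} → A ⇢ B → ∀ ab → Pushed A ab → Pushed B ab
  pushed-mono {A} {B} (f , e) (a , b) (x , p , q) = fun f x
    , subst (λ y → lt (ord B) y (fun f x)) (sym (e a)) (emb-< f p)
    , subst (λ y → lt (ord B) (fun f x) y) (sym (e b)) (emb-< f q)

  abstract
    push : Over W → Carrier W → Over W
    push A a = along A (InsertAfter.inserted em (ord A) (fun (emb A) a)) (InsertAfter.into em (ord A) (fun (emb A) a))

    push-⇢ : ∀ A a → A ⇢ push A a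
    push-⇢ A a = along-⇢ A _ (InsertAfter.into em (ord A) (fun (emb A) a))

    push-pushed : ∀ A {a b} → Adjacent W a b → Pushed (push A a) (a , b)
    push-pushed A ((p , k) , _) = nothing , (λ r → r (Order.≤-refl (ord A))) , emb-< (emb A) (≤∧≢⇒< p k)

    -- The new point sits immediately after the image of `a`. If it separates `a'` from `b'`, then
    -- `a' ≤ a < b'`, and adjacency in `W` leaves only `a' = a`.
    push-only : ∀ A {a b a' b'} → Adjacent W a b → Adjacent W a' b' →
                Pushed (push A a) (a' , b') → Pushed A (a' , b') ⊎ (a , b) ≡ (a' , b')
    push-only A adj adj' (just x , p , q) = inj₁ (x , p , q)
    push-only A {a} {b} {a'} {b'} adj adj' (nothing , p , q) with compare a' a
    ... | less l = ⊥-elim (proj₂ adj' (a , (<⇒≤ l , <⇒≢ l) , (<⇒≤ a<b' , <⇒≢ a<b')))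
      where
      a<b' : lt W a b'
      a<b' = reflect-< (emb A) q
    ... | equal refl = inj₂ (cong (a ,_) (adjacent-functional adj adj'))
    ... | greater l = ⊥-elim (p (emb-< (emb A) l))

    setDial : Over W → ℕ → Over W
    setDial A j = along A (SetDial.dialed (ord A) j) (SetDial.into (ord A) j)

    setDial-⇢ : ∀ A j → A ⇢ setDial A j
    setDial-⇢ A j = along-⇢ A _ (SetDial.into (ord A) j)

    setDial-at : ∀ A j → SatOver (setDial A j) (dial j)
    setDial-at A j = from (dial⇔ (setDial A j) j) (SetDial.dial-at (ord A) j)

    setDial-only : ∀ A j k → SatOver (setDial A j) (dial k) → k ≡ j
    setDial-only A j k s = SetDial.dial-only (ord A) j k (to (dial⇔ (setDial A j) k) s)

    setDial-pushed : ∀ A j ab → Pushed (setDial A j) ab → Pushed A ab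
    setDial-pushed A j (a , b) (inj₁ x , p , q) = x , p , q
    setDial-pushed A j (a , b) (inj₂ x , p , q) = ⊥-elim (q tt)

-- Shannon expansion.
express : ∀ {W m} → (Fin m → Sentence W) → (Vec Bool m → Sentence W) → Sentence W
express {m = zero} θ g = g []
express {m = suc m} θ g = (θ zero ∧ᶠ express (θ ∘ suc) (g ∘ (true ∷_))) ∨ᶠ ((¬ᶠ θ zero) ∧ᶠ express (θ ∘ suc) (g ∘ (false ∷_)))

module _ (em : ExcludedMiddle (lsuc 0ℓ)) {W : LO} where

  bits : ∀ {m} → (Fin m → Sentence W) → Over W → Vec Bool m
  bits θ A = tabulate (λ i → does (em {SatOver A (θ i)}))

  bits⇔ : ∀ {m} (θ : Fin m → Sentence W) A i → (Vec.lookup (bits θ A) i ≡ true) ⇔ SatOver A (θ i)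
  bits⇔ θ A i rewrite lookup∘tabulate (λ i → does (em {SatOver A (θ i)})) i with em {SatOver A (θ i)}
  ... | yes p = mk⇔ (λ _ → p) (λ _ → refl)
  ... | no k = mk⇔ (λ ()) (λ p → ⊥-elim (k p))

  express⇔ : ∀ {m} (θ : Fin m → Sentence W) g A → SatOver A (express θ g) ⇔ SatOver A (g (bits θ A))
  express⇔ {zero} θ g A = mk⇔ id id
  express⇔ {suc m} θ g A with em {SatOver A (θ zero)}
  ... | yes p = mk⇔ (λ { (inj₁ (_ , q)) → to ih q ; (inj₂ (k , _)) → ⊥-elim (k p) }) (λ q → inj₁ (p , from ih q))
    where ih = express⇔ (θ ∘ suc) (g ∘ (true ∷_)) A
  ... | no k = mk⇔ (λ { (inj₁ (p , _)) → ⊥-elim (k p) ; (inj₂ (_ , q)) → to ih q }) (λ q → inj₂ (k , from ih q))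
    where ih = express⇔ (θ ∘ suc) (g ∘ (false ∷_)) A

-- The p-morphism onto a finite frame

module Labelling (em : ExcludedMiddle (lsuc 0ℓ)) {W : LO} {ψ : PForm} (C : Countermodel ψ)
                 (pair : Fin (Countermodel.size C) → Carrier W × Carrier W)
                 (pair-injective : Injective _≡_ _≡_ pair)
                 (adjacent : ∀ i → Adjacent W (proj₁ (pair i)) (proj₂ (pair i))) where
  open Countermodel C
  private
    em₀ : ExcludedMiddle 0ℓ
    em₀ = lower-em em
    module B = Buttons em₀ {W}

  Member : Vec Bool size → Fin size → Set
  Member P i = (i ≡ root) ⊎ (Vec.lookup P i ≡ true)

  Chain : Vec Bool size → Set
  Chain P = ∀ i j → Member P i → Member P j → (i ⊑ j) ⊎ (j ⊑ i)

  Peak : Vec Bool size → Fin size → Set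
  Peak P m = Chain P × Member P m × (∀ i → Member P i → i ⊑ m)

  chain-peak : ∀ P → Chain P → Σ[ m ∈ Fin size ] Peak P m
  chain-peak P c = let (m , mem , max) = go (allFin size) in m , c , mem , λ i → max i (∈-allFin i)
    where
    go : ∀ l → Σ[ m ∈ Fin size ] (Member P m × (∀ i → i ∈ l → Member P i → i ⊑ m))
    go [] = root , inj₁ refl , λ _ ()
    go (i ∷ l) with go l | em₀ {Member P i}
    ... | m , mem , max | no k = m , mem , λ { _ (here refl) q → ⊥-elim (k q) ; j (there p) q → max j p q }
    ... | m , mem , max | yes q with c i m q mem
    ... | inj₁ i⊑m = m , mem , λ { _ (here refl) _ → i⊑m ; j (there p) q → max j p q }
    ... | inj₂ m⊑i = i , q , λ { _ (here refl) _ → ⊑-refl i ; j (there p) q → ⊑-trans (max j p q) m⊑i }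

  -- The world reached by a set of pushed buttons: the top element of the chain it forms
  -- together with the root, and the top of the frame if it is not a chain.
  peak : Vec Bool size → Fin size
  peak P with em₀ {Σ[ m ∈ Fin size ] Peak P m}
  ... | yes (m , _) = m
  ... | no _ = top

  -- In a preorder a maximum is determined only up to its cluster, so `peak` is used through
  -- inequalities and not through equations.
  ⊑-peak : ∀ P i → (∀ {m} → Peak P m → i ⊑ m) → i ⊑ peak P
  ⊑-peak P i h with em₀ {Σ[ m ∈ Fin size ] Peak P m}
  ... | yes (m , pk) = h pk
  ... | no _ = ⊑top i

  peak-⊑ : ∀ P i {m} → Peak P m → m ⊑ i → peak P ⊑ i
  peak-⊑ P i {m} (c , mem , max) p with em₀ {Σ[ m ∈ Fin size ] Peak P m}
  ... | yes (m' , c' , mem' , max') = ⊑-trans (max m' mem') p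
  ... | no k = ⊥-elim (k (m , c , mem , max))

  peak-cases : ∀ P → (Σ[ m ∈ Fin size ] (Peak P m × (m ⊑ peak P))) ⊎ (∀ i → i ⊑ peak P)
  peak-cases P with em₀ {Σ[ m ∈ Fin size ] Peak P m}
  ... | yes (m , pk) = inj₁ (m , pk , ⊑-refl m)
  ... | no _ = inj₂ ⊑top

  -- A subset of a chain is a chain, so a peak of `Q` yields a peak of `P` below it; if `Q` has
  -- none, its value is `top`.
  peak-mono : ∀ P Q → (∀ i → Vec.lookup P i ≡ true → Vec.lookup Q i ≡ true) → peak P ⊑ peak Q
  peak-mono P Q sub = ⊑-peak Q (peak P) λ {m} (c , mem , max) →
    let (m' , pk) = chain-peak P (λ i j p q → c i j (incl p) (incl q)) in
    peak-⊑ P m pk (max m' (incl (proj₁ (proj₂ pk))))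
    where
    incl : ∀ {i} → Member P i → Member Q i
    incl (inj₁ e) = inj₁ e
    incl (inj₂ t) = inj₂ (sub _ t)

  private
    θ δ : Fin size → Sentence W
    θ i = button (pair i)
    δ i = dial (toℕ i)

  reading : Vec Bool size → Fin size
  reading D with em₀ {Σ[ j ∈ Fin size ] (Vec.lookup D j ≡ true)}
  ... | yes (j , _) = j
  ... | no _ = root

  reading-unique : ∀ D j → Vec.lookup D j ≡ true → (∀ i → Vec.lookup D i ≡ true → i ≡ j) → reading D ≡ j
  reading-unique D j p u with em₀ {Σ[ j ∈ Fin size ] (Vec.lookup D j ≡ true)}
  ... | yes (i , q) = u i q
  ... | no k = ⊥-elim (k (j , p))

  private
    initial : Fin size
    initial = reading (bits em δ (base W))

  -- A dial reading outside the cluster of `m` is ignored. The label thus stays equivalent to the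
  -- peak, so monotonicity of the peak suffices for `forth`.
  choose : (m j : Fin size) → Fin size
  choose m j = if does (em₀ {(m ⊑ j) × (j ⊑ m)}) then j else m

  choose-⊑ : ∀ m j → choose m j ⊑ m
  choose-⊑ m j with em₀ {(m ⊑ j) × (j ⊑ m)}
  ... | yes (_ , q) = q
  ... | no _ = ⊑-refl m

  ⊑-choose : ∀ m j → m ⊑ choose m j
  ⊑-choose m j with em₀ {(m ⊑ j) × (j ⊑ m)}
  ... | yes (p , _) = p
  ... | no _ = ⊑-refl m

  choose-cluster : ∀ m j → m ⊑ j → j ⊑ m → choose m j ≡ j
  choose-cluster m j p q with em₀ {(m ⊑ j) × (j ⊑ m)}
  ... | yes _ = refl
  ... | no k = ⊥-elim (k (p , q))

  choose-self : ∀ m → choose m m ≡ m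
  choose-self m = choose-cluster m m (⊑-refl m) (⊑-refl m)

  -- The dial positions are permuted so that the reading at W denotes the root.
  label : Vec Bool size → Vec Bool size → Fin size
  label P D = choose (peak P) (transpose initial root (reading D))

  substitution : ℕ → Sentence W
  substitution n = express θ λ P → express δ λ D →
    if does (em₀ {valuation (label P D) n}) then ⊤ᶠ else ⊥ᶠ

  labelOf : Over W → Fin size
  labelOf A = label (bits em θ A) (bits em δ A)

  private
    pushed⇔ : ∀ A i → (Vec.lookup (bits em θ A) i ≡ true) ⇔ Pushed A (pair i)
    pushed⇔ A i = mk⇔ (λ e → to (button⇔ A (pair i)) (to (bits⇔ em θ A i) e))
                      (λ p → from (bits⇔ em θ A i) (from (button⇔ A (pair i)) p))

    peakOf : Over W → Fin size
    peakOf A = peak (bits em θ A)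

    peakOf-mono : ∀ {A B} → (∀ i → Pushed A (pair i) → Pushed B (pair i)) → peakOf A ⊑ peakOf B
    peakOf-mono {A} {B} sub = peak-mono _ _ λ i e → from (pushed⇔ B i) (sub i (to (pushed⇔ A i) e))

    label-setDial : ∀ A v → peakOf A ⊑ v → v ⊑ peakOf A →
                    labelOf (B.setDial A (toℕ (transpose root initial v))) ≡ v
    label-setDial A v p q = trans (cong (λ j → choose (peakOf A') (transpose initial root j)) read)
        (trans (cong (choose (peakOf A')) (transpose-inverse initial root))
          (choose-cluster (peakOf A') v (⊑-trans down p) (⊑-trans q up)))
      where
      j = transpose root initial v
      A' = B.setDial A (toℕ j)
      down : peakOf A' ⊑ peakOf A
      down = peakOf-mono {A'} {A} λ i → B.setDial-pushed A (toℕ j) (pair i)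
      up : peakOf A ⊑ peakOf A'
      up = peakOf-mono {A} {A'} λ i → B.pushed-mono {A} {A'} (B.setDial-⇢ A (toℕ j)) (pair i)
      read : reading (bits em δ A') ≡ j
      read = reading-unique _ j
        (from (bits⇔ em δ A' j) (B.setDial-at A (toℕ j)))
        (λ i e → toℕ-injective (B.setDial-only A (toℕ j) (toℕ i) (to (bits⇔ em δ A' i) e)))

    -- If `v` is below the peak, it lies in the cluster of the peak, and turning the dial is enough.
    -- Otherwise the button of `v` is pushed first: all members so far are below `v`, so they still
    -- form a chain and `v` becomes its peak.
    realize : ∀ A v → labelOf A ⊑ v → Σ[ B ∈ Over W ] ((A ⇢ B) × labelOf B ≡ v)
    realize A v r with em₀ {v ⊑ peakOf A}
    ... | yes q = B.setDial A j , B.setDial-⇢ A j , label-setDial A v (⊑-trans (⊑-choose _ _) r) q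
      where j = toℕ (transpose root initial v)
    ... | no k = B.setDial A' j ,
                 ⇢-trans {A = A} {A'} {B.setDial A' j} (B.push-⇢ A (proj₁ (pair v))) (B.setDial-⇢ A' j) ,
                 label-setDial A' v (peak-⊑ _ v pk' (⊑-refl v)) (⊑-peak _ v (λ (_ , _ , max) → max v v∈))
      where
      j = toℕ (transpose root initial v)
      A' = B.push A (proj₁ (pair v))
      -- v is strictly above the peak, so the peak is not the top and the buttons form a chain.
      peaked : Σ[ m ∈ Fin size ] (Peak (bits em θ A) m × (m ⊑ v))
      peaked with peak-cases (bits em θ A)
      ... | inj₁ (m , pk , m⊑) = m , pk , ⊑-trans m⊑ (⊑-trans (⊑-choose _ _) r)
      ... | inj₂ max = ⊥-elim (k (max v))
      v∈ : Member (bits em θ A') v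
      v∈ = inj₂ (from (pushed⇔ A' v) (B.push-pushed A (adjacent v)))
      old : ∀ {i} → Member (bits em θ A') i → Member (bits em θ A) i ⊎ i ≡ v
      old (inj₁ e) = inj₁ (inj₁ e)
      old {i} (inj₂ t) with B.push-only A (adjacent v) (adjacent i) (to (pushed⇔ A' i) t)
      ... | inj₁ p = inj₁ (inj₂ (from (pushed⇔ A i) p))
      ... | inj₂ e = inj₂ (sym (pair-injective e))
      below : ∀ i → Member (bits em θ A') i → i ⊑ v
      below i mem with old mem
      ... | inj₁ mem' = let (m , (_ , _ , max) , m⊑v) = peaked in ⊑-trans (max i mem') m⊑v
      ... | inj₂ refl = ⊑-refl v
      chain : Chain (bits em θ A')
      chain i j p q with old p | old q
      ... | inj₁ p' | inj₁ q' = proj₁ (proj₁ (proj₂ peaked)) i j p' q'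
      ... | inj₂ refl | _ = inj₂ (below j q)
      ... | _ | inj₂ refl = inj₁ (below i p)
      pk' : Peak (bits em θ A') v
      pk' = chain , v∈ , below

  labelling : PMorphism (loModel substitution) model
  labelling = record
    { image = labelOf
    ; atoms = λ A n → mk⇔
        (λ s → decode A n (to (express⇔ em δ _ A) (to (express⇔ em θ _ A) s)))
        (λ v → from (express⇔ em θ _ A) (from (express⇔ em δ _ A) (encode A n v)))
    ; forth = λ {A} {B} r → ⊑-trans (choose-⊑ _ _)
        (⊑-trans (peakOf-mono {A} {B} λ i → B.pushed-mono {A} {B} r (pair i)) (⊑-choose _ _))
    ; back = λ {A} {v} → realize A v }
    where
    decode : ∀ A n → SatOver A (if does (em₀ {valuation (labelOf A) n}) then ⊤ᶠ else ⊥ᶠ) → valuation (labelOf A) n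
    decode A n s with em₀ {valuation (labelOf A) n}
    ... | yes v = v
    encode : ∀ A n → valuation (labelOf A) n → SatOver A (if does (em₀ {valuation (labelOf A) n}) then ⊤ᶠ else ⊥ᶠ)
    encode A n v with em₀ {valuation (labelOf A) n}
    ... | yes _ = lift tt
    ... | no k = ⊥-elim (k v)

  label-base : labelOf (base W) ≡ root
  label-base = trans (cong (choose (peakOf (base W))) transposed)
                     (trans (cong (λ m → choose m root) peak-base) (choose-self root))
    where
    transposed : transpose initial root initial ≡ root
    transposed rewrite dec-true (initial ≟ initial) refl = refl
    only-root : ∀ {i} → Member (bits em θ (base W)) i → i ≡ root
    only-root (inj₁ e) = e
    only-root {i} (inj₂ t) = ⊥-elim (B.adjacent-unpushed (adjacent i) (to (pushed⇔ (base W) i) t))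
    pk : Peak (bits em θ (base W)) root
    pk = (λ { i j p q → inj₁ (subst (_⊑ j) (sym (only-root p)) (root⊑ j)) })
       , inj₁ refl
       , λ i p → subst (_⊑ root) (sym (only-root p)) (⊑-refl root)
    peak-base : peakOf (base W) ≡ root
    peak-base with em₀ {Σ[ m ∈ Fin size ] Peak (bits em θ (base W)) m}
    ... | yes (m , _ , mem , _) = only-root mem
    ... | no k = ⊥-elim (k (root , pk))

Val⊆S4·2 : ExcludedMiddle (lsuc 0ℓ) → ∀ W → InfinitelyManyAdjacentPairs W → ∀ ψ → Val W ψ → S4·2 ψ
Val⊆S4·2 em W inf ψ valid = by-contradiction (lower-em em) λ unprovable →
  let C = S4·2-countermodel (lower-em em) ψ unprovable
      (pair , inj , adj) = inf (Countermodel.size C)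
      module L = Labelling em {W} {ψ} C pair inj adj
  in Countermodel.refutes C (subst (λ w → forces (Countermodel.model C) w ψ) L.label-base
       (to (forces-image L.labelling ψ (base W)) (to (inst⇔forces L.substitution ψ (base W)) (valid L.substitution))))

-- Ehrenfeucht–Fraïssé equivalence of segments

-- A predicate on a fixed host: cutting at a point during the game changes only the predicate.
record Seg : Set₁ where
  constructor seg
  field
    host : LO
    mem  : Carrier host → Set
open Seg

Pt : Seg → Set
Pt S = Carrier (host S)

full : LO → Seg
full U = seg U (λ _ → ⊤)

below above : (S : Seg) → Pt S → Seg
below S x = seg (host S) (λ z → mem S z × lt (host S) z x)
above S x = seg (host S) (λ z → mem S z × lt (host S) x z)

Forth : (Seg → Seg → Set) → Seg → Seg → Set
Forth R S T = ∀ x → mem S x → Σ[ y ∈ Pt T ] (mem T y × R (below S x) (below T y) × R (above S x) (above T y))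

-- After a move the d-round game splits into independent games below and above the chosen points.
Eq : ℕ → Seg → Seg → Set
Eq zero    S T = ⊤
Eq (suc d) S T = Forth (Eq d) S T × Forth (Eq d) T S

Eq-refl : ∀ d {S} → Eq d S S
Eq-refl zero = tt
Eq-refl (suc d) = (λ x m → x , m , Eq-refl d , Eq-refl d) , (λ x m → x , m , Eq-refl d , Eq-refl d)

Eq-sym : ∀ d {S T} → Eq d S T → Eq d T S
Eq-sym zero _ = tt
Eq-sym (suc d) (f , b) = b , f

Eq-trans : ∀ d {S T R} → Eq d S T → Eq d T R → Eq d S R
Eq-trans zero _ _ = tt
Eq-trans (suc d) (f , b) (f' , b') = compose f f' , compose b' b
  where
  compose : ∀ {S T R} → Forth (Eq d) S T → Forth (Eq d) T R → Forth (Eq d) S R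
  compose f g x m = let (y , m' , l , u) = f x m ; (z , m″ , l' , u') = g y m' in
    z , m″ , Eq-trans d l l' , Eq-trans d u u'

Eq-pred : ∀ d {S T} → Eq (suc d) S T → Eq d S T
Eq-pred zero _ = tt
Eq-pred (suc d) (f , b) = weaken f , weaken b
  where
  weaken : ∀ {S T} → Forth (Eq (suc d)) S T → Forth (Eq d) S T
  weaken f x m = let (y , m' , l , u) = f x m in y , m' , Eq-pred d l , Eq-pred d u

AtLeast : ℕ → Seg → Set
AtLeast zero    S = ⊤
AtLeast (suc n) S = Σ[ x ∈ Pt S ] (mem S x × AtLeast n (above S x))

AtLeast-Eq : ∀ n {S T} → Eq n S T → AtLeast n S → AtLeast n T
AtLeast-Eq zero _ _ = tt
AtLeast-Eq (suc n) (f , _) (x , m , a) = let (y , m' , _ , u) = f x m in y , m' , AtLeast-Eq n u a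

Eq-≤ : ∀ {d e} → d ℕ.≤ e → ∀ {S T} → Eq e S T → Eq d S T
Eq-≤ p = go (ℕ.≤⇒≤′ p)
  where
  go : ∀ {d e} → d ℕ.≤′ e → ∀ {S T} → Eq e S T → Eq d S T
  go ℕ.≤′-refl q = q
  go (ℕ.≤′-step p) q = go p (Eq-pred _ q)

-- `fn` receives a membership proof, and memberships need not be propositions. Having `fn-≤` besides
-- `fn-<` makes the value independent of that proof.
record Embeds (S T : Seg) : Set where
  field
    fn     : ∀ x → mem S x → Pt T
    fn∈    : ∀ x m → mem T (fn x m)
    fn-≤   : ∀ {x y} m m' → _≤_ (host S) x y → _≤_ (host T) (fn x m) (fn y m')
    fn-<   : ∀ {x y} m m' → lt (host S) x y → lt (host T) (fn x m) (fn y m')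
open Embeds

Embeds-trans : ∀ {S T R} → Embeds S T → Embeds T R → Embeds S R
Embeds-trans e f = record
  { fn = λ x m → fn f (fn e x m) (fn∈ e x m)
  ; fn∈ = λ x m → fn∈ f _ _
  ; fn-≤ = λ m m' p → fn-≤ f _ _ (fn-≤ e m m' p)
  ; fn-< = λ m m' p → fn-< f _ _ (fn-< e m m' p) }

AtLeast-Embeds : ∀ n {S T} → Embeds S T → AtLeast n S → AtLeast n T
AtLeast-Embeds zero e _ = tt
AtLeast-Embeds (suc n) e (x , m , a) = fn e x m , fn∈ e x m , AtLeast-Embeds n (record
  { fn = λ z (m' , _) → fn e z m'
  ; fn∈ = λ z (m' , l) → fn∈ e z m' , fn-< e m m' l
  ; fn-≤ = λ (m' , _) (m″ , _) → fn-≤ e m' m″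
  ; fn-< = λ (m' , _) (m″ , _) → fn-< e m' m″ }) a

subseg : ∀ {U} {P Q : Carrier U → Set} → (∀ x → P x → Q x) → Embeds (seg U P) (seg U Q)
subseg h = record { fn = λ x _ → x ; fn∈ = h ; fn-≤ = λ _ _ p → p ; fn-< = λ _ _ p → p }

LoBound HiBound : (U : LO) → Maybe (Carrier U) → Carrier U → Set
LoBound U nothing  x = ⊤
LoBound U (just a) x = lt U a x
HiBound U nothing  x = ⊤
HiBound U (just b) x = lt U x b

between : (U : LO) → Maybe (Carrier U) → Maybe (Carrier U) → Seg
between U a b = seg U (λ x → LoBound U a x × HiBound U b x)

module EF (em : ExcludedMiddle 0ℓ) where

  record _≅_ (S T : Seg) : Set where
    field
      map    : Pt S → Pt T
      map∈   : ∀ {x} → mem S x → mem T (map x)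
      onto   : ∀ {y} → mem T y → Σ[ x ∈ Pt S ] (mem S x × map x ≡ y)
      strict : ∀ {x y} → mem S x → mem S y → lt (host S) x y → lt (host T) (map x) (map y)

    reflects : ∀ {x y} → mem S x → mem S y → lt (host T) (map x) (map y) → lt (host S) x y
    reflects {x} {y} m m' l with StrictOrder.compare em (host S) x y
    ... | StrictOrder.less k = k
    ... | StrictOrder.equal refl = ⊥-elim (l (Order.≤-refl (host T)))
    ... | StrictOrder.greater k = ⊥-elim (l (Order.<⇒≤ (host T) (strict m' m k)))
  open _≅_

  ≅-below : ∀ {S T} (i : S ≅ T) {x} → mem S x → below S x ≅ below T (map i x)
  ≅-below {S} {T} i {x} m = record
    { map = map i
    ; map∈ = λ (m' , l) → map∈ i m' , strict i m' m l
    ; onto = λ { (m' , l) → case (onto i m') l }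
    ; strict = λ (m' , _) (m″ , _) → strict i m' m″ }
    where
    case : ∀ {y} → Σ[ z ∈ Pt S ] (mem S z × map i z ≡ y) → lt (host T) y (map i x) →
           Σ[ z ∈ Pt S ] (mem (below S x) z × map i z ≡ y)
    case (z , mz , refl) l = z , (mz , reflects i mz m l) , refl

  ≅-above : ∀ {S T} (i : S ≅ T) {x} → mem S x → above S x ≅ above T (map i x)
  ≅-above {S} {T} i {x} m = record
    { map = map i
    ; map∈ = λ (m' , l) → map∈ i m' , strict i m m' l
    ; onto = λ { (m' , l) → case (onto i m') l }
    ; strict = λ (m' , _) (m″ , _) → strict i m' m″ }
    where
    case : ∀ {y} → Σ[ z ∈ Pt S ] (mem S z × map i z ≡ y) → lt (host T) (map i x) y →
           Σ[ z ∈ Pt S ] (mem (above S x) z × map i z ≡ y)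
    case (z , mz , refl) l = z , (mz , reflects i m mz l) , refl

  ≅⇒Eq : ∀ d {S T} → S ≅ T → Eq d S T
  ≅⇒Eq zero i = tt
  ≅⇒Eq (suc d) {S} {T} i = (λ x m → map i x , map∈ i m , ≅⇒Eq d (≅-below i m) , ≅⇒Eq d (≅-above i m)) , bk
    where
    bk : Forth (Eq d) T S
    bk y m with onto i m
    ... | x , mx , refl = x , mx , Eq-sym d (≅⇒Eq d (≅-below i mx)) , Eq-sym d (≅⇒Eq d (≅-above i mx))

  same : ∀ {U} {P Q : Carrier U → Set} → (∀ x → P x → Q x) → (∀ x → Q x → P x) → seg U P ≅ seg U Q
  same h k = record { map = id ; map∈ = λ {x} → h x ; onto = λ {x} m → x , k x m , refl ; strict = λ _ _ l → l }

  -- Games on ordered sums and products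

  record Split (S : Seg) (P Q : Pt S → Set) : Set where
    field
      cover : ∀ {x} → mem S x → P x ⊎ Q x
      inˡ   : ∀ {x} → P x → mem S x
      inʳ   : ∀ {x} → Q x → mem S x
      sep   : ∀ {x y} → P x → Q y → lt (host S) x y
  open Split

  module _ {S : Seg} {P Q : Pt S → Set} (s : Split S P Q) where
    private
      U = host S
      open Order U

    split-below-left : ∀ {x} → P x → below S x ≅ below (seg U P) x
    split-below-left {x} p = same (λ { z (m , l) → onlyˡ z (cover s m) l , l }) (λ z (q , l) → inˡ s q , l)
      where
      onlyˡ : ∀ z → P z ⊎ Q z → lt U z x → P z
      onlyˡ z (inj₁ q) l = q
      onlyˡ z (inj₂ q) l = ⊥-elim (l (<⇒≤ (sep s p q)))

    split-above-left : ∀ {x} → P x → Split (above S x) (mem (above (seg U P) x)) Q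
    split-above-left {x} p = record
      { cover = λ { (m , l) → cov (cover s m) l }
      ; inˡ = λ (q , l) → inˡ s q , l
      ; inʳ = λ q → inʳ s q , sep s p q
      ; sep = λ (p' , _) q → sep s p' q }
      where
      cov : ∀ {z} → P z ⊎ Q z → lt U x z → (P z × lt U x z) ⊎ Q z
      cov (inj₁ p) l = inj₁ (p , l)
      cov (inj₂ q) l = inj₂ q

    split-above-right : ∀ {x} → Q x → above S x ≅ above (seg U Q) x
    split-above-right {x} q = same (λ { z (m , l) → onlyʳ z (cover s m) l , l }) (λ z (q , l) → inʳ s q , l)
      where
      onlyʳ : ∀ z → P z ⊎ Q z → lt U x z → Q z
      onlyʳ z (inj₁ p) l = ⊥-elim (l (<⇒≤ (sep s p q)))
      onlyʳ z (inj₂ q) l = q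

    split-below-right : ∀ {x} → Q x → Split (below S x) P (mem (below (seg U Q) x))
    split-below-right {x} q = record
      { cover = λ { (m , l) → cov (cover s m) l }
      ; inˡ = λ p → inˡ s p , sep s p q
      ; inʳ = λ (q , l) → inʳ s q , l
      ; sep = λ p (q' , _) → sep s p q' }
      where
      cov : ∀ {z} → P z ⊎ Q z → lt U z x → P z ⊎ (Q z × lt U z x)
      cov (inj₁ p) l = inj₁ p
      cov (inj₂ q) l = inj₂ (q , l)

  ≅-Eq-≅ : ∀ d {S S' T T'} → S ≅ S' → T ≅ T' → Eq d S' T' → Eq d S T
  ≅-Eq-≅ d i j e = Eq-trans d (≅⇒Eq d i) (Eq-trans d e (Eq-sym d (≅⇒Eq d j)))

  -- A move in one summand is answered there. The other summand passes whole into one of the two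
  -- halves, where it needs one round less.
  glue : ∀ d {S T P₁ P₂ Q₁ Q₂} → Split S P₁ P₂ → Split T Q₁ Q₂ →
         Eq d (seg (host S) P₁) (seg (host T) Q₁) → Eq d (seg (host S) P₂) (seg (host T) Q₂) → Eq d S T
  glue zero s t _ _ = tt
  glue (suc d) s t e₁ e₂ = half s t e₁ e₂ , half t s (Eq-sym (suc d) e₁) (Eq-sym (suc d) e₂)
    where
    half : ∀ {S T P₁ P₂ Q₁ Q₂} → Split S P₁ P₂ → Split T Q₁ Q₂ →
           Eq (suc d) (seg (host S) P₁) (seg (host T) Q₁) → Eq (suc d) (seg (host S) P₂) (seg (host T) Q₂) → Forth (Eq d) S T
    half s t e₁ e₂ x m with cover s m
    ... | inj₁ p = let (y , q , l , u) = proj₁ e₁ x p in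
          y , inˡ t q , ≅-Eq-≅ d (split-below-left s p) (split-below-left t q) l
            , glue d (split-above-left s p) (split-above-left t q) u (Eq-pred d e₂)
    ... | inj₂ p = let (y , q , l , u) = proj₁ e₂ x p in
          y , inʳ t q , glue d (split-below-right s p) (split-below-right t q) (Eq-pred d e₁) l
            , ≅-Eq-≅ d (split-above-right s p) (split-above-right t q) u

  module _ (L X : LO) where
    private
      module L = StrictOrder em L
      module X = StrictOrder em X

      _⊴_ : Carrier L × Carrier X → Carrier L × Carrier X → Set
      (l , x) ⊴ (m , y) = lt L l m ⊎ (l ≡ m × _≤_ X x y)

      ⊴-trans : ∀ {p q r} → p ⊴ q → q ⊴ r → p ⊴ r
      ⊴-trans (inj₁ a) (inj₁ b) = inj₁ (L.<-trans a b)
      ⊴-trans (inj₁ a) (inj₂ (refl , _)) = inj₁ a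
      ⊴-trans (inj₂ (refl , _)) (inj₁ b) = inj₁ b
      ⊴-trans (inj₂ (refl , a)) (inj₂ (refl , b)) = inj₂ (refl , X.≤-trans a b)

      ⊴-antisym : ∀ {p q} → p ⊴ q → q ⊴ p → p ≡ q
      ⊴-antisym (inj₁ a) (inj₁ b) = ⊥-elim (a (L.<⇒≤ b))
      ⊴-antisym (inj₁ a) (inj₂ (refl , _)) = ⊥-elim (a L.≤-refl)
      ⊴-antisym (inj₂ (refl , _)) (inj₁ b) = ⊥-elim (b L.≤-refl)
      ⊴-antisym (inj₂ (refl , a)) (inj₂ (_ , b)) = cong (_ ,_) (X.≤-antisym a b)

      ⊴-total : ∀ p q → p ⊴ q ⊎ q ⊴ p
      ⊴-total (l , x) (m , y) with L.compare l m
      ... | L.less a = inj₁ (inj₁ a)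
      ... | L.greater a = inj₂ (inj₁ a)
      ... | L.equal refl with X.≤-total x y
      ... | inj₁ b = inj₁ (inj₂ (refl , b))
      ... | inj₂ b = inj₂ (inj₂ (refl , b))

    Lex : LO
    Lex = record
      { Carrier = Carrier L × Carrier X
      ; _≤_ = _⊴_
      ; isTotalOrder = record
        { isPartialOrder = record
          { isPreorder = record
            { isEquivalence = isEquivalence
            ; reflexive = λ { refl → inj₂ (refl , X.≤-refl) }
            ; trans = ⊴-trans }
          ; antisym = ⊴-antisym }
        ; total = ⊴-total } }

    lex-<ˡ : ∀ {l m x y} → lt L l m → lt Lex (l , x) (m , y)
    lex-<ˡ a (inj₁ b) = a (L.<⇒≤ b)
    lex-<ˡ a (inj₂ (refl , _)) = a L.≤-refl

    lex-<ʳ : ∀ {l x y} → lt X x y → lt Lex (l , x) (l , y)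
    lex-<ʳ a (inj₁ b) = b L.≤-refl
    lex-<ʳ a (inj₂ (_ , b)) = a b

    lex-<-elim : ∀ {l m x y} → lt Lex (l , x) (m , y) → lt L l m ⊎ (l ≡ m × lt X x y)
    lex-<-elim {l} {m} k with L.compare l m
    ... | L.less a = inj₁ a
    ... | L.equal refl = inj₂ (refl , λ b → k (inj₂ (refl , b)))
    ... | L.greater a = ⊥-elim (k (inj₁ a))

  -- The product with one copy of the second segment for each point of the first.
  box : Seg → Seg → Seg
  box I B = seg (Lex (host I) (host B)) (λ (l , x) → mem I l × mem B x)

  fibre : (L : LO) → Carrier L → Seg → Seg
  fibre L l B = box (seg L (_≡ l)) B

  fibre-≅ : ∀ {L l B} → fibre L l B ≅ B
  fibre-≅ {L} {l} {B} = record
    { map = proj₂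
    ; map∈ = proj₂
    ; onto = λ {y} m → (l , y) , (refl , m) , refl
    ; strict = λ { (refl , _) (refl , _) k → λ p → k (inj₂ (refl , p)) } }

  split-box-below : ∀ I B {l x} → mem I l → mem B x →
    Split (below (box I B) (l , x)) (mem (box (below I l) B)) (mem (fibre (host I) l (below B x)))
  split-box-below I B {l} {x} ml mx = record
    { cover = λ { ((m , b) , k) → cov (lex-<-elim (host I) (host B) k) m b }
    ; inˡ = λ ((m , k) , b) → (m , b) , lex-<ˡ (host I) (host B) k
    ; inʳ = λ { (refl , b , k) → (ml , b) , lex-<ʳ (host I) (host B) k }
    ; sep = λ { ((m , k) , _) (refl , _) → lex-<ˡ (host I) (host B) k } }
    where
    cov : ∀ {l' x'} → lt (host I) l' l ⊎ (l' ≡ l × lt (host B) x' x) → mem I l' → mem B x' → _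
    cov (inj₁ k) m b = inj₁ ((m , k) , b)
    cov (inj₂ (e , k)) m b = inj₂ (e , b , k)

  split-box-above : ∀ I B {l x} → mem I l → mem B x →
    Split (above (box I B) (l , x)) (mem (fibre (host I) l (above B x))) (mem (box (above I l) B))
  split-box-above I B {l} {x} ml mx = record
    { cover = λ { ((m , b) , k) → cov (lex-<-elim (host I) (host B) k) m b }
    ; inˡ = λ { (refl , b , k) → (ml , b) , lex-<ʳ (host I) (host B) k }
    ; inʳ = λ ((m , k) , b) → (m , b) , lex-<ˡ (host I) (host B) k
    ; sep = λ { (refl , _) ((m , k) , _) → lex-<ˡ (host I) (host B) k } }
    where
    cov : ∀ {l' x'} → lt (host I) l l' ⊎ (l ≡ l' × lt (host B) x x') → mem I l' → mem B x' → _
    cov (inj₁ k) m b = inj₂ ((m , k) , b)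
    cov (inj₂ (e , k)) m b = inj₁ (sym e , b , k)

  Eq-fibre : ∀ d {L l L' l' A B} → Eq d A B → Eq d (fibre L l A) (fibre L' l' B)
  Eq-fibre d {L} {l} {L'} {l'} {A} {B} = ≅-Eq-≅ d (fibre-≅ {L} {l}) (fibre-≅ {L'} {l'})

  -- Cutting a product at a point leaves a smaller product and part of one copy of `B`. The index is
  -- answered by the game on `I` and `J`, and the coordinate in `B` is repeated.
  Eq-box : ∀ d {I J B} → Eq d I J → Eq d (box I B) (box J B)
  Eq-box zero _ = tt
  Eq-box (suc d) {I} {J} {B} (f , b) = half f , half b
    where
    half : ∀ {I J} → Forth (Eq d) I J → Forth (Eq d) (box I B) (box J B)
    half {I} {J} f (l , x) (ml , mx) = let (m , mm , lo , hi) = f l ml in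
      (m , x) , (mm , mx)
      , glue d (split-box-below I B ml mx) (split-box-below J B mm mx) (Eq-box d lo) (Eq-fibre d (Eq-refl d))
      , glue d (split-box-above I B ml mx) (split-box-above J B mm mx) (Eq-fibre d (Eq-refl d)) (Eq-box d hi)

  between-below : ∀ U a b {x} → mem (between U a b) x → below (between U a b) x ≅ between U a (just x)
  between-below U a b (p , q) = same (λ z ((r , _) , l) → r , l) (λ z (r , l) → (r , shrink b q l) , l)
    where
    shrink : ∀ b {x z} → HiBound U b x → lt U z x → HiBound U b z
    shrink nothing _ _ = tt
    shrink (just b) q l = Order.<-trans U l q

  between-above : ∀ U a b {x} → mem (between U a b) x → above (between U a b) x ≅ between U (just x) b
  between-above U a b (p , q) = same (λ z ((_ , r) , l) → l , r) (λ z (l , r) → (shrink a p l , r) , l)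
    where
    shrink : ∀ a {x z} → LoBound U a x → lt U x z → LoBound U a z
    shrink nothing _ _ = tt
    shrink (just a) p l = Order.<-trans U p l

  -- Discrete orders

  ℤ-LO : LO
  ℤ-LO = record { Carrier = ℤ ; _≤_ = ℤ._≤_ ; isTotalOrder = ℤ.≤-isTotalOrder }

  -- Multiplying by ℤ makes any `A` discrete without end points. Finite intervals and intervals
  -- spanning much of `A` then live in one order and can be compared there.
  module Shift (A : LO) where
    L : LO
    L = Lex A ℤ-LO

    private
      module L = StrictOrder em L

    infixl 6 _⊹_
    _⊹_ : Carrier L → ℕ → Carrier L
    (a , m) ⊹ k = a , m ℤ.+ + k

    ⊹-+ : ∀ x i j → x ⊹ i ⊹ j ≡ x ⊹ (i ℕ.+ j)
    ⊹-+ (a , m) i j = cong (a ,_) (trans (ℤ.+-assoc m (+ i) (+ j)) (cong (ℤ._+_ m) (sym (ℤ.pos-+ i j))))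

    ⊹-0 : ∀ x → x ⊹ 0 ≡ x
    ⊹-0 (a , m) = cong (a ,_) (ℤ.+-identityʳ m)

    ⊹-mono : ∀ x {i j} → i ℕ.≤ j → _≤_ L (x ⊹ i) (x ⊹ j)
    ⊹-mono (a , m) p = inj₂ (refl , ℤ.+-monoʳ-≤ m (ℤ.+≤+ p))

    ⊹-strict : ∀ x {i j} → i ℕ.< j → lt L (x ⊹ i) (x ⊹ j)
    ⊹-strict (a , m) p = lex-<ʳ A ℤ-LO (λ q → ℤ.<⇒≱ (ℤ.+-monoʳ-< m (ℤ.+<+ p)) q)

    ⊹-cancel-≤ : ∀ {x y} i → _≤_ L (x ⊹ i) (y ⊹ i) → _≤_ L x y
    ⊹-cancel-≤ i (inj₁ l) = inj₁ l
    ⊹-cancel-≤ i (inj₂ (refl , q)) = inj₂ (refl , ℤ.≮⇒≥ (λ k → ℤ.<⇒≱ (ℤ.+-monoˡ-< (+ i) k) q))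

    ⊹-cancel-< : ∀ x {i j} → lt L (x ⊹ i) (x ⊹ j) → i ℕ.< j
    ⊹-cancel-< x k = ℕ.≰⇒> (λ p → k (⊹-mono x p))

    -- Positions counted from the right end of an interval need this, hence ℤ and not ℕ.
    ⊹-back : ∀ y i → Σ[ z ∈ Carrier L ] (z ⊹ i ≡ y)
    ⊹-back (a , m) i = (a , m ℤ.+ ℤ.- (+ i)) , cong (a ,_)
      (trans (ℤ.+-assoc m _ _) (trans (cong (ℤ._+_ m) (ℤ.+-inverseˡ (+ i))) (ℤ.+-identityʳ m)))

    distance : ∀ {m n} → m ℤ.≤ n → m ℤ.+ + ℤ.∣ n ℤ.- m ∣ ≡ n
    distance {m} {n} p = trans (cong (ℤ._+_ m) (ℤ.0≤i⇒+∣i∣≡i (ℤ.i≤j⇒0≤j-i p)))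
      (trans (ℤ.+-comm m (n ℤ.- m)) (trans (ℤ.+-assoc n (ℤ.- m) m)
        (trans (cong (ℤ._+_ n) (ℤ.+-inverseˡ m)) (ℤ.+-identityʳ n))))

    near-or-far : ∀ x z k → lt L x z → (Σ[ i ∈ ℕ ] (i ℕ.< k × z ≡ x ⊹ i)) ⊎ _≤_ L (x ⊹ k) z
    near-or-far (a , m) (b , n) k p with lex-<-elim A ℤ-LO p
    ... | inj₁ l = inj₂ (inj₁ l)
    ... | inj₂ (refl , l) with ℕ.<-≤-connex ℤ.∣ n ℤ.- m ∣ k
    ... | inj₁ q = inj₁ (ℤ.∣ n ℤ.- m ∣ , q , cong (a ,_) (sym (distance (ℤ.<⇒≤ (ℤ.≰⇒> l)))))
    ... | inj₂ q = inj₂ (inj₂ (refl , subst (m ℤ.+ + k ℤ.≤_) (distance (ℤ.<⇒≤ (ℤ.≰⇒> l))) (ℤ.+-monoʳ-≤ m (ℤ.+≤+ q))))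

    interval-points : ∀ x n {z} → lt L x z → lt L z (x ⊹ n) → Σ[ i ∈ ℕ ] (i ℕ.< n × z ≡ x ⊹ i)
    interval-points x n {z} p q with near-or-far x z n p
    ... | inj₁ r = r
    ... | inj₂ r = ⊥-elim (q r)

    positive : ∀ x {i} → lt L x (x ⊹ i) → 0 ℕ.< i
    positive x {i} p = ⊹-cancel-< x (subst (λ y → lt L y (x ⊹ i)) (sym (⊹-0 x)) p)

    after : ∀ x {i} → 0 ℕ.< i → lt L x (x ⊹ i)
    after x {i} p = subst (λ y → lt L y (x ⊹ i)) (⊹-0 x) (⊹-strict x p)

    interval : Carrier L → Carrier L → Seg
    interval x y = between L (just x) (just y)

    answer : ∀ d {x y x' y' z z'} → mem (interval x y) z → mem (interval x' y') z' →
             Eq d (interval x z) (interval x' z') → Eq d (interval z y) (interval z' y') →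
             Σ[ w ∈ Carrier L ] (mem (interval x' y') w × Eq d (below (interval x y) z) (below (interval x' y') w)
                                                       × Eq d (above (interval x y) z) (above (interval x' y') w))
    answer d {z' = z'} m m' lo hi = z' , m' ,
      ≅-Eq-≅ d (between-below L _ _ m) (between-below L _ _ m') lo ,
      ≅-Eq-≅ d (between-above L _ _ m) (between-above L _ _ m') hi

    same-length : ∀ d n {x y x' y'} → y ≡ x ⊹ n → y' ≡ x' ⊹ n → Eq d (interval x y) (interval x' y')
    same-length zero n _ _ = tt
    same-length (suc d) n {x} {_} {x'} refl refl = half , half
      where
      half : ∀ {x x'} → Forth (Eq d) (interval x (x ⊹ n)) (interval x' (x' ⊹ n))
      half {x} {x'} z (p , q) with interval-points x n p q
      ... | i , i<n , refl = answer d (p , q) (after x' (positive x p) , ⊹-strict x' i<n)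
              (same-length d i refl refl) (same-length d (n ℕ.∸ i) (rest x) (rest x'))
        where
        rest : ∀ x → x ⊹ n ≡ x ⊹ i ⊹ (n ℕ.∸ i)
        rest x = sym (trans (⊹-+ x i _) (cong (x ⊹_) (ℕ.m+[n∸m]≡n (ℕ.<⇒≤ i<n))))

    -- The bound doubles per round. With `n = 2 ^ d`, a point nearer than `n` to one end is answered
    -- at the same distance from that end, which leaves at least `n` on the other side; a point far
    -- from both ends is answered by `x' ⊹ n`.
    long : ∀ d {x y x' y'} → _≤_ L (x ⊹ (2 ^ d)) y → _≤_ L (x' ⊹ (2 ^ d)) y' → Eq d (interval x y) (interval x' y')
    long zero _ _ = tt
    long (suc d) {x₀} {_} {x₁} a a' = half (conv x₀ a) (conv x₁ a') , half (conv x₁ a') (conv x₀ a)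
      where
      n = 2 ^ d
      n>0 : 0 ℕ.< n
      n>0 = ℕ.m^n>0 2 d
      conv : ∀ x {y} → _≤_ L (x ⊹ (2 ^ suc d)) y → _≤_ L (x ⊹ (n ℕ.+ n)) y
      conv x {y} = subst (λ k → _≤_ L (x ⊹ (n ℕ.+ k)) y) (ℕ.+-identityʳ n)
      shorter : ∀ x {y} i → i ℕ.≤ n → _≤_ L (x ⊹ (n ℕ.+ n)) y → _≤_ L (x ⊹ i ⊹ n) y
      shorter x {y} i p q = L.≤-trans (subst (λ w → _≤_ L w (x ⊹ (n ℕ.+ n))) (sym (⊹-+ x i n)) (⊹-mono x (ℕ.+-monoˡ-≤ n p))) q
      half : ∀ {x y x' y'} → _≤_ L (x ⊹ (n ℕ.+ n)) y → _≤_ L (x' ⊹ (n ℕ.+ n)) y' → Forth (Eq d) (interval x y) (interval x' y')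
      half {x} {y} {x'} {y'} a a' z (p , q) with near-or-far x z n p
      ... | inj₁ (i , i<n , refl) = answer d (p , q)
              (after x' (positive x p) , L.<-≤-trans (⊹-strict x' (ℕ.<-≤-trans i<n (ℕ.m≤m+n n n))) a')
              (same-length d i refl refl) (long d (shorter x i (ℕ.<⇒≤ i<n) a) (shorter x' i (ℕ.<⇒≤ i<n) a'))
      ... | inj₂ far with near-or-far z y n q
      ... | inj₂ far' = answer d (p , q)
              (after x' n>0 , L.<-≤-trans (⊹-strict x' (ℕ.m<m+n n n>0)) a')
              (long d far L.≤-refl) (long d far' (shorter x' n ℕ.≤-refl a'))
      ... | inj₁ (i , i<n , refl) with ⊹-back y' i
      ... | z' , refl = answer d (p , q) (L.<-≤-trans (after x' n>0) x'+n≤z' , after z' (positive z q))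
              (long d far x'+n≤z') (same-length d i refl refl)
        where
        x'+n≤z' : _≤_ L (x' ⊹ n) z'
        x'+n≤z' = ⊹-cancel-≤ i (L.≤-trans (subst (λ w → _≤_ L w (x' ⊹ (n ℕ.+ n))) (sym (⊹-+ x' n i))
                    (⊹-mono x' (ℕ.+-monoʳ-≤ n (ℕ.<⇒≤ i<n)))) a')

  -- A `suc d`-type is the set of pairs of `d`-types obtained by cutting at a point, stored as bits;
  -- hence the power of two. Finiteness feeds the pigeonhole in `pump`.
  types : ℕ → ℕ
  types zero = 1
  types (suc d) = 2 ^ (types d ℕ.* types d)

  mutual
    Realises : ∀ d → Seg → Fin (types d ℕ.* types d) → Set
    Realises d S k = Σ[ x ∈ Pt S ] (mem S x × combine (type d (below S x)) (type d (above S x)) ≡ k)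

    type : ∀ d → Seg → Fin (types d)
    type zero S = zero
    type (suc d) S = funToFin (λ k → if does (em {Realises d S k}) then suc zero else zero)

  type-Eq : ∀ d {S T} → type d S ≡ type d T → Eq d S T
  type-Eq zero _ = tt
  type-Eq (suc d) e = half e , half (sym e)
    where
    sign : Seg → Fin (types d ℕ.* types d) → Fin 2
    sign S k = if does (em {Realises d S k}) then suc zero else zero
    transfer : ∀ S T k → sign S k ≡ sign T k → Realises d S k → Realises d T k
    transfer S T k e r with em {Realises d S k} | em {Realises d T k}
    ... | _ | yes r' = r'
    transfer S T k () r | yes _ | no _
    ... | no n | no _ = ⊥-elim (n r)
    half : ∀ {S T} → type (suc d) S ≡ type (suc d) T → Forth (Eq d) S T
    half {S} {T} e x m =
      let k = combine (type d (below S x)) (type d (above S x))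
          sign≡ = trans (sym (finToFun-funToFin (sign S) k)) (trans (cong (λ c → finToFun c k) e) (finToFun-funToFin (sign T) k))
          (y , m' , e') = transfer S T k sign≡ (x , m , refl)
          (lo , hi) = combine-injective (type d (below T y)) (type d (above T y)) _ _ e'
      in y , m' , type-Eq d (sym lo) , type-Eq d (sym hi)

  points : ∀ n S → AtLeast n S → Σ[ p ∈ (Fin n → Pt S) ]
    ((∀ i → mem S (p i)) × (∀ i j → toℕ i ℕ.< toℕ j → lt (host S) (p i) (p j)))
  points zero S _ = (λ ()) , (λ ()) , λ ()
  points (suc n) S (x , m , a) with points n (above S x) a
  ... | p , m' , inc = p⁺ , mem⁺ , inc⁺
    where
    p⁺ : Fin (suc n) → Pt S
    p⁺ zero = x
    p⁺ (suc i) = p i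
    mem⁺ : ∀ i → mem S (p⁺ i)
    mem⁺ zero = m
    mem⁺ (suc i) = proj₁ (m' i)
    inc⁺ : ∀ i j → toℕ i ℕ.< toℕ j → lt (host S) (p⁺ i) (p⁺ j)
    inc⁺ zero (suc j) _ = proj₂ (m' j)
    inc⁺ (suc i) (suc j) (s≤s l) = inc i j l

  One : LO
  One = Fin-LO 1

  -- With p₀ < p₁ chosen so that A = S ∩ (−∞, p₀) and A + B = S ∩ (−∞, p₁) have the same type,
  -- A is equivalent to A + B·n for all n, hence to A + B·I for any order I equivalent to large
  -- finite orders; I can be taken to contain J.
  module Pump (d : ℕ) (S : Seg) (J : LO) (p₀ p₁ : Pt S) (p₀∈ : mem S p₀) (p₀<p₁ : lt (host S) p₀ p₁)
              (A≡A+B : Eq d (below S p₀) (below S p₁)) where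
    -- The two added points supply the ends `z₀` and `z₁`, with `J` strictly between them.
    open Shift (Sum One (Sum J One))
    private
      X = host S
      module X = StrictOrder em X
      module L = StrictOrder em L
      M = Lex L X

      A B C : Seg
      A = below S p₀
      B = seg X (λ x → mem S x × _≤_ X p₀ x × lt X x p₁)
      C = seg X (λ x → mem S x × _≤_ X p₀ x)

      z₀ z₁ : Carrier L
      z₀ = inj₁ zero , + 0
      z₁ = inj₂ (inj₂ zero) , + 0

      -- `A` followed by copies of `B`, realised in the single host `M`: `A` over `z₀`, a copy of
      -- `B` over each point strictly between `z₀` and `z`.
      G : Carrier L → Seg
      G z = seg M (λ q → mem (fibre L z₀ A) q ⊎ mem (box (interval z₀ z) B) q)

      K : Seg
      K = seg M (λ q → mem (G z₁) q ⊎ mem (fibre L z₁ C) q)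

      ≤-or-> : ∀ x y → _≤_ X x y ⊎ lt X y x
      ≤-or-> x y with em {_≤_ X x y}
      ... | yes p = inj₁ p
      ... | no k = inj₂ k

      split-S : Split S (mem A) (mem C)
      split-S = record
        { cover = λ {x} m → cov m (≤-or-> p₀ x)
        ; inˡ = proj₁
        ; inʳ = proj₁
        ; sep = λ (_ , l) (_ , q) → X.<-≤-trans l q }
        where
        cov : ∀ {x} → mem S x → _≤_ X p₀ x ⊎ lt X x p₀ → mem A x ⊎ mem C x
        cov m (inj₁ q) = inj₂ (m , q)
        cov m (inj₂ l) = inj₁ (m , l)

      split-A : Split (below S p₁) (mem A) (mem B)
      split-A = record
        { cover = λ {x} m → cov m (≤-or-> p₀ x)
        ; inˡ = λ (m , l) → m , X.<-trans l p₀<p₁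
        ; inʳ = λ (m , _ , l) → m , l
        ; sep = λ (_ , l) (_ , q , _) → X.<-≤-trans l q }
        where
        cov : ∀ {x} → mem (below S p₁) x → _≤_ X p₀ x ⊎ lt X x p₀ → mem A x ⊎ mem B x
        cov (m , l) (inj₁ q) = inj₂ (m , q , l)
        cov (m , _) (inj₂ l) = inj₁ (m , l)

      split-G : ∀ z → Split (G z) (mem (fibre L z₀ A)) (mem (box (interval z₀ z) B))
      split-G z = record
        { cover = id
        ; inˡ = inj₁
        ; inʳ = inj₂
        ; sep = λ { (refl , _) ((l , _) , _) → lex-<ˡ L X l } }

      split-K : lt L z₀ z₁ → Split K (mem (G z₁)) (mem (fibre L z₁ C))
      split-K z₀<z₁ = record
        { cover = id
        ; inˡ = inj₁
        ; inʳ = inj₂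
        ; sep = λ { (inj₁ (refl , _)) (refl , _) → lex-<ˡ L X z₀<z₁
                  ; (inj₂ ((_ , l) , _)) (refl , _) → lex-<ˡ L X l } }

      -- Exactly `n` indices lie strictly between `z₀` and `z₀ ⊹ suc n`, so this is `A + B·n`. By
      -- induction all but the last copy of `B` are absorbed, and `A≡A+B` absorbs the last.
      finite : ∀ n → Eq d (G (z₀ ⊹ suc n)) A
      finite zero = Eq-trans d (≅⇒Eq d (same (λ { q (inj₁ m) → m ; q (inj₂ ((l , h) , _)) → ⊥-elim (empty l h) }) (λ q → inj₁)))
                      (≅⇒Eq d fibre-≅)
        where
        empty : ∀ {l} → lt L z₀ l → ¬ lt L l (z₀ ⊹ 1)
        empty l h with interval-points z₀ 1 l h
        ... | zero , _ , e = L.<⇒≢ l (sym (trans e (⊹-0 z₀)))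
        ... | suc i , s≤s () , _
      finite (suc n) = Eq-trans d (glue d split split-A (finite n) (≅⇒Eq d fibre-≅)) (Eq-sym d A≡A+B)
        where
        e = z₀ ⊹ suc n
        split : Split (G (z₀ ⊹ suc (suc n))) (mem (G e)) (mem (fibre L e B))
        split = record
          { cover = λ { (inj₁ m) → inj₁ (inj₁ m) ; (inj₂ ((l , h) , b)) → cov l h b }
          ; inˡ = λ { (inj₁ m) → inj₁ m ; (inj₂ ((l , h) , b)) → inj₂ ((l , L.<-trans h (⊹-strict z₀ (ℕ.n<1+n (suc n)))) , b) }
          ; inʳ = λ { (refl , b) → inj₂ ((after z₀ (s≤s z≤n) , ⊹-strict z₀ (ℕ.n<1+n (suc n))) , b) }
          ; sep = λ { (inj₁ (refl , _)) (refl , _) → lex-<ˡ L X (after z₀ (s≤s z≤n))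
                    ; (inj₂ ((_ , h) , _)) (refl , _) → lex-<ˡ L X h } }
          where
          cov : ∀ {l x} → lt L z₀ l → lt L l (z₀ ⊹ suc (suc n)) → mem B x → mem (G e) (l , x) ⊎ mem (fibre L e B) (l , x)
          cov p h b with interval-points z₀ (suc (suc n)) p h
          ... | i , i< , refl with ℕ.m≤n⇒m<n∨m≡n (ℕ.s≤s⁻¹ i<)
          ... | inj₁ i<n = inj₁ (inj₂ ((p , ⊹-strict z₀ i<n) , b))
          ... | inj₂ refl = inj₂ (refl , b)

      z₀<z₁ : lt L z₀ z₁
      z₀<z₁ = lex-<ˡ (Sum One (Sum J One)) ℤ-LO (λ ())

      A≡G : Eq d A (G z₁)
      -- For `d` rounds `2 ^ d` copies of `B` suffice: the finite index interval and the one up to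
      -- `z₁` are both long.
      A≡G = Eq-trans d (Eq-sym d (finite (2 ^ d)))
        (glue d (split-G (z₀ ⊹ suc (2 ^ d))) (split-G z₁) (Eq-refl d)
          (Eq-box d (long d (⊹-mono z₀ (ℕ.n≤1+n (2 ^ d))) (inj₁ (λ ())))))

    pumped : Seg
    pumped = K

    pumped-Eq : Eq d S K
    pumped-Eq = glue d split-S (split-K z₀<z₁) A≡G (Eq-sym d (≅⇒Eq d fibre-≅))

    pumped-Embeds : Embeds (full J) K
    pumped-Embeds = record
      -- `p₀` is the first point of `B`, so it marks one point in every copy.
      { fn = λ j _ → (inj₂ (inj₁ j) , + 0) , p₀
      ; fn∈ = λ j _ → inj₁ (inj₂ ((lex-<ˡ (Sum One (Sum J One)) ℤ-LO (λ ()) , lex-<ˡ (Sum One (Sum J One)) ℤ-LO (λ ())) , p₀∈ , X.≤-refl , p₀<p₁))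
      ; fn-≤ = λ {x} {y} _ _ p → le x y p
      ; fn-< = λ {x} {y} _ _ l → lex-<ˡ L X {x = p₀} {p₀} (lex-<ˡ (Sum One (Sum J One)) ℤ-LO {inj₂ (inj₁ x)} {inj₂ (inj₁ y)} l) }
      where
      le : ∀ x y → _≤_ J x y → _≤_ M ((inj₂ (inj₁ x) , + 0) , p₀) ((inj₂ (inj₁ y) , + 0) , p₀)
      le x y p with StrictOrder.≤⇒<⊎≡ em J p
      ... | inj₁ l = inj₁ (lex-<ˡ (Sum One (Sum J One)) ℤ-LO {inj₂ (inj₁ x)} {inj₂ (inj₁ y)} l)
      ... | inj₂ refl = inj₂ (refl , X.≤-refl)

  -- Among `suc (types d)` increasing points, two cut off initial parts of the same `d`-type.
  pump : ∀ d S → AtLeast (suc (types d)) S → ∀ J → Σ[ T ∈ Seg ] (Eq d S T × Embeds (full J) T)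
  pump d S a J =
    let (p , m , inc) = points (suc (types d)) S a
        (i , j , i<j , e) = pigeonhole (ℕ.n<1+n (types d)) (λ i → type d (below S (p i)))
        module P = Pump d S J (p i) (p j) (m i) (inc i j i<j) (type-Eq d e)
    in P.pumped , P.pumped-Eq , P.pumped-Embeds

-- Truth in extensions and sizes of gaps

-- With `holds` irrelevant, points with the same `elem` are equal, as antisymmetry for `_≡_`
-- requires. Excluded middle recovers the proof when it is needed.
record SubPt (S : Seg) : Set where
  constructor sub
  field
    elem   : Pt S
    .holds : mem S elem
open SubPt

Sub : Seg → LO
Sub S = record
  { Carrier = SubPt S
  ; _≤_ = λ x y → _≤_ (host S) (elem x) (elem y)
  ; isTotalOrder = record
    { isPartialOrder = record
      { isPreorder = record
        { isEquivalence = isEquivalence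
        ; reflexive = λ { refl → ≤-refl }
        ; trans = ≤-trans }
      ; antisym = λ p q → ext (≤-antisym p q) }
    ; total = λ x y → ≤-total (elem x) (elem y) } }
  where
  open Order (host S)
  ext : ∀ {x y : SubPt S} → elem x ≡ elem y → x ≡ y
  ext {sub _ _} {sub _ _} refl = refl

Embeds-Sub : ∀ {T S} → Embeds T S → Embeds T (full (Sub S))
Embeds-Sub e = record
  { fn = λ x m → sub (fn e x m) (fn∈ e x m)
  ; fn∈ = λ _ _ → tt
  ; fn-≤ = fn-≤ e
  ; fn-< = fn-< e }

fn-irrelevant : ∀ {S T} (e : Embeds S T) {x} m m' → fn e x m ≡ fn e x m'
fn-irrelevant {S} {T} e m m' = Order.≤-antisym (host T)
  (fn-≤ e m m' (Order.≤-refl (host S))) (fn-≤ e m' m (Order.≤-refl (host S)))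

-- T has at most as many points as S, up to N.
AtMost : ℕ → Seg → Seg → Set
AtMost N S T = ∀ k → k ℕ.≤ N → AtLeast k T → AtLeast k S

-- A finite partial isomorphism listed in increasing order, with `R` between corresponding gaps. `R`
-- varies because the game needs `Eq` while a modal step needs only `AtMost`.
Chain : (Seg → Seg → Set) → (U V : LO) → Maybe (Carrier U) → Maybe (Carrier V) → List (Carrier U × Carrier V) → Set
Chain R U V a b [] = R (between U a nothing) (between V b nothing)
Chain R U V a b ((x , y) ∷ zs) =
  LoBound U a x × LoBound V b y × R (between U a (just x)) (between V b (just y)) × Chain R U V (just x) (just y) zs

module _ {U V : LO} where

  Chain-map : ∀ {R R'} → (∀ {S T} → R S T → R' S T) → ∀ zs {a b} → Chain R U V a b zs → Chain R' U V a b zs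
  Chain-map h [] c = h c
  Chain-map h (_ ∷ zs) (p , q , r , c) = p , q , h r , Chain-map h zs c

  Chain-sym : ∀ {R R'} → (∀ {S T} → R S T → R' T S) → ∀ zs {a b} → Chain R U V a b zs → Chain R' V U b a (mapᴸ swap zs)
  Chain-sym h [] c = h c
  Chain-sym h (_ ∷ zs) (p , q , r , c) = q , p , h r , Chain-sym h zs c

LoBound-< : ∀ {U} a {x y} → LoBound U a x → lt U x y → LoBound U a y
LoBound-< nothing _ _ = tt
LoBound-< {U} (just a) p l = Order.<-trans U p l

Chain-LoBound : ∀ {R U V} zs {a b x y} → Chain R U V a b zs → (x , y) ∈ zs → LoBound U a x × LoBound V b y
Chain-LoBound (_ ∷ zs) (p , q , _ , _) (here refl) = p , q
Chain-LoBound (_ ∷ zs) {a} {b} (p , q , _ , c) (there m) =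
  let (l , l') = Chain-LoBound zs c m in LoBound-< a p l , LoBound-< b q l'

Chain-≤ : ∀ {R U V} zs {a b x y x' y'} → Chain R U V a b zs → (x , y) ∈ zs → (x' , y') ∈ zs → _≤_ U x x' → _≤_ V y y'
Chain-≤ {V = V} (_ ∷ zs) c (here refl) (here refl) p = Order.≤-refl V
Chain-≤ {V = V} (_ ∷ zs) (_ , _ , _ , c) (here refl) (there m) p = Order.<⇒≤ V (proj₂ (Chain-LoBound zs c m))
Chain-≤ (_ ∷ zs) (_ , _ , _ , c) (there m) (here refl) p = ⊥-elim (proj₁ (Chain-LoBound zs c m) p)
Chain-≤ (_ ∷ zs) (_ , _ , _ , c) (there m) (there m') p = Chain-≤ zs c m m' p

module Elimination (em : ExcludedMiddle 0ℓ) where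
  open EF em
  open _≅_

  Sub-≅ : ∀ {S} → full (Sub S) ≅ S
  Sub-≅ {S} = record
    { map = elem
    ; map∈ = λ { {sub x h} _ → recompute em h }
    ; onto = λ {y} m → sub y m , tt , refl
    ; strict = λ _ _ l → l }

  Embeds⇒Emb : ∀ {V V'} → Embeds (full V) (full V') → Emb V V'
  Embeds⇒Emb e = record
    { fun = λ x → fn e x tt
    ; mono = fn-≤ e tt tt
    ; reflect = λ p → by-contradiction em (λ k → fn-< e tt tt k p) }

  AtLeast-below : ∀ n T {y} → mem T y → AtLeast n (below T y) → AtLeast (suc n) T
  AtLeast-below zero T {y} m _ = y , m , tt
  AtLeast-below (suc n) T m (x , (mx , l) , a) = x , mx , AtLeast-below n (above T x) (m , l)
    (AtLeast-Embeds n (subseg (λ z ((mz , z<y) , x<z) → (mz , x<z) , z<y)) a)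

  least : ∀ n T → ¬ AtLeast n T → ∀ {y} → mem T y → Σ[ z ∈ Pt T ] (mem T z × (∀ {w} → mem T w → _≤_ (host T) z w))
  least zero T k m = ⊥-elim (k tt)
  least (suc n) T k {y} m with em {Σ[ w ∈ Pt T ] (mem T w × lt (host T) w y)}
  ... | no none = y , m , λ {w} mw → by-contradiction em (λ l → none (w , mw , l))
  ... | yes (w , mw , l) with least n (below T y) (k ∘ AtLeast-below n T m) (mw , l)
  ... | z , (mz , z<y) , min = z , mz , bound
    where
    bound : ∀ {v} → mem T v → _≤_ (host T) z v
    bound {v} mv with em {lt (host T) v y}
    ... | yes v<y = min (mv , v<y)
    ... | no v≮y = Order.≤-trans (host T) (Order.<⇒≤ (host T) z<y) (by-contradiction em v≮y)

  -- A finite nonempty `T` has a least point; it goes to the first of the `s` points of `S`, and the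
  -- rest follows above.
  fit : ∀ s T S → ¬ AtLeast (suc s) T → AtLeast s S → Embeds T S
  fit s T S k a with em {Σ[ y ∈ Pt T ] mem T y}
  ... | no none = record
    { fn = λ x m → ⊥-elim (none (x , m)) ; fn∈ = λ x m → ⊥-elim (none (x , m))
    ; fn-≤ = λ m → ⊥-elim (none (_ , m)) ; fn-< = λ m → ⊥-elim (none (_ , m)) }
  fit zero T S k a | yes (y , m) = ⊥-elim (k (y , m , tt))
  fit (suc s) T S k (x , mx , a) | yes (y , m) = record
    { fn = λ w m → place w m em
    ; fn∈ = λ w m → place∈ w m em
    ; fn-≤ = λ m m' p → place-≤ m m' em em p
    ; fn-< = λ m m' l → place-< m m' em em l }
    where
    module S = Order (host S)
    module T = Order (host T)
    zmin = least (suc (suc s)) T k m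
    z = proj₁ zmin
    z∈ : mem T z
    z∈ = proj₁ (proj₂ zmin)
    min : ∀ {w} → mem T w → _≤_ (host T) z w
    min = proj₂ (proj₂ zmin)
    e : Embeds (above T z) (above S x)
    e = fit s (above T z) (above S x) (λ b → k (z , z∈ , b)) a
    place : ∀ w → mem T w → Dec (lt (host T) z w) → Pt S
    place w m (yes l) = fn e w (m , l)
    place w m (no _) = x
    place∈ : ∀ w m d → mem S (place w m d)
    place∈ w m (yes l) = proj₁ (fn∈ e w (m , l))
    place∈ w m (no _) = mx
    z≥ : ∀ {w} → ¬ lt (host T) z w → _≤_ (host T) w z
    z≥ = by-contradiction em
    place-≤ : ∀ {w w'} m m' d d' → _≤_ (host T) w w' → _≤_ (host S) (place w m d) (place w' m' d')
    place-≤ m m' (yes l) (yes l') p = fn-≤ e (m , l) (m' , l') p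
    place-≤ m m' (yes l) (no k') p = ⊥-elim (l (T.≤-trans p (z≥ k')))
    place-≤ m m' (no _) (yes l') p = S.<⇒≤ (proj₂ (fn∈ e _ (m' , l')))
    place-≤ m m' (no _) (no _) p = S.≤-refl
    place-< : ∀ {w w'} m m' d d' → lt (host T) w w' → lt (host S) (place w m d) (place w' m' d')
    place-< m m' (yes l) (yes l') p = fn-< e (m , l) (m' , l') p
    place-< m m' _ (no k') p = ⊥-elim (p (T.≤-trans (z≥ k') (min m)))
    place-< m m' (no _) (yes l') p = proj₂ (fn∈ e _ (m' , l'))

  exactSize : ∀ N S → ¬ AtLeast N S → Σ[ s ∈ ℕ ] (s ℕ.< N × AtLeast s S × ¬ AtLeast (suc s) S)
  exactSize zero S k = ⊥-elim (k tt)
  exactSize (suc N) S k with em {AtLeast N S}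
  ... | yes a = N , ℕ.n<1+n N , a , k
  ... | no k' = let (s , p , q) = exactSize N S k' in s , ℕ.m≤n⇒m≤1+n p , q

  threshold : ℕ → ℕ
  threshold d = suc (types d)

  -- Answers an extension inside one gap: `S` has grown to `S'`, and `T` is the corresponding gap. A
  -- large `S'` is pumped to contain the host of `T`. A small `S'` forces `S`, and with it `T`, to
  -- be small, and then `T` already fits into `S'`.
  widen : ∀ d S S' T → Embeds S S' → AtMost (threshold d) S T →
          Σ[ V ∈ LO ] (Eq d S' (full V) × Embeds T (full V))
  widen d S S' T e small with em {AtLeast (threshold d) S'}
  ... | yes a = let (K , eq , h) = pump d S' a (host T) in
        Sub K , Eq-trans d eq (Eq-sym d (≅⇒Eq d Sub-≅)) , Embeds-Sub (Embeds-trans (subseg (λ _ _ → tt)) h)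
  ... | no k = let (s , s<N , a , k') = exactSize (threshold d) S (k ∘ AtLeast-Embeds (threshold d) e) in
        Sub S' , Eq-sym d (≅⇒Eq d Sub-≅) , Embeds-Sub (Embeds-trans (fit s T S (k' ∘ small (suc s) s<N) a) e)

  module _ {U V : LO} where

    move : ∀ d zs {a b x} → Chain (Eq (suc d)) U V a b zs → LoBound U a x →
           Σ[ y ∈ Carrier V ] Σ[ zs' ∈ List (Carrier U × Carrier V) ]
             (Chain (Eq d) U V a b zs' × (x , y) ∈ zs' × (∀ {p} → p ∈ zs → p ∈ zs'))
    move d [] {a} {b} {x} (f , _) l = let (y , m , lo , hi) = f x (l , tt) in
      y , (x , y) ∷ [] ,
      (l , proj₁ m , Eq-trans d (Eq-sym d (≅⇒Eq d (between-below U a nothing (l , tt)))) (Eq-trans d lo (≅⇒Eq d (between-below V b nothing m)))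
        , Eq-trans d (Eq-sym d (≅⇒Eq d (between-above U a nothing (l , tt)))) (Eq-trans d hi (≅⇒Eq d (between-above V b nothing m)))) ,
      here refl , λ ()
    move d ((x₀ , y₀) ∷ zs) {a} {b} {x} (la , lb , e , c) l with StrictOrder.compare em U x x₀
    ... | StrictOrder.less x<x₀ = let (y , m , lo , hi) = proj₁ e x (l , x<x₀) in
          y , (x , y) ∷ (x₀ , y₀) ∷ zs ,
          (l , proj₁ m , Eq-trans d (Eq-sym d (≅⇒Eq d (between-below U a (just x₀) (l , x<x₀)))) (Eq-trans d lo (≅⇒Eq d (between-below V b (just y₀) m)))
            , x<x₀ , proj₂ m , Eq-trans d (Eq-sym d (≅⇒Eq d (between-above U a (just x₀) (l , x<x₀)))) (Eq-trans d hi (≅⇒Eq d (between-above V b (just y₀) m)))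
            , Chain-map (λ {S} {T} → Eq-pred d {S} {T}) zs c) ,
          here refl , there
    ... | StrictOrder.equal refl = y₀ , (x₀ , y₀) ∷ zs , Chain-map (λ {S} {T} → Eq-pred d {S} {T}) ((x₀ , y₀) ∷ zs) (la , lb , e , c) , here refl , id
    ... | StrictOrder.greater x₀<x = let (y , zs' , c' , m , incl) = move d zs c x₀<x in
          y , (x₀ , y₀) ∷ zs' , (la , lb , Eq-pred d e , c') , there m ,
          λ { (here refl) → here refl ; (there p) → there (incl p) }

  emb-LoBound : ∀ {U U'} (f : Emb U U') a {x} → LoBound U a x → LoBound U' (Maybe.map (fun f) a) (fun f x)
  emb-LoBound f nothing l = tt
  emb-LoBound f (just a) l = emb-< f l

  emb-HiBound : ∀ {U U'} (f : Emb U U') b {x} → HiBound U b x → HiBound U' (Maybe.map (fun f) b) (fun f x)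
  emb-HiBound f nothing l = tt
  emb-HiBound f (just a) l = emb-< f l

  emb-between : ∀ {U U'} (f : Emb U U') a b →
                Embeds (between U a b) (between U' (Maybe.map (fun f) a) (Maybe.map (fun f) b))
  emb-between f a b = record
    { fn = λ x _ → fun f x
    ; fn∈ = λ x (p , q) → emb-LoBound f a p , emb-HiBound f b q
    ; fn-≤ = λ _ _ → mono f
    ; fn-< = λ _ _ → emb-< f }

  full≅between : ∀ {V} → full V ≅ between V nothing nothing
  full≅between = same (λ _ _ → tt , tt) (λ _ _ → tt)

  module Append (T₁ V₂ : LO) where
    V' : LO
    V' = Sum T₁ (Sum One V₂)

    pt : Carrier V'
    pt = inj₂ (inj₁ zero)

    upper : Carrier V₂ → Carrier V'
    upper v = inj₂ (inj₂ v)

    -- Inside the sum `V₂` lies above `pt`, so its missing lower bound turns into `pt`.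
    raise : Maybe (Carrier V₂) → Maybe (Carrier V')
    raise nothing = just pt
    raise (just v) = just (upper v)

    lower≅ : full T₁ ≅ between V' nothing (just pt)
    lower≅ = record
      { map = inj₁
      ; map∈ = λ _ → tt , λ ()
      ; onto = λ { {inj₁ x} _ → x , tt , refl
                 ; {inj₂ (inj₁ zero)} (_ , k) → ⊥-elim (k z≤n)
                 ; {inj₂ (inj₂ v)} (_ , k) → ⊥-elim (k tt) }
      ; strict = λ _ _ l → l }

    raise-lo : ∀ b {y} → LoBound V₂ b y → LoBound V' (raise b) (upper y)
    raise-lo nothing _ = λ ()
    raise-lo (just b) l = l

    raise-hi : ∀ c {y} → HiBound V₂ c y → HiBound V' (Maybe.map upper c) (upper y)
    raise-hi nothing _ = tt
    raise-hi (just c) l = l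

    lower-hi : ∀ c {y} → HiBound V' (Maybe.map upper c) (upper y) → HiBound V₂ c y
    lower-hi nothing _ = tt
    lower-hi (just c) l = l

    raise-≅ : ∀ b c → between V₂ b c ≅ between V' (raise b) (Maybe.map upper c)
    raise-≅ b c = record
      { map = upper
      ; map∈ = λ (l , h) → raise-lo b l , raise-hi c h
      ; onto = λ { (l , h) → back b l h }
      ; strict = λ _ _ l → l }
      where
      back : ∀ b {y} → LoBound V' (raise b) y → HiBound V' (Maybe.map upper c) y →
             Σ[ v ∈ Carrier V₂ ] (mem (between V₂ b c) v × upper v ≡ y)
      back nothing {inj₁ _} l _ = ⊥-elim (l tt)
      back nothing {inj₂ (inj₁ zero)} l _ = ⊥-elim (l z≤n)
      back nothing {inj₂ (inj₂ v)} l h = v , (tt , lower-hi c h) , refl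
      back (just b) {inj₁ _} l _ = ⊥-elim (l tt)
      back (just b) {inj₂ (inj₁ _)} l _ = ⊥-elim (l tt)
      back (just b) {inj₂ (inj₂ v)} l h = v , (l , lower-hi c h) , refl

    Chain-raise : ∀ d {U} zs {a : Maybe (Carrier U)} {b} → Chain (Eq d) U V₂ a b zs →
                  Chain (Eq d) U V' a (raise b) (mapᴸ (λ (x , y) → x , upper y) zs)
    Chain-raise d [] {a} {b} e = Eq-trans d e (≅⇒Eq d (raise-≅ b nothing))
    Chain-raise d ((x , y) ∷ zs) {a} {b} (p , q , e , c) =
      p , raise-lo b q , Eq-trans d e (≅⇒Eq d (raise-≅ b (just y))) , Chain-raise d zs c

    module _ {V : LO} (b : Maybe (Carrier V)) (y₀ : Carrier V)
             (e₁ : Embeds (between V b (just y₀)) (full T₁)) (e₂ : Embeds (between V (just y₀) nothing) (full V₂)) where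
      private
        module V = StrictOrder em V
        module V' = Order V'

      place : ∀ y → LoBound V b y → V.Tri y y₀ → Carrier V'
      place y l (V.less k) = inj₁ (fn e₁ y (l , k))
      place y l (V.equal _) = pt
      place y l (V.greater k) = upper (fn e₂ y (k , tt))

      place-< : ∀ {y y'} l l' t t' → lt V y y' → lt V' (place y l t) (place y' l' t')
      place-< l l' (V.less k) (V.less k') p = fn-< e₁ _ _ p
      place-< l l' (V.less k) (V.equal _) p = λ ()
      place-< l l' (V.less k) (V.greater _) p = λ ()
      place-< l l' (V.equal refl) (V.less k') p = ⊥-elim (p (V.<⇒≤ k'))
      place-< l l' (V.equal refl) (V.equal refl) p = ⊥-elim (p V.≤-refl)
      place-< l l' (V.equal refl) (V.greater _) p = λ ()
      place-< l l' (V.greater k) (V.less k') p = ⊥-elim (p (V.<⇒≤ (V.<-trans k' k)))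
      place-< l l' (V.greater k) (V.equal refl) p = ⊥-elim (p (V.<⇒≤ k))
      place-< l l' (V.greater k) (V.greater k') p = fn-< e₂ _ _ p

      place-equal : ∀ l t → place y₀ l t ≡ pt
      place-equal l (V.less k) = ⊥-elim (k V.≤-refl)
      place-equal l (V.equal _) = refl
      place-equal l (V.greater k) = ⊥-elim (k V.≤-refl)

      place-greater : ∀ {y} l (m : mem (between V (just y₀) nothing) y) t → place y l t ≡ upper (fn e₂ y m)
      place-greater l (k , _) (V.less k') = ⊥-elim (k (V.<⇒≤ k'))
      place-greater l (k , _) (V.equal refl) = ⊥-elim (k V.≤-refl)
      place-greater l m (V.greater k') = cong upper (fn-irrelevant e₂ _ _)

      place-irrelevant : ∀ y l l' t t' → place y l t ≡ place y l' t'
      place-irrelevant y l l' (V.less k) (V.less k') = cong inj₁ (fn-irrelevant e₁ _ _)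
      place-irrelevant y l l' (V.less k) (V.equal refl) = ⊥-elim (k V.≤-refl)
      place-irrelevant y l l' (V.less k) (V.greater k') = ⊥-elim (k (V.<⇒≤ k'))
      place-irrelevant y l l' (V.equal refl) t' = sym (place-equal l' t')
      place-irrelevant y l l' (V.greater k) t' = sym (place-greater l' (k , tt) t')

      place-≤ : ∀ {y y'} l l' t t' → _≤_ V y y' → _≤_ V' (place y l t) (place y' l' t')
      place-≤ {y} {y'} l l' t t' p with V.≤⇒<⊎≡ p
      ... | inj₁ k = V'.<⇒≤ {place y l t} {place y' l' t'} (place-< l l' t t' k)
      ... | inj₂ refl = V'.≤-reflexive (place-irrelevant _ l l' t t')

      joined : Embeds (between V b nothing) (full V')
      joined = record
        { fn = λ y (l , _) → place y l (V.compare y y₀)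
        ; fn∈ = λ _ _ → tt
        ; fn-≤ = λ {y} {y'} (l , _) (l' , _) → place-≤ l l' (V.compare y y₀) (V.compare y' y₀)
        ; fn-< = λ {y} {y'} (l , _) (l' , _) → place-< l l' (V.compare y y₀) (V.compare y' y₀) }

      joined-equal : ∀ l → fn joined y₀ l ≡ pt
      joined-equal (l , _) = place-equal l (V.compare y₀ y₀)

      joined-greater : ∀ {y} l (m : mem (between V (just y₀) nothing) y) → fn joined y l ≡ upper (fn e₂ y m)
      joined-greater (l , _) m = place-greater l m (V.compare _ y₀)

  module _ (d : ℕ) {U U' : LO} (f : Emb U U') {V : LO} where

    Follows : ∀ {V'} (b : Maybe (Carrier V)) → Embeds (between V b nothing) (full V') →
              List (Carrier U × Carrier V) → List (Carrier U' × Carrier V') → Set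
    Follows b h zs zs' = ∀ {x y} → (x , y) ∈ zs →
      Σ[ m ∈ mem (between V b nothing) y ] ((fun f x , fn h y m) ∈ zs')

    -- An extension of `U` widens its gaps independently. Each gap of `V` is answered by `widen`,
    -- and the answers are joined, from the last gap backwards, with one new point between
    -- neighbours.
    follow : ∀ zs {a b} → Chain (AtMost (threshold d)) U V a b zs →
      Σ[ V' ∈ LO ] Σ[ h ∈ Embeds (between V b nothing) (full V') ] Σ[ zs' ∈ List (Carrier U' × Carrier V') ]
        (Chain (Eq d) U' V' (Maybe.map (fun f) a) nothing zs' × Follows b h zs zs')
    follow [] {a} {b} small =
      let (V' , e , h) = widen d _ _ _ (emb-between f a nothing) small in
      V' , h , [] , Eq-trans d e (≅⇒Eq d full≅between) , λ ()
    follow ((x₀ , y₀) ∷ zs) {a} {b} (la , lb , small , c) =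
      let (T₁ , e , e₁) = widen d _ _ _ (emb-between f a (just x₀)) small
          (V₂ , e₂ , zs₂ , c₂ , fol) = follow zs c
          open Append T₁ V₂
          h = joined b y₀ e₁ e₂
      in V' , h , (fun f x₀ , pt) ∷ mapᴸ (λ (x , y) → x , upper y) zs₂ ,
         (emb-LoBound f a la , tt , Eq-trans d e (≅⇒Eq d lower≅) , Chain-raise d zs₂ c₂) ,
         λ { (here refl) → (lb , tt) , here (cong (fun f x₀ ,_) (joined-equal b y₀ e₁ e₂ (lb , tt)))
           ; (there p) → let (m , q) = fol p
                             l = LoBound-< b lb (proj₁ m)
                         in (l , tt) , there (subst (λ v → (fun f _ , v) ∈ _)
                              (sym (joined-greater b y₀ e₁ e₂ (l , tt) m)) (∈-map⁺ (λ (x , y) → x , upper y) q)) }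

  -- Invariance of modal formulas

  termConstants : ∀ {W n} → Term W n → List (Carrier W)
  termConstants (var i) = []
  termConstants (con w) = w ∷ []

  constants : ∀ {W n} → Form W n → List (Carrier W)
  constants (s ≤ᶠ t) = termConstants s ++ termConstants t
  constants (s ≐ t)  = termConstants s ++ termConstants t
  constants ⊥ᶠ       = []
  constants ⊤ᶠ       = []
  constants (¬ᶠ φ)   = constants φ
  constants (φ ∧ᶠ ψ) = constants φ ++ constants ψ
  constants (φ ∨ᶠ ψ) = constants φ ++ constants ψ
  constants (φ ⇒ᶠ ψ) = constants φ ++ constants ψ
  constants (∀ᶠ φ)   = constants φ
  constants (∃ᶠ φ)   = constants φ
  constants (◇ᶠ φ)   = constants φ
  constants (□ᶠ φ)   = constants φ

  -- A modality costs `threshold` and not one round: to answer an extension, gap sizes must be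
  -- comparable up to `threshold`, and `Eq D` compares sizes up to `D`.
  rank : ∀ {W n} → Form W n → ℕ
  rank (s ≤ᶠ t) = 0
  rank (s ≐ t)  = 0
  rank ⊥ᶠ       = 0
  rank ⊤ᶠ       = 0
  rank (¬ᶠ φ)   = rank φ
  rank (φ ∧ᶠ ψ) = rank φ ⊔ rank ψ
  rank (φ ∨ᶠ ψ) = rank φ ⊔ rank ψ
  rank (φ ⇒ᶠ ψ) = rank φ ⊔ rank ψ
  rank (∀ᶠ φ)   = suc (rank φ)
  rank (∃ᶠ φ)   = suc (rank φ)
  rank (◇ᶠ φ)   = threshold (rank φ)
  rank (□ᶠ φ)   = threshold (rank φ)

  record Match {W : LO} (R : Seg → Seg → Set) (cs : List (Carrier W)) {U V : LO} (c : Emb W U) (d : Emb W V)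
               {n : ℕ} (ρ : Fin n → Carrier U) (τ : Fin n → Carrier V) : Set where
    constructor match
    field
      pairs      : List (Carrier U × Carrier V)
      chain      : Chain R U V nothing nothing pairs
      constants∈ : ∀ {w} → w ∈ cs → (fun c w , fun d w) ∈ pairs
      variables∈ : ∀ i → (ρ i , τ i) ∈ pairs
  open Match

  module _ {W : LO} {U V : LO} {c : Emb W U} {d : Emb W V} where

    Match-⊆ : ∀ {R cs cs' n} {ρ : Fin n → _} {τ} → (∀ {w} → w ∈ cs' → w ∈ cs) →
              Match R cs c d ρ τ → Match R cs' c d ρ τ
    Match-⊆ h (match zs ch k v) = match zs ch (k ∘ h) v

    Match-sym : ∀ {e cs n} {ρ : Fin n → _} {τ} → Match (Eq e) cs c d ρ τ → Match (Eq e) cs d c τ ρ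
    Match-sym {e} (match zs ch k v) = match (mapᴸ swap zs) (Chain-sym (λ {S} {T} → Eq-sym e {S} {T}) zs ch)
      (λ m → ∈-map⁺ swap (k m)) (λ i → ∈-map⁺ swap (v i))

    Match-move : ∀ {e cs n} {ρ : Fin n → _} {τ} → Match (Eq (suc e)) cs c d ρ τ → ∀ x →
                 Σ[ y ∈ Carrier V ] Match (Eq e) cs c d (extend x ρ) (extend y τ)
    Match-move {e} (match zs ch k v) x =
      let (y , zs' , ch' , m , incl) = move e zs ch tt in
      y , match zs' ch' (λ p → incl (k p)) λ { zero → m ; (suc i) → incl (v i) }

    Match-follow : ∀ {e cs n} {ρ : Fin n → _} {τ} → Match (AtMost (threshold e)) cs c d ρ τ →
                   ∀ {U'} (f : Emb U U') → Σ[ V' ∈ LO ] Σ[ g ∈ Emb V V' ]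
                     Match (Eq e) cs (f ∘E c) (g ∘E d) (λ i → fun f (ρ i)) (λ i → fun g (τ i))
    Match-follow {e} (match zs ch k v) f =
      let (V' , h , zs' , ch' , fol) = follow e f zs ch in
      V' , Embeds⇒Emb (Embeds-trans (subseg (λ _ _ → tt , tt)) h) ,
      match zs' ch' (λ p → proj₂ (fol (k p))) (λ i → proj₂ (fol (v i)))

    Match-term : ∀ {R cs n} {ρ : Fin n → _} {τ} (M : Match R cs c d ρ τ) (t : Term W n) →
                 (∀ {w} → w ∈ termConstants t → w ∈ cs) → (⟦ t ⟧ₜ c ρ , ⟦ t ⟧ₜ d τ) ∈ pairs M
    Match-term M (var i) h = variables∈ M i
    Match-term M (con w) h = constants∈ M (h (here refl))

  Eq⇒AtMost : ∀ {N D S T} → N ℕ.≤ D → Eq D S T → AtMost N S T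
  Eq⇒AtMost {D = D} p e k k≤N a = AtLeast-Eq k (Eq-≤ (ℕ.≤-trans k≤N p) (Eq-sym D e)) a

  Match-AtMost : ∀ {W U V} {c : Emb W U} {d : Emb W V} {N D cs n} {ρ : Fin n → _} {τ} → N ℕ.≤ D →
                 Match (Eq D) cs c d ρ τ → Match (AtMost N) cs c d ρ τ
  Match-AtMost p (match zs ch k v) = match zs (Chain-map (λ {S} {T} → Eq⇒AtMost {S = S} {T} p) zs ch) k v

  -- Quantifiers use up a round of the game. At a modality the game is reduced to gap sizes, from
  -- which `Match-follow` rebuilds a game of length `rank φ` on the extensions.
  agree : ∀ {W U V n} (φ : Form W n) {c : Emb W U} {d : Emb W V} {D} {ρ : Fin n → Carrier U} {τ : Fin n → Carrier V} →
          rank φ ℕ.≤ D → Match (Eq D) (constants φ) c d ρ τ → Sat U c ρ φ → Sat V d τ φ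
  agree (s ≤ᶠ t) r M (lift p) = lift (Chain-≤ (pairs M) (chain M)
    (Match-term M s ∈-++⁺ˡ) (Match-term M t (∈-++⁺ʳ (termConstants s))) p)
  agree {U = U} {V} (s ≐ t) r M (lift p) = lift (Order.≤-antisym V
    (Chain-≤ (pairs M) (chain M) s∈ t∈ (Order.≤-reflexive U p))
    (Chain-≤ (pairs M) (chain M) t∈ s∈ (Order.≤-reflexive U (sym p))))
    where s∈ = Match-term M s ∈-++⁺ˡ
          t∈ = Match-term M t (∈-++⁺ʳ (termConstants s))
  agree ⊤ᶠ r M p = p
  agree (¬ᶠ φ) r M k p = k (agree φ r (Match-sym M) p)
  agree (φ ∧ᶠ ψ) r M (p , q) =
    agree φ (ℕ.m⊔n≤o⇒m≤o _ _ r) (Match-⊆ ∈-++⁺ˡ M) p ,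
    agree ψ (ℕ.m⊔n≤o⇒n≤o (rank φ) _ r) (Match-⊆ (∈-++⁺ʳ (constants φ)) M) q
  agree (φ ∨ᶠ ψ) r M (inj₁ p) = inj₁ (agree φ (ℕ.m⊔n≤o⇒m≤o _ _ r) (Match-⊆ ∈-++⁺ˡ M) p)
  agree (φ ∨ᶠ ψ) r M (inj₂ q) = inj₂ (agree ψ (ℕ.m⊔n≤o⇒n≤o (rank φ) _ r) (Match-⊆ (∈-++⁺ʳ (constants φ)) M) q)
  agree (φ ⇒ᶠ ψ) r M k p = agree ψ (ℕ.m⊔n≤o⇒n≤o (rank φ) _ r) (Match-⊆ (∈-++⁺ʳ (constants φ)) M)
    (k (agree φ (ℕ.m⊔n≤o⇒m≤o _ _ r) (Match-sym (Match-⊆ ∈-++⁺ˡ M)) p))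
  agree (∀ᶠ φ) (s≤s r) M k y = let (x , M') = Match-move (Match-sym M) y in agree φ r (Match-sym M') (k x)
  agree (∃ᶠ φ) (s≤s r) M (x , p) = let (y , M') = Match-move M x in y , agree φ r M' p
  agree (◇ᶠ φ) r M (U' , f , p) =
    let (V' , g , M') = Match-follow (Match-AtMost r M) f in V' , g , agree φ ℕ.≤-refl M' p
  agree (□ᶠ φ) r M k V' g =
    let (U' , f , M') = Match-follow (Match-AtMost r (Match-sym M)) g in agree φ ℕ.≤-refl (Match-sym M') (k U' f)

  -- Every extension of `B` has to be imitated by one of `A`, never the converse, so it is enough
  -- that the gaps of `A` are not larger. This is why necessities are monotone in the gap sizes.
  □-preserved : ∀ {W} {A B : Over W} φ {N} → threshold (rank φ) ℕ.≤ N → Match (AtMost N) (constants φ) (Over.emb B) (Over.emb A) (Over.env B) (Over.env A) →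
                SatOver A (□ᶠ φ) → SatOver B (□ᶠ φ)
  □-preserved {A = A} {B} φ {N} r (match zs ch k v) p B' g =
    let M = match zs (Chain-map (λ {S} {T} h k q → h k (ℕ.≤-trans q r)) zs ch) k v
        (A' , f , M') = Match-follow {c = Over.emb B} {d = Over.emb A} {e = rank φ} M g
    in agree φ ℕ.≤-refl (Match-sym M') (p A' f)

-- Forks and adjacent pairs

⋀ : ∀ {n} → (Fin n → PForm) → PForm
⋀ {zero} f = ⊤ₚ
⋀ {suc n} f = f zero ∧ₚ ⋀ (f ∘ suc)

forces-⋀ : ∀ {a} (M : Model a) w {n} (f : Fin n → PForm) → forces M w (⋀ f) ⇔ (∀ i → forces M w (f i))
forces-⋀ M w {zero} f = mk⇔ (λ _ ()) (λ _ → lift tt)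
forces-⋀ M w {suc n} f = mk⇔
  (λ { (p , q) zero → p ; (p , q) (suc i) → to (forces-⋀ M w (f ∘ suc)) q i })
  (λ h → h zero , from (forces-⋀ M w (f ∘ suc)) (h ∘ suc))

module _ (n : ℕ) where

  box-at : Fin n → PForm
  box-at i = □ₚ (pvar (toℕ i))

  quiet : PForm
  quiet = ⋀ {n} (λ i → ¬ₚ box-at i)

  forces-quiet : ∀ {a} (M : Model a) w → forces M w quiet ⇔ (∀ i → ¬ forces M w (box-at i))
  forces-quiet M w = forces-⋀ M w (λ i → ¬ₚ box-at i)

  only : Fin n → PForm
  only i = box-at i ∧ₚ ⋀ {n} (λ j → if does (i ≟ j) then ⊤ₚ else (¬ₚ box-at j))

  -- The n boxes cannot all stay unpushed while each of them can always be pushed alone.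
  noFork : PForm
  noFork = ¬ₚ (quiet ∧ₚ □ₚ (quiet ⇒ₚ ⋀ (λ i → ◇ₚ (only i))))

  forces-only : ∀ {a} (M : Model a) w i → forces M w (only i) ⇔
                (forces M w (box-at i) × (∀ j → i ≢ j → ¬ forces M w (box-at j)))
  forces-only M w i = mk⇔
    (λ (p , q) → p , λ j k → there′ j k (to (forces-⋀ M w rest) q j))
    (λ (p , q) → p , from (forces-⋀ M w rest) (λ j → back′ j (q j)))
    where
    rest : Fin n → PForm
    rest j = if does (i ≟ j) then ⊤ₚ else (¬ₚ box-at j)
    there′ : ∀ j → i ≢ j → forces M w (if does (i ≟ j) then ⊤ₚ else (¬ₚ box-at j)) → ¬ forces M w (box-at j)
    there′ j k with i ≟ j
    ... | yes e = ⊥-elim (k e)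
    ... | no _ = id
    back′ : ∀ j → (i ≢ j → ¬ forces M w (box-at j)) → forces M w (if does (i ≟ j) then ⊤ₚ else (¬ₚ box-at j))
    back′ j q with i ≟ j
    ... | yes _ = lift tt
    ... | no k = q k

  data ForkPoint : Set where
    bottom apex : ForkPoint
    prong       : Fin n → ForkPoint

  data _⊑ᶠ_ : ForkPoint → ForkPoint → Set where
    bottom⊑ : ∀ {x} → bottom ⊑ᶠ x
    prong⊑  : ∀ {i} → prong i ⊑ᶠ prong i
    ⊑apex   : ∀ {x} → x ⊑ᶠ apex

  fork : Model 0ℓ
  fork = record { World = ForkPoint ; _↝_ = _⊑ᶠ_ ; val = forkVal }
    where
    forkVal : ForkPoint → ℕ → Set
    forkVal bottom _ = ⊥
    forkVal (prong i) k = toℕ i ≡ k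
    forkVal apex _ = ⊤

  fork-directed : DirectedPreorder fork
  fork-directed = record
    { ↝-refl = λ { bottom → bottom⊑ ; (prong i) → prong⊑ ; apex → ⊑apex }
    ; ↝-trans = λ { bottom⊑ _ → bottom⊑ ; prong⊑ q → q ; ⊑apex ⊑apex → ⊑apex }
    ; ↝-directed = λ _ _ → apex , ⊑apex , ⊑apex }

  fork-refutes : ¬ forces fork bottom noFork
  fork-refutes k = k (from (forces-quiet fork bottom) (λ i b → b bottom bottom⊑) ,
    λ w _ q → from (forces-⋀ fork w (λ i → ◇ₚ (only i))) (possible w q))
    where
    pushed : ∀ i → forces fork (prong i) (box-at i)
    pushed i (prong j) prong⊑ = refl
    pushed i apex ⊑apex = tt
    possible : ∀ w → forces fork w quiet → ∀ i → forces fork w (◇ₚ (only i))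
    possible bottom q i = prong i , bottom⊑ , from (forces-only fork (prong i) i)
      (pushed i , λ j k b → k (toℕ-injective (b (prong i) prong⊑)))
    possible (prong j) q i = ⊥-elim (to (forces-quiet fork (prong j)) q j (pushed j))
    possible apex q i = ⊥-elim (to (forces-quiet fork apex) q i λ { apex ⊑apex → tt })

  noFork∉S4·2 : ExcludedMiddle 0ℓ → ¬ S4·2 noFork
  noFork∉S4·2 em d = fork-refutes (S4·2-sound em fork fork-directed d bottom)

-- Counting points, adjacent pairs and gaps

module Counting (em : ExcludedMiddle 0ℓ) where
  open EF em
  open Elimination em

  Embeds-above : ∀ {S T} (g : Embeds S T) {x} m → Embeds (above S x) (above T (fn g x m))
  Embeds-above g m = record
    { fn = λ z (mz , _) → fn g z mz
    ; fn∈ = λ z (mz , l) → fn∈ g z mz , fn-< g m mz l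
    ; fn-≤ = λ (mz , _) (mz' , _) → fn-≤ g mz mz'
    ; fn-< = λ (mz , _) (mz' , _) → fn-< g mz mz' }

  Image : ∀ {S T} → Embeds S T → Pt T → Set
  Image {S} g y = Σ[ x ∈ Pt S ] Σ[ m ∈ mem S x ] (fn g x m ≡ y)

  fn-reflect-< : ∀ {S T} (g : Embeds S T) {x y} m m' → lt (host T) (fn g x m) (fn g y m') → lt (host S) x y
  fn-reflect-< g m m' l p = l (fn-≤ g m' m p)

  inverse : ∀ {S T} (g : Embeds S T) → (∀ y → mem T y → Image g y) → Embeds T S
  inverse {S} {T} g h = record
    { fn = λ y m → proj₁ (h y m)
    ; fn∈ = λ y m → proj₁ (proj₂ (h y m))
    ; fn-≤ = λ {y} {y'} m m' p → let (x , mx , e) = h y m ; (x' , mx' , e') = h y' m' in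
        by-contradiction em (λ l → fn-< g mx' mx l (subst₂ (_≤_ (host T)) (sym e) (sym e') p))
    ; fn-< = λ {y} {y'} m m' l → let (x , mx , e) = h y m ; (x' , mx' , e') = h y' m' in
        λ p → l (subst₂ (_≤_ (host T)) e' e (fn-≤ g mx' mx p)) }

  one-more : ∀ k {S T} (g : Embeds S T) {v} → mem T v → (∀ x m → fn g x m ≢ v) → AtLeast k S → AtLeast (suc k) T
  one-more zero g {v} mv new _ = v , mv , tt
  one-more (suc k) {S} {T} g {v} mv new (x , m , a) with StrictOrder.compare em (host T) v (fn g x m)
  ... | StrictOrder.equal e = ⊥-elim (new x m (sym e))
  ... | StrictOrder.less l = v , mv , fn g x m , (fn∈ g x m , l) ,
        AtLeast-Embeds k (Embeds-trans (Embeds-above g m)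
          (subseg (λ z (mz , q) → (mz , Order.<-trans (host T) l q) , q))) a
  ... | StrictOrder.greater l = fn g x m , fn∈ g x m ,
        one-more k (Embeds-above g m) (mv , l) (λ z (mz , _) → new z mz) a

  one-less : ∀ k {S T} (g : Embeds S T) v → (∀ y → mem T y → Image g y ⊎ y ≡ v) → AtLeast (suc k) T → AtLeast k S
  one-less zero g v cov _ = tt
  one-less (suc k) {S} {T} g v cov (y , my , a) with cov y my
  ... | inj₂ refl = AtLeast-Embeds (suc k) back a
    where
    back : Embeds (above T v) S
    back = Embeds-trans (inverse (record
      { fn = λ x (m , _) → fn g x m ; fn∈ = λ x (m , l) → fn∈ g x m , l
      ; fn-≤ = λ (m , _) (m' , _) → fn-≤ g m m' ; fn-< = λ (m , _) (m' , _) → fn-< g m m' }) image) (subseg (λ _ → proj₁))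
      where
      image : ∀ z → mem (above T v) z → Σ[ x ∈ Pt S ] Σ[ m ∈ (Σ[ mx ∈ mem S x ] lt (host T) v (fn g x mx)) ] (fn g x (proj₁ m) ≡ z)
      image z (mz , l) with cov z mz
      ... | inj₁ (x , m , refl) = x , (m , l) , refl
      ... | inj₂ refl = ⊥-elim (l (Order.≤-refl (host T)))
  ... | inj₁ (x , m , refl) = x , m , one-less k (Embeds-above g m) v cov' a
    where
    cov' : ∀ z → mem (above T (fn g x m)) z → Image (Embeds-above g m) z ⊎ z ≡ v
    cov' z (mz , l) with cov z mz
    ... | inj₁ (x' , m' , refl) = inj₁ (x' , (m' , fn-reflect-< g m m' l) , refl)
    ... | inj₂ e = inj₂ e

  -- If some `z` lies strictly between, the part below `z` has fewer points, so the descent ends at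
  -- an adjacent pair. An empty gap yields its own end points.
  adjacentIn : ∀ (W : LO) k {a b} → lt W a b → ¬ AtLeast k (between W (just a) (just b)) →
               Σ[ x ∈ Carrier W ] Σ[ y ∈ Carrier W ] (_≤_ W a x × _≤_ W y b × Adjacent W x y)
  adjacentIn W zero l k = ⊥-elim (k tt)
  adjacentIn W (suc n) {a} {b} l k with em {Σ[ z ∈ Carrier W ] (lt W a z × lt W z b)}
  ... | no none = a , b , ≤-refl , ≤-refl , (<⇒≤ l , <⇒≢ l) ,
        λ (z , (p , q) , (p' , q')) → none (z , ≤∧≢⇒< p q , ≤∧≢⇒< p' q')
    where open Order W
  ... | yes (z , p , q) =
        let (x , y , ax , yz , adj) = adjacentIn W n p (λ c → k (AtLeast-below n _ {z} (p , q)
              (AtLeast-Embeds n (subseg (λ w (r , s) → (r , Order.<-trans W s q) , s)) c)))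
        in x , y , ax , Order.≤-trans W yz (Order.<⇒≤ W q) , adj

  enumerate : ∀ W n →
    (Σ[ l ∈ List (Carrier W × Carrier W) ] (∀ a b → Adjacent W a b → (a , b) ∈ l)) ⊎
    (Σ[ f ∈ (Fin n → Carrier W × Carrier W) ] (Injective _≡_ _≡_ f × (∀ i → Adjacent W (proj₁ (f i)) (proj₂ (f i)))))
  enumerate W zero = inj₂ ((λ ()) , (λ { {()} }) , λ ())
  enumerate W (suc n) with enumerate W n
  ... | inj₁ l = inj₁ l
  ... | inj₂ (f , inj , adj) with em {Σ[ a ∈ Carrier W ] Σ[ b ∈ Carrier W ] (Adjacent W a b × ¬ ((a , b) ∈ tabulateᴸ f))}
  ... | no none = inj₁ (tabulateᴸ f , λ a b ab → by-contradiction em (λ k → none (a , b , ab , k)))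
  ... | yes (a , b , ab , new) = inj₂ (f⁺ , inj⁺ , adj⁺)
    where
    f⁺ : Fin (suc n) → Carrier W × Carrier W
    f⁺ zero = a , b
    f⁺ (suc i) = f i
    inj⁺ : Injective _≡_ _≡_ f⁺
    inj⁺ {zero} {zero} _ = refl
    inj⁺ {zero} {suc j} e = ⊥-elim (new (subst (_∈ tabulateᴸ f) (sym e) (∈-tabulate⁺ {f = f} j)))
    inj⁺ {suc i} {zero} e = ⊥-elim (new (subst (_∈ tabulateᴸ f) e (∈-tabulate⁺ {f = f} i)))
    inj⁺ {suc i} {suc j} e = cong suc (inj e)
    adj⁺ : ∀ i → Adjacent W (proj₁ (f⁺ i)) (proj₂ (f⁺ i))
    adj⁺ zero = ab
    adj⁺ (suc i) = adj i

  module Gaps (W : LO) where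

    Sorted : Maybe (Carrier W) → List (Carrier W) → Set
    Sorted a [] = ⊤
    Sorted a (x ∷ xs) = LoBound W a x × Sorted (just x) xs

    insert : ∀ x xs {a} → LoBound W a x → Sorted a xs →
             Σ[ ys ∈ List (Carrier W) ] (Sorted a ys × x ∈ ys × (∀ {w} → w ∈ xs → w ∈ ys))
    insert x [] l _ = x ∷ [] , (l , tt) , here refl , λ ()
    insert x (y ∷ xs) l (l' , s) with StrictOrder.compare em W x y
    ... | StrictOrder.less p = x ∷ y ∷ xs , (l , p , s) , here refl , there
    ... | StrictOrder.equal refl = y ∷ xs , (l' , s) , here refl , id
    ... | StrictOrder.greater p = let (ys , s' , m , incl) = insert x xs p s in
          y ∷ ys , (l' , s') , there m , λ { (here e) → here e ; (there q) → there (incl q) }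

    sort : ∀ xs → Σ[ ys ∈ List (Carrier W) ] (Sorted nothing ys × (∀ {w} → w ∈ xs → w ∈ ys))
    sort [] = [] , tt , λ ()
    sort (x ∷ xs) = let (ys , s , incl) = sort xs ; (zs , s' , m , incl') = insert x ys tt s in
      zs , s' , λ { (here refl) → m ; (there q) → incl' (incl q) }

    gap : Maybe (Carrier W) → (s : List (Carrier W)) → Fin (suc (length s)) → Maybe (Carrier W) × Maybe (Carrier W)
    gap a [] _ = a , nothing
    gap a (c ∷ s) zero = a , just c
    gap a (c ∷ s) (suc j) = gap (just c) s j

    gap-bound : ∀ s {a} → Sorted a s → ∀ j {b} → proj₂ (gap a s j) ≡ just b → LoBound W (proj₁ (gap a s j)) b
    gap-bound (c ∷ s) (l , _) zero refl = l
    gap-bound (c ∷ s) (_ , o) (suc j) e = gap-bound s o j e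

    gap-lower : ∀ s {c} → Sorted (just c) s → ∀ j → Σ[ l ∈ Carrier W ] (proj₁ (gap (just c) s j) ≡ just l × _≤_ W c l)
    gap-lower [] {c} _ j = c , refl , Order.≤-refl W
    gap-lower (d ∷ s) {c} (p , o) zero = c , refl , Order.≤-refl W
    gap-lower (d ∷ s) (p , o) (suc j) = let (l , e , q) = gap-lower s o j in
      l , e , Order.≤-trans W (Order.<⇒≤ W p) q

    Precedes : (g g' : Maybe (Carrier W) × Maybe (Carrier W)) → Set
    Precedes g g' = Σ[ h ∈ Carrier W ] Σ[ l ∈ Carrier W ] (proj₂ g ≡ just h × proj₁ g' ≡ just l × _≤_ W h l)

    gap-order : ∀ s {a} → Sorted a s → ∀ i j → toℕ i ℕ.< toℕ j → Precedes (gap a s i) (gap a s j)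
    gap-order [] o zero zero ()
    gap-order (c ∷ s) (_ , o) zero (suc j) _ = let (l , e , q) = gap-lower s o j in c , l , refl , e , q
    gap-order (c ∷ s) (_ , o) (suc i) (suc j) (s≤s p) = gap-order s o i j p

    gapIn : Over W → Maybe (Carrier W) × Maybe (Carrier W) → Seg
    gapIn A (a , b) = between (ord A) (Maybe.map (fun (emb A)) a) (Maybe.map (fun (emb A)) b)

    gaps-disjoint : ∀ (A : Over W) {g g' v} → Precedes g g' → mem (gapIn A g) v → ¬ mem (gapIn A g') v
    gaps-disjoint A {_ , just h} {just l , _} (_ , _ , refl , refl , h≤l) (_ , p) (q , _) =
      <-irrefl (<-≤-trans p (≤-trans (mono (emb A) h≤l) (<⇒≤ q)))
      where open Order (ord A)

    gap-Chain : ∀ {R} (A B : Over W) s {a} → Sorted a s → (∀ j → R (gapIn A (gap a s j)) (gapIn B (gap a s j))) →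
                Chain R (ord A) (ord B) (Maybe.map (fun (emb A)) a) (Maybe.map (fun (emb B)) a)
                      (mapᴸ (λ w → fun (emb A) w , fun (emb B) w) s)
    gap-Chain A B [] o h = h zero
    gap-Chain A B (c ∷ s) {a} (l , o) h =
      emb-LoBound (emb A) a l , emb-LoBound (emb B) a l , h zero , gap-Chain A B s o (h ∘ suc)

    ⇢-gap : ∀ {A B : Over W} → A ⇢ B → ∀ g → Embeds (gapIn A g) (gapIn B g)
    ⇢-gap {A} {B} (f , e) (a , b) = record
      { fn = λ x _ → fun f x
      ; fn∈ = λ x (p , q) → lo a p , hi b q
      ; fn-≤ = λ _ _ → mono f
      ; fn-< = λ _ _ → emb-< f }
      where
      lo : ∀ a {x} → LoBound (ord A) (Maybe.map (fun (emb A)) a) x → LoBound (ord B) (Maybe.map (fun (emb B)) a) (fun f x)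
      lo nothing _ = tt
      lo (just a) p = subst (λ y → lt (ord B) y _) (sym (e a)) (emb-< f p)
      hi : ∀ b {x} → HiBound (ord A) (Maybe.map (fun (emb A)) b) x → HiBound (ord B) (Maybe.map (fun (emb B)) b) (fun f x)
      hi nothing _ = tt
      hi (just b) p = subst (λ y → lt (ord B) _ y) (sym (e b)) (emb-< f p)

    gap-reflect : ∀ {A B : Over W} (r : A ⇢ B) g {x} → mem (gapIn B g) (fun (proj₁ r) x) → mem (gapIn A g) x
    gap-reflect {A} {B} (f , e) (a , b) (p , q) = lo a p , hi b q
      where
      lo : ∀ a {x} → LoBound (ord B) (Maybe.map (fun (emb B)) a) (fun f x) → LoBound (ord A) (Maybe.map (fun (emb A)) a) x
      lo nothing _ = tt
      lo (just a) {x} p = reflect-< f (subst (λ y → lt (ord B) y (fun f x)) (e a) p)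
      hi : ∀ b {x} → HiBound (ord B) (Maybe.map (fun (emb B)) b) (fun f x) → HiBound (ord A) (Maybe.map (fun (emb A)) b) x
      hi nothing _ = tt
      hi (just b) {x} p = reflect-< f (subst (λ y → lt (ord B) (fun f x) y) (e b) p)

    collect : ∀ m (φ : Fin m → Sentence W) → Σ[ cs ∈ List (Carrier W) ] Σ[ N ∈ ℕ ]
              (∀ i → (∀ {w} → w ∈ constants (φ i) → w ∈ cs) × threshold (rank (φ i)) ℕ.≤ N)
    collect zero φ = [] , 0 , λ ()
    collect (suc m) φ = let (cs , N , h) = collect m (φ ∘ suc) in
      constants (φ zero) ++ cs , threshold (rank (φ zero)) ⊔ N ,
      λ { zero → ∈-++⁺ˡ , ℕ.m≤m⊔n _ N
        ; (suc i) → (λ p → ∈-++⁺ʳ (constants (φ zero)) (proj₁ (h i) p)) , ℕ.≤-trans (proj₂ (h i)) (ℕ.m≤n⊔m _ N) }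

-- Validity of the fork formula over finitely many adjacent pairs

module FinitelyManyPairs
  (em : ExcludedMiddle (lsuc 0ℓ)) {W : LO}
  (l : List (Carrier W × Carrier W)) (complete : ∀ a b → Adjacent W a b → (a , b) ∈ l)
  (m : ℕ) (l<m : 2 ℕ.+ length l ℕ.< m)
  (σ : ℕ → Sentence W)
  (cs : List (Carrier W)) (cs-sorted : Counting.Gaps.Sorted (lower-em em) W nothing cs)
  (N : ℕ)
  (bounds : ∀ (i : Fin m) → (∀ {w} → w ∈ Elimination.constants (lower-em em) (σ (toℕ i)) → w ∈ cs) ×
                  Elimination.threshold (lower-em em) (Elimination.rank (lower-em em) (σ (toℕ i))) ℕ.≤ N)
  where
  private
    em₀ : ExcludedMiddle 0ℓ
    em₀ = lower-em em
    M = loModel σ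
  open EF em₀
  open Elimination em₀
  open Counting em₀
  open Gaps W

  BoxPushed : Fin m → Over W → Set₁
  BoxPushed i A = forces M A (box-at m i)

  Quiet : Over W → Set₁
  Quiet A = ∀ i → ¬ BoxPushed i A

  Index : Set
  Index = Fin (suc (length cs))

  gapAt : Index → Maybe (Carrier W) × Maybe (Carrier W)
  gapAt = gap nothing cs

  gapOf : Over W → Index → Seg
  gapOf A j = gapIn A (gapAt j)

  pushed-mono : ∀ {A B} i → A ⇢ B → BoxPushed i A → BoxPushed i B
  pushed-mono {A} {B} i r p C s = p C (⇢-trans {A = A} {B} {C} r s)

  pushed-gaps : ∀ {A B} i → (∀ j → AtMost N (gapOf B j) (gapOf A j)) → BoxPushed i A → BoxPushed i B
  pushed-gaps {A} {B} i h p = to (inst⇔forces σ (box-at m i) B)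
    (□-preserved {A = A} {B} (σ (toℕ i)) (proj₂ (bounds i))
      (match _ (gap-Chain B A cs cs-sorted h)
        (λ w∈ → ∈-map⁺ _ (proj₁ (bounds i) w∈)) (λ ()))
      (from (inst⇔forces σ (box-at m i) A) p))

  gap-mono : ∀ {A B} → A ⇢ B → ∀ j k → AtLeast k (gapOf A j) → AtLeast k (gapOf B j)
  gap-mono {A} {B} r j k = AtLeast-Embeds k (⇢-gap {A = A} {B} r (gapAt j))

  -- A quiet extension in which no gap can grow further (up to size N) without pushing a box.
  Saturated : Over W → List (Index × ℕ) → Set₁
  Saturated A ix = ∀ {j k} → (j , k) ∈ ix → AtLeast k (gapOf A j) ⊎ (∀ B → A ⇢ B → Quiet B → ¬ AtLeast k (gapOf B j))

  -- Both alternatives of `Saturated` persist in extensions, so the finitely many conditions can be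
  -- settled one after another.
  saturate : ∀ ix → Quiet (base W) → Σ[ A ∈ Over W ] ((base W ⇢ A) × Quiet A × Saturated A ix)
  saturate [] q = base W , ⇢-refl (base W) , q , λ ()
  saturate ((j , k) ∷ ix) q with saturate ix q
  ... | A , r , qA , sat with em {Σ[ B ∈ Over W ] ((A ⇢ B) × Quiet B × AtLeast k (gapOf B j))}
  ... | no none = A , r , qA , λ { (here refl) → inj₂ (λ B s qB a → none (B , s , qB , a)) ; (there p) → sat p }
  ... | yes (B , s , qB , a) = B , ⇢-trans {A = base W} {A} {B} r s , qB , λ { (here refl) → inj₁ a ; (there p) → keep (sat p) }
    where
    keep : ∀ {j k} → AtLeast k (gapOf A j) ⊎ (∀ C → A ⇢ C → Quiet C → ¬ AtLeast k (gapOf C j)) →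
           AtLeast k (gapOf B j) ⊎ (∀ C → B ⇢ C → Quiet C → ¬ AtLeast k (gapOf C j))
    keep {j} {k} (inj₁ b) = inj₁ (gap-mono {A} {B} s j k b)
    keep (inj₂ h) = inj₂ (λ C t → h C (⇢-trans {A = A} {B} {C} s t))

  record OnePoint (A B : Over W) (j : Index) : Set where
    field
      arrow  : A ⇢ B
      point  : Carrier (ord B)
      point∈ : mem (gapOf B j) point
      new    : ∀ x → fun (proj₁ arrow) x ≢ point
      cover  : ∀ y → (Σ[ x ∈ Carrier (ord A) ] (fun (proj₁ arrow) x ≡ y)) ⊎ y ≡ point
  open OnePoint

  module _ {A B : Over W} {j : Index} (o : OnePoint A B j) where
    private
      g : ∀ j' → Embeds (gapOf A j') (gapOf B j')
      g j' = ⇢-gap {A = A} {B} (arrow o) (gapAt j')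

      covered : ∀ j' y → mem (gapOf B j') y → Image (g j') y ⊎ y ≡ point o
      covered j' y my with cover o y
      ... | inj₁ (x , refl) = inj₁ (x , gap-reflect {A = A} {B} (arrow o) (gapAt j') my , refl)
      ... | inj₂ e = inj₂ e

    gap-grows : ∀ k → AtLeast k (gapOf A j) → AtLeast (suc k) (gapOf B j)
    gap-grows k = one-more k (g j) (point∈ o) (λ x _ → new o x)

    gap-shrinks : ∀ k → AtLeast (suc k) (gapOf B j) → AtLeast k (gapOf A j)
    gap-shrinks k = one-less k (g j) (point o) (covered j)

    gap-other : ∀ j' k → j' ≢ j → AtLeast k (gapOf B j') → AtLeast k (gapOf A j')
    gap-other j' k j'≢j = AtLeast-Embeds k (inverse (g j') image)
      where
      outside : ¬ mem (gapOf B j') (point o)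
      outside p with <-cmp j' j
      ... | tri< a _ _ = gaps-disjoint B {gapAt j'} {gapAt j} (gap-order cs cs-sorted j' j a) p (point∈ o)
      ... | tri≈ _ e _ = j'≢j e
      ... | tri> _ _ a = gaps-disjoint B {gapAt j} {gapAt j'} (gap-order cs cs-sorted j j' a) (point∈ o) p
      image : ∀ y → mem (gapOf B j') y → Image (g j') y
      image y my with covered j' y my
      ... | inj₁ i = i
      ... | inj₂ refl = ⊥-elim (outside my)

  -- Only the number of points in a gap counts, so it does not matter where in gap `j` the two new
  -- points were placed.
  OnePoint-AtMost : ∀ {A B C j} → OnePoint A B j → OnePoint A C j → ∀ j' k → AtLeast k (gapOf B j') → AtLeast k (gapOf C j')
  OnePoint-AtMost o o' j' zero _ = tt
  OnePoint-AtMost {A} {B} {C} {j} o o' j' (suc k) a with j' ≟ j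
  ... | yes refl = gap-grows {A} {C} {j'} o' k (gap-shrinks {A} {B} {j'} o k a)
  ... | no ne = gap-mono {A} {C} (arrow o') j' (suc k) (gap-other {A} {B} {j} o j' (suc k) ne a)

  -- `C` is the suborder of `B` on the image of `A` together with `v`; remaining inside `B`, it can
  -- push no box that `B` does not.
  adjoin : ∀ {A B} (r : A ⇢ B) j v → mem (gapOf B j) v → (∀ x → fun (proj₁ r) x ≢ v) →
           Σ[ C ∈ Over W ] (OnePoint A C j × (C ⇢ B))
  adjoin {A} {B} (f , e) j v v∈ fresh = C , record
      { arrow = g , λ _ → refl
      ; point = sub v (inj₂ refl)
      ; point∈ = gap-reflect {A = C} {B} r (gapAt j) v∈
      ; new = λ x q → fresh x (cong elem q)
      ; cover = cov } , r
    where
    S : Seg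
    S = seg (ord B) (λ y → (Σ[ x ∈ Carrier (ord A) ] (fun f x ≡ y)) ⊎ y ≡ v)
    g : Emb (ord A) (Sub S)
    g = record { fun = λ x → sub (fun f x) (inj₁ (x , refl)) ; mono = mono f ; reflect = reflect f }
    C : Over W
    C = along A (Sub S) g
    r : C ⇢ B
    r = record { fun = elem ; mono = id ; reflect = id } , e
    cov : ∀ y → (Σ[ x ∈ Carrier (ord A) ] (fun g x ≡ y)) ⊎ y ≡ sub v (inj₂ refl)
    -- `h` is irrelevant and cannot be split on; excluded middle supplies the cases again.
    cov (sub y h) with em₀ {(Σ[ x ∈ Carrier (ord A) ] (fun f x ≡ y)) ⊎ y ≡ v}
    ... | yes (inj₁ (x , refl)) = inj₁ (x , refl)
    ... | yes (inj₂ refl) = inj₂ refl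
    ... | no k = ⊥-elim-irr (k h)
      where
      ⊥-elim-irr : ∀ {X : Set} → .⊥ → X
      ⊥-elim-irr ()

  -- The outer gaps get codes of their own, since they may be empty and then supply no pair. An
  -- inner gap counts with its end points, so even an empty one contains a pair.
  data Coded : Maybe (Carrier W) → Maybe (Carrier W) → Fin (2 ℕ.+ length l) → Set where
    first : ∀ {b} → Coded nothing b zero
    last  : ∀ {a} → Coded (just a) nothing (suc zero)
    inner : ∀ {a b x y i} → _≤_ W a x → _≤_ W y b → lt W x y → lookup l i ≡ (x , y) →
            Coded (just a) (just b) (suc (suc i))

  GapCoded : Index → Fin (2 ℕ.+ length l) → Set
  GapCoded j = Coded (proj₁ (gapAt j)) (proj₂ (gapAt j))

  -- Closed gaps share at most an end point, which leaves no room for a common pair `x < y`.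
  Coded-disjoint : ∀ {g g' : Maybe (Carrier W) × Maybe (Carrier W)} {c} → Precedes g g' → Coded (proj₁ g) (proj₂ g) c → ¬ Coded (proj₁ g') (proj₂ g') c
  Coded-disjoint (_ , _ , refl , refl , p) (inner _ y≤h x<y e) (inner k≤x' _ _ e') with trans (sym e) e'
  ... | refl = x<y (Order.≤-trans W y≤h (Order.≤-trans W p k≤x'))

  code : ∀ k a b → (∀ {c} → b ≡ just c → LoBound W a c) → ¬ AtLeast k (gapIn (base W) (a , b)) → ∃ (Coded a b)
  code k nothing b _ _ = zero , first
  code k (just a) nothing _ _ = suc zero , last
  code k (just a) (just b) a<b small =
    let (x , y , ax , yb , adj) = adjacentIn W k (a<b refl) small
        xy∈ = complete x y adj
    in suc (suc (Any.index xy∈)) ,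
       inner ax yb (Order.≤∧≢⇒< W (proj₁ (proj₁ adj)) (proj₂ (proj₁ adj))) (sym (lookup-index xy∈))

  code-injective : ∀ i j {c} → GapCoded i c → GapCoded j c → i ≡ j
  code-injective i j p q with <-cmp i j
  ... | tri≈ _ e _ = e
  ... | tri< i<j _ _ = ⊥-elim (Coded-disjoint {gapAt i} {gapAt j} (gap-order cs cs-sorted i j i<j) p q)
  ... | tri> _ _ j<i = ⊥-elim (Coded-disjoint {gapAt j} {gapAt i} (gap-order cs cs-sorted j i j<i) q p)

  module _ (q₀ : Quiet (base W))
           (alone : ∀ A → base W ⇢ A → Quiet A → ∀ i →
                    Σ[ B ∈ Over W ] ((A ⇢ B) × BoxPushed i B × (∀ j → i ≢ j → ¬ BoxPushed j B))) where
    private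
      ix : List (Index × ℕ)
      -- Sizes up to `N` inclusive, the range that `pushed-gaps` looks at.
      ix = cartesianProduct (allFin (suc (length cs))) (upTo (suc N))
      saturated = saturate ix q₀
      U : Over W
      U = proj₁ saturated
      reach : base W ⇢ U
      reach = proj₁ (proj₂ saturated)
      quietU : Quiet U
      quietU = proj₁ (proj₂ (proj₂ saturated))

    record Step (i : Fin m) : Set₁ where
      field
        index   : Index
        bound   : ℕ
        small   : ¬ AtLeast bound (gapOf U index)
        grown   : Over W
        onePt   : OnePoint U grown index
        pushed  : BoxPushed i grown
        others  : ∀ j → i ≢ j → ¬ BoxPushed j grown
    open Step

    -- Box `i` is pushed in `V` but not in `U`, so some gap has gained a point. Adjoining one such
    -- point gives `C` below `V`, where no box other than `i` can be pushed; saturation of `U` shows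
    -- that some box is.
    step : ∀ i → Step i
    step i with alone U reach quietU i
    ... | V , r , pV , oV with em₀ {Σ[ j ∈ Index ] Σ[ k ∈ ℕ ] (k ℕ.≤ N × AtLeast k (gapOf V j) × ¬ AtLeast k (gapOf U j))}
    ... | no none = ⊥-elim (quietU i (pushed-gaps {V} {U} i
            (λ j k k≤N a → by-contradiction em₀ (λ n → none (j , k , k≤N , a , n))) pV))
    ... | yes (j , k , k≤N , aV , nU) with em₀ {Σ[ v ∈ Carrier (ord V) ] (mem (gapOf V j) v × (∀ x → fun (proj₁ r) x ≢ v))}
    ... | no none = ⊥-elim (nU (AtLeast-Embeds k (inverse (⇢-gap {A = U} {V} r (gapAt j)) image) aV))
      where
      image : ∀ y → mem (gapOf V j) y → Image (⇢-gap {A = U} {V} r (gapAt j)) y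
      image y my with em₀ {Σ[ x ∈ Carrier (ord U) ] (fun (proj₁ r) x ≡ y)}
      ... | yes (x , refl) = x , gap-reflect {A = U} {V} r (gapAt j) my , refl
      ... | no n = ⊥-elim (none (y , my , λ x e → n (x , e)))
    ... | yes (v , v∈ , fresh) with adjoin {U} {V} r j v v∈ fresh
    ... | C , o , s = record
        { index = j ; bound = k ; small = nU ; grown = C ; onePt = o
        ; pushed = by-contradiction em (λ n → loud (λ i' p → n (subst (λ i → BoxPushed i C) (sym (same-box i' p)) p)))
        ; others = λ i' ne p → oV i' ne (pushed-mono {C} {V} i' s p) }
      where
      same-box : ∀ i' → BoxPushed i' C → i ≡ i'
      same-box i' p with i ≟ i'
      ... | yes e = e
      ... | no ne = ⊥-elim (oV i' ne (pushed-mono {C} {V} i' s p))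
      loud : ¬ Quiet C
      -- With `t` the exact size of the gap in `U`, the size `suc t` is at most `N` and is reached
      -- in `C`; saturation forbids this in a quiet extension.
      loud qC = let (t , t<k , a , n) = exactSize k (gapOf U j) nU
                    larger = gap-grows {U} {C} {j} o t a
                    t+1∈ = ∈-cartesianProduct⁺ (∈-allFin j) (∈-upTo⁺ (s≤s (ℕ.≤-trans t<k k≤N)))
                in case (proj₂ (proj₂ (proj₂ saturated)) t+1∈) n larger
        where
        case : ∀ {t} → AtLeast (suc t) (gapOf U j) ⊎ (∀ B → U ⇢ B → Quiet B → ¬ AtLeast (suc t) (gapOf B j)) →
               ¬ AtLeast (suc t) (gapOf U j) → AtLeast (suc t) (gapOf C j) → ⊥
        case (inj₁ b) n _ = n b
        case (inj₂ h) n larger = h C (arrow o) qC larger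

    -- From one gap both extensions have the same gap sizes and so push the same boxes, while each
    -- pushes a single one.
    step-injective : ∀ i i' → index (step i) ≡ index (step i') → i ≡ i'
    step-injective i i' e with i ≟ i'
    ... | yes p = p
    ... | no ne = ⊥-elim (others s' i (ne ∘ sym) (pushed-gaps {grown s} {grown s'} i
            (λ j k _ → OnePoint-AtMost {U} {grown s} {grown s'} (onePt s) (subst (OnePoint U (grown s')) (sym e) (onePt s')) j k)
            (pushed s)))
      where s = step i
            s' = step i'

    impossible : ⊥
    impossible =
      let codeOf i = code (bound (step i)) _ _ (gap-bound cs cs-sorted (index (step i)))
                       (λ a → small (step i) (gap-mono {base W} {U} reach (index (step i)) (bound (step i)) a))
          (i , i' , i<i' , e) = pigeonhole l<m (λ i → proj₁ (codeOf i))
          same-index = code-injective (index (step i)) (index (step i')) (proj₂ (codeOf i))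
                         (subst (Coded _ _) (sym e) (proj₂ (codeOf i')))
      in ℕ.<⇒≢ i<i' (cong toℕ (step-injective i i' same-index))

  noFork-true : forces M (base W) (noFork m)
  noFork-true (q , h) = impossible
    (to (forces-quiet m M (base W)) q)
    (λ A r qA i → let (B , s , p) = to (forces-⋀ M A (λ i → ◇ₚ (only m i))) (h A r (from (forces-quiet m M A) qA)) i
                      (p₁ , p₂) = to (forces-only m M B i) p
                  in B , s , p₁ , p₂)

S4·2⇒infinitelyMany : ExcludedMiddle (lsuc 0ℓ) → ∀ W → (∀ ψ → Val W ψ → S4·2 ψ) → InfinitelyManyAdjacentPairs W
S4·2⇒infinitelyMany em W h n with Counting.enumerate (lower-em em) W n
... | inj₂ f = f
... | inj₁ (l , complete) = ⊥-elim (noFork∉S4·2 m (lower-em em) (h (noFork m) valid))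
  where
  -- One more than the number of codes: two outer gaps and the pairs in `l`. It does not depend on
  -- the substitution.
  m = 3 ℕ.+ length l
  valid : Val W (noFork m)
  valid σ =
    let (cs , N , bounds) = Counting.Gaps.collect (lower-em em) W m (λ i → σ (toℕ i))
        (cs' , sorted , incl) = Counting.Gaps.sort (lower-em em) W cs
    in from (inst⇔forces σ (noFork m) (base W)) (FinitelyManyPairs.noFork-true em l complete m (ℕ.n<1+n _) σ
         cs' sorted N (λ i → (λ p → incl (proj₁ (bounds i) p)) , proj₂ (bounds i)))

theorem6p12 : ExcludedMiddle (lsuc 0ℓ) → (W : LO) →
    ((∀ ψ → (Val W ψ → S4·2 ψ) × (S4·2 ψ → Val W ψ)) ⇔ InfinitelyManyAdjacentPairs W)
theorem6p12 em W = mk⇔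
  (λ h → S4·2⇒infinitelyMany em W (λ ψ → proj₁ (h ψ)))
  (λ inf ψ → Val⊆S4·2 em W inf ψ , S4·2⊆Val em W ψ)
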